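{- Let $p$ be a prime and let $A \subseteq \mathbb{F}_p^*$ with $|A| = \alpha p$ be sum-free (i.e. $A \cap (A+A) = \varnothing$) and satisfy $A = A^*$. Then $\alpha \leqslant 1/9 + o(1)$ as $p \to \infty$.
   Context: $\mathbb{F}_p^* = \mathbb{F}_p\setminus\{0\}$, $A^* = \{a^{ -1}: a\in A\}$, and $A + A = \{a+b : a,b\in A\}$. -}

module Defs where

open import Data.Nat using (ℕ; _+_; _*_)
open import Data.Integer using (+_; _-_)
open import Data.Integer.Divisibility using (_∣_)
open import Data.Fin using (Fin; toℕ)
open import Data.Fin.Subset using (Subset; _∈_)
open import Data.Product using (Σ; _×_)
open import Relation.Binary.PropositionalEquality using (_≢_)
open import Relation.Nullary using (¬_)

-- ModEq p x y : x ≡ y (mod p). Congruence modulo p of natural numbers: p divides x - y (in ℤ).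
-- Elements of 𝔽_p are represented by Fin p (residues 0,…,p-1).
ModEq : ℕ → ℕ → ℕ → Set
ModEq p x y = (+ p) ∣ ((+ x) - (+ y))

AvoidsZero : (p : ℕ) → Subset p → Set
AvoidsZero p A = (x : Fin p) → x ∈ A → toℕ x ≢ 0

-- x ∈ A^* = {a⁻¹ : a ∈ A}, i.e. x = a⁻¹ for some a ∈ A, i.e. a·x = 1 in 𝔽_p
_∈Inv_ : {p : ℕ} → Fin p → Subset p → Set
_∈Inv_ {p} x A = Σ (Fin p) (λ a → (a ∈ A) × ModEq p (toℕ a * toℕ x) 1)

SelfInverse : (p : ℕ) → Subset p → Set
SelfInverse p A = (x : Fin p) → (x ∈ A → x ∈Inv A) × (x ∈Inv A → x ∈ A)

SumFree : (p : ℕ) → Subset p → Set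
SumFree p A = (a b c : Fin p) → a ∈ A → b ∈ A → c ∈ A →
  ¬ ModEq p (toℕ a + toℕ b) (toℕ c)

{-# OPTIONS --safe #-}
module Submission where

-- Write f for the indicator function of A and h(x) for the number of pairs of elements of A with
-- difference x, so that f h = 0 because A is sum-free.  Croot–Sisask sampling yields a set T whose
-- density is bounded below in terms of k, such that h hardly changes in mean square between two shifts
-- by elements of T.  Let S consist of the u for which u + T contains at least |T|/L elements of A.
-- Moving three points of A inside translates of T changes the number of solutions of a + a′ = a″ by
-- little, hence v + w + d = u has few solutions in S for an average d in T, and Pollard's theorem gives
-- |S| ≤ (1/3 + o(1)) p.  Now count the (x, u, v) with x ∈ A ∩ (u + T) ∩ (v + T)*.  Since A = A*, those
-- with u ∉ S or v ∉ S contribute at most 2 p |T|² / L, so that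
-- |A| |T|² ≤ 2 p |T|² / L + Σ_{u,v ∈ S} |(u + T) ∩ (v + T)*|.  Two applications of the second moment
-- method, which reduce to counting points on the conics 1/x − 1/(x − t) = 1/x′ − 1/(x′ − t′), show that
-- |(u + T) ∩ (v + T)*| is close to |T|²/p for almost all (u, v), whence |A| ≤ |S|²/p + o(p).

-- The 1/9 is the square of the 1/3 that Cauchy-Davenport gives for every sum-free set. To multiply
-- the densities, membership in a set and membership of the inverse must behave like independent
-- events; for A itself this fails completely, as A is its own image under inversion. It does hold
-- on average for translates of any dense set T, whatever its structure, which is why A is traded
-- for a set S of centres of translates. The price is that S is only almost sum-free, up to a shift.
-- Cauchy-Davenport breaks down under such a perturbation, while Pollard's theorem counts sums with
-- multiplicity and survives it. No exponential sums occur: the conics pass through the origin, so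
-- their points can be counted by slope. The saving is weaker than from Kloosterman sum bounds, but
-- any saving that grows with p beats losses that depend on k alone. All estimates are integer
-- inequalities with denominators cleared. Where Cauchy-Schwarz would bring in a square root, the
-- inequality between arithmetic and geometric means is used with a free integer parameter (`lam`,
-- later `θ`).

open import Algebra.Bundles using (CommutativeRing)
open import Algebra.Structures using (IsCommutativeRing)
open import Data.Fin using (Fin; zero; suc; toℕ; fromℕ<)
import Data.Fin.Properties as Fin
open import Data.Integer.Tactic.RingSolver using (solve-∀)
open import Data.Nat using (ℕ; zero; suc; z≤n; s≤s) renaming (_+_ to infixl 6 _ℕ+_; _*_ to infixl 7 _ℕ*_)
open import Data.Integer using (ℤ)
import Data.Integer.Properties as ℤₚ
import Data.Nat.Properties as ℕ
open import Data.Product using (∃; Σ; _×_; _,_; proj₁; proj₂)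
open import Data.Sum using (_⊎_; inj₁; inj₂)
open import Function using (_∘_)
open import Relation.Binary.PropositionalEquality
open import Relation.Nullary using (¬_; Dec; yes; no; contradiction)

-- Integer inequalities with explicit slack.

-- ℤ's operations reduce to case distinctions on signs, which makes unification explode on nested
-- expressions; the opaque copies are rigid.
module Arithmetic where

  open import Data.Integer public using (+_; 0ℤ; 1ℤ; _≤_; _<_; +≤+; +<+; _≤?_)
  import Data.Integer as ℤ
  open ℤₚ public using (≤-refl; ≤-reflexive; ≤-trans; ≰⇒>; <⇒≤; <-≤-trans; <-irrefl)

  infixl 6 _+_ _-_
  infixl 7 _*_
  infix 8 -_ _²
  infixr 7.8 _^_

  opaque
    _+_ _*_ : ℤ → ℤ → ℤ
    _+_ = ℤ._+_
    _*_ = ℤ._*_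
    -_ : ℤ → ℤ
    -_ = ℤ.-_

  _-_ : ℤ → ℤ → ℤ
  a - b = a + - b

  _² : ℤ → ℤ
  a ² = a * a

  _^_ : ℤ → ℕ → ℤ
  a ^ zero = 1ℤ
  a ^ suc k = a * a ^ k

  opaque
    unfolding _+_

    +-mono-≤ : ∀ {a b c d} → a ≤ b → c ≤ d → a + c ≤ b + d
    +-mono-≤ = ℤₚ.+-mono-≤

    +-identityˡ : ∀ a → 0ℤ + a ≡ a
    +-identityˡ = ℤₚ.+-identityˡ

    +-identityʳ : ∀ a → a + 0ℤ ≡ a
    +-identityʳ = ℤₚ.+-identityʳ

    *-identityˡ : ∀ a → 1ℤ * a ≡ a
    *-identityˡ = ℤₚ.*-identityˡ

    *-identityʳ : ∀ a → a * 1ℤ ≡ a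
    *-identityʳ = ℤₚ.*-identityʳ

    *-zeroˡ : ∀ a → 0ℤ * a ≡ 0ℤ
    *-zeroˡ = ℤₚ.*-zeroˡ

    *-zeroʳ : ∀ a → a * 0ℤ ≡ 0ℤ
    *-zeroʳ = ℤₚ.*-zeroʳ

    *-comm : ∀ a b → a * b ≡ b * a
    *-comm = ℤₚ.*-comm

    *-assoc : ∀ a b c → a * b * c ≡ a * (b * c)
    *-assoc = ℤₚ.*-assoc

    pos-+ : ∀ m n → + (m ℕ+ n) ≡ + m + + n
    pos-+ = ℤₚ.pos-+

    pos-* : ∀ m n → + (m ℕ* n) ≡ + m * + n
    pos-* = ℤₚ.pos-*

    gap : ∀ {a b} → a ≤ b → 0ℤ ≤ b - a
    gap = ℤₚ.i≤j⇒0≤j-i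

    <⇒1+≤ : ∀ {a b} → a < b → 1ℤ + a ≤ b
    <⇒1+≤ = ℤₚ.i<j⇒suc[i]≤j

    0<⇒1≤ : ∀ {a} → 0ℤ < a → 1ℤ ≤ a
    0<⇒1≤ = ℤₚ.i<j⇒suc[i]≤j

    1≤⇒0< : ∀ {a} → 1ℤ ≤ a → 0ℤ < a
    1≤⇒0< = ℤₚ.suc[i]≤j⇒i<j

    1+≤⇒< : ∀ {a b} → 1ℤ + a ≤ b → a < b
    1+≤⇒< = ℤₚ.suc[i]≤j⇒i<j

    *-cancelˡ : ∀ {k a b} → 0ℤ < k → k * a ≤ k * b → a ≤ b
    *-cancelˡ {k} 0<k = ℤₚ.*-cancelˡ-≤-pos _ _ k {{ℤ.positive 0<k}}

    *-cancelˡ-< : ∀ {k a b} → 0ℤ ≤ k → k * a < k * b → a < b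
    *-cancelˡ-< {k} 0≤k = ℤₚ.*-cancelˡ-<-nonNeg k {{ℤ.nonNegative 0≤k}}

    *-pos : ∀ {a b} → 0ℤ < a → 0ℤ < b → 0ℤ < a * b
    *-pos {a} {b} 0<a 0<b = subst (ℤ._< a * b) (ℤₚ.*-zeroʳ a) (ℤₚ.*-monoˡ-<-pos a {{ℤ.positive 0<a}} 0<b)

    gap⁻¹ : ∀ {a b} → 0ℤ ≤ b - a → a ≤ b
    gap⁻¹ = ℤₚ.0≤i-j⇒j≤i

  1≤⇒0≤ : ∀ {a} → 1ℤ ≤ a → 0ℤ ≤ a
  1≤⇒0≤ = ≤-trans (+≤+ z≤n)

  ≰⇒1+≤ : ∀ {a b} → ¬ (a ≤ b) → 1ℤ + b ≤ a
  ≰⇒1+≤ a≰b = <⇒1+≤ (≰⇒> a≰b)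

  -- The working tool for inequalities: exhibit the difference of the two sides as a visibly
  -- nonnegative `d`, assembled from `gap`, `square-nonneg`, `⊹` and `·`, and leave the identity
  -- `a + d ≡ b` to the ring solver.
  ≤-slack : ∀ {a b} d → 0ℤ ≤ d → a + d ≡ b → a ≤ b
  ≤-slack {a} d 0≤d a+d≡b = subst₂ _≤_ (+-identityʳ a) a+d≡b (+-mono-≤ (≤-refl {a}) 0≤d)

  infixl 6 _⊹_
  infixl 7 _·_
  _⊹_ : ∀ {a b} → 0ℤ ≤ a → 0ℤ ≤ b → 0ℤ ≤ a + b
  _⊹_ {a} {b} 0≤a 0≤b = ≤-trans 0≤a (≤-slack b 0≤b refl)

  _·_ : ∀ {a b} → 0ℤ ≤ a → 0ℤ ≤ b → 0ℤ ≤ a * b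
  _·_ {+ a} {+ b} _ _ = subst (0ℤ ≤_) (pos-* a b) (+≤+ z≤n)

  0≤+ : ∀ n → 0ℤ ≤ + n
  0≤+ n = +≤+ z≤n

  opaque
    unfolding _+_

    square-nonneg : ∀ a → 0ℤ ≤ a ²
    square-nonneg (+ n) = subst (0ℤ ≤_) (ℤₚ.pos-* n n) (+≤+ z≤n)
    square-nonneg (ℤ.negsuc n) = +≤+ z≤n

  am-gm : ∀ a b → + 2 * a * b ≤ a ² + b ²
  am-gm a b = ≤-slack ((a - b) * (a - b)) (square-nonneg (a - b)) (eq a b)
    where
    opaque
      unfolding _+_
      eq : ∀ a b → + 2 * a * b + (a - b) * (a - b) ≡ a * a + b * b
      eq = solve-∀

  *-monoˡ : ∀ {k a b} → 0ℤ ≤ k → a ≤ b → k * a ≤ k * b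
  *-monoˡ {k} {a} {b} 0≤k a≤b = ≤-slack (k * (b - a)) (0≤k · gap a≤b) (eq k a b)
    where
    opaque
      unfolding _+_
      eq : ∀ k a b → k * a + k * (b - a) ≡ k * b
      eq = solve-∀

  *-mono : ∀ {a b c d} → 0ℤ ≤ a → 0ℤ ≤ d → a ≤ b → c ≤ d → a * c ≤ b * d
  *-mono {a} {b} {c} {d} 0≤a 0≤d a≤b c≤d =
    ≤-slack _ (0≤a · gap c≤d ⊹ gap a≤b · 0≤d) (eq a b c d)
    where
    opaque
      unfolding _+_
      eq : ∀ a b c d → a * c + (a * (d - c) + (b - a) * d) ≡ b * d
      eq = solve-∀

-- Finite sums and 0/1-valued indicator functions.

module Sums where

  open import Data.Fin.Permutation using (permutation)
  open Arithmetic
  import Algebra.Properties.Semiring.Sum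
  private module S = Algebra.Properties.Semiring.Sum ℤₚ.+-*-semiring

  opaque
    unfolding _+_

    ∑ : ∀ {n} → (Fin n → ℤ) → ℤ
    ∑ = S.sum

    ∑-zero-dim : (f : Fin 0 → ℤ) → ∑ f ≡ 0ℤ
    ∑-zero-dim f = refl

    ∑-suc : ∀ {n} (f : Fin (suc n) → ℤ) → ∑ f ≡ f zero + ∑ (λ x → f (suc x))
    ∑-suc f = refl

    ∑-cong : ∀ {n} {f g : Fin n → ℤ} → (∀ x → f x ≡ g x) → ∑ f ≡ ∑ g
    ∑-cong = S.sum-cong-≗

    ∑-+ : ∀ {n} (f g : Fin n → ℤ) → ∑ (λ x → f x + g x) ≡ ∑ f + ∑ g
    ∑-+ = S.∑-distrib-+

    ∑-*ˡ : ∀ {n} c (f : Fin n → ℤ) → ∑ (λ x → c * f x) ≡ c * ∑ f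
    ∑-*ˡ c f = sym (S.*-distribˡ-sum c f)

    ∑-*ʳ : ∀ {n} (f : Fin n → ℤ) c → ∑ (λ x → f x * c) ≡ ∑ f * c
    ∑-*ʳ f c = sym (S.*-distribʳ-sum c f)

    ∑-comm : ∀ {m n} (f : Fin n → Fin m → ℤ) → ∑ (λ x → ∑ (f x)) ≡ ∑ (λ y → ∑ (λ x → f x y))
    ∑-comm = S.∑-comm

    ∑-permute : ∀ {n} (f : Fin n → ℤ) (φ ψ : Fin n → Fin n) →
      (∀ x → φ (ψ x) ≡ x) → (∀ x → ψ (φ x) ≡ x) → ∑ f ≡ ∑ (λ x → f (φ x))
    ∑-permute f φ ψ φψ ψφ = S.∑-permute f (permutation φ ψ φψ ψφ)

  infixr 7.5 ∑
  syntax ∑ (λ x → e) = ∑[ x ] e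

  module _ {n : ℕ} where

    ∑-lin₂ : ∀ a b (f g : Fin n → ℤ) → ∑[ x ] (a * f x + b * g x) ≡ a * ∑ f + b * ∑ g
    ∑-lin₂ a b f g = trans (∑-+ _ _) (cong₂ _+_ (∑-*ˡ a f) (∑-*ˡ b g))

    ∑-lin₃ : ∀ a b c (f g h : Fin n → ℤ) →
      ∑[ x ] (a * f x + b * g x + c * h x) ≡ a * ∑ f + b * ∑ g + c * ∑ h
    ∑-lin₃ a b c f g h = trans (∑-+ _ _) (cong₂ _+_ (∑-lin₂ a b f g) (∑-*ˡ c h))

    ∑-product : ∀ {m} (f : Fin n → ℤ) (g : Fin m → ℤ) → ∑[ x ] ∑[ y ] (f x * g y) ≡ ∑ f * ∑ g
    ∑-product f g = trans (∑-cong (λ x → ∑-*ˡ (f x) g)) (∑-*ʳ f (∑ g))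

  ∑-mono : ∀ {n} {f g : Fin n → ℤ} → (∀ x → f x ≤ g x) → ∑ f ≤ ∑ g
  ∑-mono {zero} {f} {g} f≤g = ≤-reflexive (trans (∑-zero-dim f) (sym (∑-zero-dim g)))
  ∑-mono {suc n} {f} {g} f≤g =
    subst₂ _≤_ (sym (∑-suc f)) (sym (∑-suc g)) (+-mono-≤ (f≤g zero) (∑-mono (f≤g ∘ suc)))

  ∑-const : ∀ n c → ∑ {n} (λ _ → c) ≡ + n * c
  ∑-const zero c = trans (∑-zero-dim _) (sym (*-zeroˡ c))
  ∑-const (suc n) c =
    trans (∑-suc _) (trans (cong (_+_ c) (∑-const n c)) (trans (eq c (+ n)) (cong (_* c) (sym (pos-+ 1 n)))))
    where
    opaque
      unfolding _+_
      eq : ∀ c n → c + n * c ≡ (1ℤ + n) * c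
      eq = solve-∀

  ∑-zero : ∀ {n} {f : Fin n → ℤ} → (∀ x → f x ≡ 0ℤ) → ∑ f ≡ 0ℤ
  ∑-zero {n} f≡0 = trans (∑-cong f≡0) (trans (∑-const n 0ℤ) (*-zeroʳ (+ n)))

  ∑-nonneg : ∀ {n} {f : Fin n → ℤ} → (∀ x → 0ℤ ≤ f x) → 0ℤ ≤ ∑ f
  ∑-nonneg {f = f} 0≤f = subst (_≤ ∑ f) (∑-zero (λ _ → refl)) (∑-mono 0≤f)

  ∑-≤-const : ∀ {n} {f : Fin n → ℤ} c → (∀ x → f x ≤ c) → ∑ f ≤ + n * c
  ∑-≤-const {n} {f} c f≤c = subst (∑ f ≤_) (∑-const n c) (∑-mono f≤c)

  term≤∑ : ∀ {n} {f : Fin n → ℤ} → (∀ x → 0ℤ ≤ f x) → ∀ x → f x ≤ ∑ f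
  term≤∑ {f = f} 0≤f zero =
    subst₂ _≤_ (+-identityʳ (f zero)) (sym (∑-suc f)) (+-mono-≤ (≤-refl {f zero}) (∑-nonneg (0≤f ∘ suc)))
  term≤∑ {f = f} 0≤f (suc x) =
    subst₂ _≤_ (+-identityˡ (f (suc x))) (sym (∑-suc f)) (+-mono-≤ (0≤f zero) (term≤∑ (0≤f ∘ suc) x))

  -- Were every `+ n * f x` below `c`, integrality would give `1ℤ + + n * f x ≤ c`, and summing over
  -- `x` would contradict `c ≤ ∑ f`.
  ∃-above-average : ∀ {n} (f : Fin n → ℤ) {c} → 0ℤ < + n → c ≤ ∑ f → ∃ λ x → c ≤ + n * f x
  ∃-above-average {n} f {c} 0<n c≤∑f with Fin.any? (λ x → c ≤? + n * f x)
  ... | yes found = found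
  ... | no none = contradiction (≤-trans step (*-monoˡ (0≤+ n) c≤∑f)) (λ le → <-irrefl refl (<-≤-trans bump le))
    where
    step : + n * (1ℤ + ∑ f) ≤ + n * c
    step = ≤-trans (≤-reflexive lhs) (∑-≤-const c (λ x → ≰⇒1+≤ (λ le → none (x , le))))
      where
      lhs : + n * (1ℤ + ∑ f) ≡ ∑[ x ] (1ℤ + + n * f x)
      lhs = sym (trans (∑-+ _ _) (trans (cong₂ _+_ (∑-const n 1ℤ) (∑-*ˡ (+ n) f)) (eq (+ n) (∑ f))))
        where
        opaque
          unfolding _+_
          eq : ∀ n s → n * 1ℤ + n * s ≡ n * (1ℤ + s)
          eq = solve-∀
    bump : + n * ∑ f < + n * (1ℤ + ∑ f)
    bump = 1+≤⇒< (≤-slack _ (gap (0<⇒1≤ 0<n)) (eq (+ n) (∑ f)))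
      where
      opaque
        unfolding _+_
        eq : ∀ n s → 1ℤ + n * s + (n - 1ℤ) ≡ n * (1ℤ + s)
        eq = solve-∀

  δ : ∀ {n} → Fin n → Fin n → ℤ
  δ zero zero = 1ℤ
  δ zero (suc y) = 0ℤ
  δ (suc x) zero = 0ℤ
  δ (suc x) (suc y) = δ x y

  δ-refl : ∀ {n} {x y : Fin n} → x ≡ y → δ x y ≡ 1ℤ
  δ-refl {x = zero} refl = refl
  δ-refl {x = suc x} refl = δ-refl {x = x} refl

  δ-≢ : ∀ {n} {x y : Fin n} → x ≢ y → δ x y ≡ 0ℤ
  δ-≢ {x = zero} {zero} x≢y = contradiction refl x≢y
  δ-≢ {x = zero} {suc y} x≢y = refl
  δ-≢ {x = suc x} {zero} x≢y = refl
  δ-≢ {x = suc x} {suc y} x≢y = δ-≢ (x≢y ∘ cong suc)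

  ∑-δ : ∀ {n} (x : Fin n) (f : Fin n → ℤ) → ∑[ y ] (δ x y * f y) ≡ f x
  ∑-δ zero f = trans (∑-suc _) (trans (cong₂ _+_ (*-identityˡ (f zero)) (∑-zero (λ x → *-zeroˡ (f (suc x))))) (+-identityʳ _))
  ∑-δ (suc x) f = trans (∑-suc _) (trans (cong₂ _+_ (*-zeroˡ (f zero)) (∑-δ x (f ∘ suc))) (+-identityˡ _))

  Bit : ℤ → Set
  Bit a = a ≡ 0ℤ ⊎ a ≡ 1ℤ

  bit-* : ∀ {a b} → Bit a → Bit b → Bit (a * b)
  bit-* {b = b} (inj₁ refl) b-bit = inj₁ (*-zeroˡ b)
  bit-* {b = b} (inj₂ refl) b-bit = subst Bit (sym (*-identityˡ b)) b-bit

  bit-*≡1 : ∀ {a b} → Bit a → a * b ≡ 1ℤ → a ≡ 1ℤ × b ≡ 1ℤ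
  bit-*≡1 {b = b} (inj₁ refl) ab≡1 = contradiction (trans (sym (*-zeroˡ b)) ab≡1) (λ ())
  bit-*≡1 {b = b} (inj₂ refl) ab≡1 = refl , trans (sym (*-identityˡ b)) ab≡1

  Indicator : ∀ {n} → (Fin n → ℤ) → Set
  Indicator f = ∀ x → Bit (f x)

  δ-indicator : ∀ {n} (x : Fin n) → Indicator (δ x)
  δ-indicator x y with x Fin.≟ y
  ... | yes x≡y = inj₂ (δ-refl x≡y)
  ... | no x≢y = inj₁ (δ-≢ x≢y)

  module _ {n} {f : Fin n → ℤ} (f-ind : Indicator f) where

    indicator-nonneg : ∀ x → 0ℤ ≤ f x
    indicator-nonneg x with f-ind x
    ... | inj₁ eq rewrite eq = ≤-refl
    ... | inj₂ eq rewrite eq = +≤+ z≤n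

    indicator-≤1 : ∀ x → f x ≤ 1ℤ
    indicator-≤1 x with f-ind x
    ... | inj₁ eq rewrite eq = +≤+ z≤n
    ... | inj₂ eq rewrite eq = ≤-refl

    indicator-idem : ∀ x → f x * f x ≡ f x
    indicator-idem x with f-ind x
    ... | inj₁ eq rewrite eq = *-zeroˡ 0ℤ
    ... | inj₂ eq rewrite eq = *-identityˡ 1ℤ

    ∑-indicator-≤ : ∑ f ≤ + n
    ∑-indicator-≤ = subst (∑ f ≤_) (*-identityʳ (+ n)) (∑-≤-const 1ℤ indicator-≤1)

    ∃-indicator : 1ℤ ≤ ∑ f → ∃ λ x → f x ≡ 1ℤ
    ∃-indicator 1≤∑ with Fin.any? (λ x → f x ℤₚ.≟ 1ℤ)
    ... | yes found = found
    ... | no none = contradiction (subst (1ℤ ≤_) (∑-zero vanish) 1≤∑) (λ { (+≤+ ()) })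
      where
      vanish : ∀ x → f x ≡ 0ℤ
      vanish x with f-ind x
      ... | inj₁ eq = eq
      ... | inj₂ eq = contradiction (x , eq) none

    ∑-at-most-one : (∀ x y → f x ≡ 1ℤ → f y ≡ 1ℤ → x ≡ y) → ∑ f ≤ 1ℤ
    ∑-at-most-one unique with 1ℤ ≤? ∑ f
    ... | no none = <⇒≤ (≰⇒> none)
    ... | yes some with ∃-indicator some
    ...   | x , fx = ≤-reflexive (trans (∑-cong (λ y → pointwise y)) (∑-δ x (λ _ → 1ℤ)))
      where
      pointwise : ∀ y → f y ≡ δ x y * 1ℤ
      pointwise y with f-ind y
      ... | inj₂ fy = trans fy (sym (trans (*-identityʳ _) (δ-refl (unique x y fx fy))))
      ... | inj₁ fy with x Fin.≟ y
      ...   | yes refl = contradiction (trans (sym fy) fx) (λ ())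
      ...   | no x≢y = trans fy (sym (trans (*-identityʳ _) (δ-≢ x≢y)))

  product-indicator : ∀ {n} {f g : Fin n → ℤ} → Indicator f → Indicator g → Indicator (λ x → f x * g x)
  product-indicator f-ind g-ind x = bit-* (f-ind x) (g-ind x)

-- The field with p elements.

module FiniteField where

  open import Data.Integer using (+_; 0ℤ; 1ℤ; _+_; _*_; _-_; -_; ∣_∣; _/ℕ_)
  open import Data.Integer.DivMod using (n%ℕd<d; a≡a%ℕn+[a/ℕn]*n)
  open import Data.Integer.Divisibility using () renaming (_∣_ to _∣ᵤ_)
  open import Data.Integer.Divisibility.Signed using (_∣_; divides; ∣ᵤ⇒∣; ∣⇒∣ᵤ)
  open import Data.Nat.Coprimality using (prime⇒coprime; coprime-Bézout)
  open import Data.Nat.GCD using (module Bézout)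
  open import Data.Nat.Primality using (Prime; prime⇒nonZero)
  import Data.Nat as ℕ
  import Data.Nat.Divisibility as ℕ
  import Data.Nat.DivMod as ℕ

  -- An interface that hides residues modulo p from the later arguments. The convention that zero is
  -- its own inverse makes `inv` an involution of the whole field, hence a change of variable in
  -- every sum.
  record PrimeField (p : ℕ) : Set where
    infixl 6 _⊕_
    infixl 7 _⊗_
    infix 8 ⊝_
    field
      _⊕_ _⊗_ : Fin p → Fin p → Fin p
      ⊝_ inv : Fin p → Fin p
      ⟦_⟧ : ℤ → Fin p
      isCommutativeRing : IsCommutativeRing _≡_ _⊕_ _⊗_ ⊝_ ⟦ 0ℤ ⟧ ⟦ 1ℤ ⟧
      ⟦⟧-+ : ∀ i j → ⟦ i + j ⟧ ≡ ⟦ i ⟧ ⊕ ⟦ j ⟧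
      ⟦⟧-* : ∀ i j → ⟦ i * j ⟧ ≡ ⟦ i ⟧ ⊗ ⟦ j ⟧
      ⟦⟧-neg : ∀ i → ⟦ - i ⟧ ≡ ⊝ ⟦ i ⟧
      ⟦⟧-cong : ∀ {i j} → + p ∣ᵤ i - j → ⟦ i ⟧ ≡ ⟦ j ⟧
      ⟦⟧-injective : ∀ {i j} → ⟦ i ⟧ ≡ ⟦ j ⟧ → + p ∣ᵤ i - j
      ⟦⟧-toℕ : ∀ x → ⟦ + toℕ x ⟧ ≡ x
      inv-zero : inv ⟦ 0ℤ ⟧ ≡ ⟦ 0ℤ ⟧
      ⊗-inv : ∀ x → x ≢ ⟦ 0ℤ ⟧ → x ⊗ inv x ≡ ⟦ 1ℤ ⟧

  primeField : ∀ {p} → Prime p → PrimeField p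
  primeField {p} p-prime = record
    { _⊕_ = _⊕_ ; _⊗_ = _⊗_ ; ⊝_ = ⊝_ ; inv = inv ; ⟦_⟧ = ⟦_⟧
    ; isCommutativeRing = record
      { isRing = record
        { +-isAbelianGroup = record
          { isGroup = record
            { isMonoid = record
              { isSemigroup = record
                { isMagma = record { isEquivalence = isEquivalence ; ∙-cong = cong₂ _⊕_ }
                ; assoc = ⊕-assoc }
              ; identity = ⊕-idˡ , λ x → trans (⊕-comm x _) (⊕-idˡ x) }
            ; inverse = ⊝-invˡ , λ x → trans (⊕-comm x _) (⊝-invˡ x)
            ; ⁻¹-cong = cong ⊝_ }
          ; comm = ⊕-comm }
        ; *-cong = cong₂ _⊗_
        ; *-assoc = ⊗-assoc
        ; *-identity = ⊗-idˡ , λ x → trans (⊗-comm x _) (⊗-idˡ x)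
        ; distrib = ⊗-distribˡ , λ x y z → trans (⊗-comm _ x) (trans (⊗-distribˡ x y z) (cong₂ _⊕_ (⊗-comm x y) (⊗-comm x z))) }
      ; *-comm = ⊗-comm }
    ; ⟦⟧-+ = λ i j → sym (reduce (∼-+ (∼-ι i) (∼-ι j)))
    ; ⟦⟧-* = λ i j → sym (reduce (∼-* (∼-ι i) (∼-ι j)))
    ; ⟦⟧-neg = λ i → sym (reduce (∼-neg (∼-ι i)))
    ; ⟦⟧-cong = λ {i} {j} d → reduce {i} {j} (difference (∣ᵤ⇒∣ d))
    ; ⟦⟧-injective = λ {i} {j} eq → ∣⇒∣ᵤ (_∼_.divisible (∼-trans (∼-sym (∼-ι i)) (subst (λ x → ι x ∼ j) (sym eq) (∼-ι j))))
    ; ⟦⟧-toℕ = ⟦⟧-ι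
    ; inv-zero = inv-zero
    ; ⊗-inv = ⊗-inv
    }
    where
    instance
      p≢0 : ℕ.NonZero p
      p≢0 = prime⇒nonZero p-prime

    ⟦_⟧ : ℤ → Fin p
    ⟦ i ⟧ = fromℕ< (n%ℕd<d i p)

    ι : Fin p → ℤ
    ι x = + toℕ x

    infixl 6 _⊕_
    infixl 7 _⊗_
    infix 8 ⊝_
    infix 4 _∼_
    _⊕_ _⊗_ : Fin p → Fin p → Fin p
    x ⊕ y = ⟦ ι x + ι y ⟧
    x ⊗ y = ⟦ ι x * ι y ⟧
    ⊝_ : Fin p → Fin p
    ⊝ x = ⟦ - ι x ⟧

    -- A record rather than a synonym, because `i` and `j` cannot be recovered by unification from
    -- the difference `i - j`.
    record _∼_ (i j : ℤ) : Set where
      eta-equality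
      constructor difference
      field divisible : + p ∣ i - j

    ∼-refl : ∀ {i} → i ∼ i
    ∼-refl {i} = difference (divides 0ℤ (eq i (+ p)))
      where
      eq : ∀ i p → i - i ≡ 0ℤ * p
      eq = solve-∀

    ∼-sym : ∀ {i j} → i ∼ j → j ∼ i
    ∼-sym {i} {j} (difference (divides q eq₁)) = difference (divides (- q) (trans (eq i j) (trans (cong -_ eq₁) (eq₂ q (+ p)))))
      where
      eq : ∀ i j → j - i ≡ - (i - j)
      eq = solve-∀
      eq₂ : ∀ q p → - (q * p) ≡ - q * p
      eq₂ = solve-∀

    ∼-+ : ∀ {i j k l} → i ∼ j → k ∼ l → i + k ∼ j + l
    ∼-+ {i} {j} {k} {l} (difference (divides q eq₁)) (difference (divides r eq₂)) =
      difference (divides (q + r) (trans (eq i j k l) (trans (cong₂ _+_ eq₁ eq₂) (eq₃ q r (+ p)))))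
      where
      eq : ∀ i j k l → i + k - (j + l) ≡ (i - j) + (k - l)
      eq = solve-∀
      eq₃ : ∀ q r p → q * p + r * p ≡ (q + r) * p
      eq₃ = solve-∀

    ∼-* : ∀ {i j k l} → i ∼ j → k ∼ l → i * k ∼ j * l
    ∼-* {i} {j} {k} {l} (difference (divides q eq₁)) (difference (divides r eq₂)) =
      difference (divides (q * k + j * r) (trans (eq i j k l) (trans (cong₂ _+_ (cong (_* k) eq₁) (cong (j *_) eq₂)) (eq₃ q r j k (+ p)))))
      where
      eq : ∀ i j k l → i * k - j * l ≡ (i - j) * k + j * (k - l)
      eq = solve-∀
      eq₃ : ∀ q r j k p → q * p * k + j * (r * p) ≡ (q * k + j * r) * p
      eq₃ = solve-∀

    ∼-neg : ∀ {i j} → i ∼ j → - i ∼ - j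
    ∼-neg {i} {j} (difference (divides q eq₁)) = difference (divides (- q) (trans (eq i j) (trans (cong -_ eq₁) (eq₂ q (+ p)))))
      where
      eq : ∀ i j → - i - - j ≡ - (i - j)
      eq = solve-∀
      eq₂ : ∀ q p → - (q * p) ≡ - q * p
      eq₂ = solve-∀

    ∼-trans : ∀ {i j k} → i ∼ j → j ∼ k → i ∼ k
    ∼-trans {i} {j} {k} a b = difference (subst (+ p ∣_) (eq i j k) (_∼_.divisible (∼-+ a b)))
      where
      eq : ∀ i j k → i + j - (j + k) ≡ i - k
      eq = solve-∀

    ∼-ι : ∀ i → ι ⟦ i ⟧ ∼ i
    ∼-ι i = ∼-sym (difference (divides (i /ℕ p) (trans (cong (_- ι ⟦ i ⟧) (a≡a%ℕn+[a/ℕn]*n i p))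
      (trans (cong (λ r → + r + (i /ℕ p) * + p - ι ⟦ i ⟧) (sym (Fin.toℕ-fromℕ< (n%ℕd<d i p)))) (eq (ι ⟦ i ⟧) _)))))
      where
      eq : ∀ a b → a + b - a ≡ b
      eq = solve-∀

    ι-injective : ∀ {x y} → ι x ∼ ι y → x ≡ y
    ι-injective {x} {y} d = Fin.toℕ-injective (ℤₚ.+-injective (ℤₚ.i-j≡0⇒i≡j (ι x) (ι y) (ℤₚ.∣i∣≡0⇒i≡0 abs≡0)))
      where
      bound : ∣ ι x - ι y ∣ ℕ.< p
      bound = ℕ.≤-<-trans (subst (λ z → ∣ z ∣ ℕ.≤ toℕ x ℕ.⊔ toℕ y) (sym (ℤₚ.m-n≡m⊖n (toℕ x) (toℕ y))) (ℤₚ.∣m⊝n∣≤m⊔n (toℕ x) (toℕ y)))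
                          (ℕ.⊔-lub (Fin.toℕ<n x) (Fin.toℕ<n y))
      abs≡0 : ∣ ι x - ι y ∣ ≡ 0
      abs≡0 with ∣ ι x - ι y ∣ | bound | ∣⇒∣ᵤ (_∼_.divisible d)
      ... | zero | _ | _ = refl
      ... | suc n | n<p | p∣n = contradiction (ℕ.∣⇒≤ p∣n) (ℕ.<⇒≱ n<p)

    reduce : ∀ {i j} → i ∼ j → ⟦ i ⟧ ≡ ⟦ j ⟧
    reduce {i} {j} i∼j = ι-injective (∼-trans (∼-ι i) (∼-trans i∼j (∼-sym (∼-ι j))))

    by-ring : ∀ {i j k l} → i ∼ j → j ≡ k → l ∼ k → ⟦ i ⟧ ≡ ⟦ l ⟧
    by-ring a refl b = reduce (∼-trans a (∼-sym b))

    ⟦⟧-ι : ∀ x → ⟦ ι x ⟧ ≡ x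
    ⟦⟧-ι x = ι-injective (∼-ι (ι x))

    ⊕-assoc : ∀ x y z → (x ⊕ y) ⊕ z ≡ x ⊕ (y ⊕ z)
    ⊕-assoc x y z = by-ring (∼-+ (∼-ι (ι x + ι y)) (∼-refl {ι z})) (ℤₚ.+-assoc (ι x) (ι y) (ι z)) (∼-+ (∼-refl {ι x}) (∼-ι (ι y + ι z)))

    ⊕-comm : ∀ x y → x ⊕ y ≡ y ⊕ x
    ⊕-comm x y = cong ⟦_⟧ (ℤₚ.+-comm (ι x) (ι y))

    ⊕-idˡ : ∀ x → ⟦ 0ℤ ⟧ ⊕ x ≡ x
    ⊕-idˡ x = trans (by-ring (∼-+ (∼-ι 0ℤ) (∼-refl {ι x})) (ℤₚ.+-identityˡ (ι x)) (∼-refl {ι x})) (⟦⟧-ι x)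

    ⊝-invˡ : ∀ x → ⊝ x ⊕ x ≡ ⟦ 0ℤ ⟧
    ⊝-invˡ x = by-ring (∼-+ (∼-ι (- ι x)) (∼-refl {ι x})) (ℤₚ.+-inverseˡ (ι x)) (∼-refl {0ℤ})

    ⊗-assoc : ∀ x y z → (x ⊗ y) ⊗ z ≡ x ⊗ (y ⊗ z)
    ⊗-assoc x y z = by-ring (∼-* (∼-ι (ι x * ι y)) (∼-refl {ι z})) (ℤₚ.*-assoc (ι x) (ι y) (ι z)) (∼-* (∼-refl {ι x}) (∼-ι (ι y * ι z)))

    ⊗-comm : ∀ x y → x ⊗ y ≡ y ⊗ x
    ⊗-comm x y = cong ⟦_⟧ (ℤₚ.*-comm (ι x) (ι y))

    ⊗-idˡ : ∀ x → ⟦ 1ℤ ⟧ ⊗ x ≡ x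
    ⊗-idˡ x = trans (by-ring (∼-* (∼-ι 1ℤ) (∼-refl {ι x})) (ℤₚ.*-identityˡ (ι x)) (∼-refl {ι x})) (⟦⟧-ι x)

    ⊗-distribˡ : ∀ x y z → x ⊗ (y ⊕ z) ≡ x ⊗ y ⊕ x ⊗ z
    ⊗-distribˡ x y z = by-ring (∼-* (∼-refl {ι x}) (∼-ι (ι y + ι z))) (ℤₚ.*-distribˡ-+ (ι x) (ι y) (ι z)) (∼-+ (∼-ι (ι x * ι y)) (∼-ι (ι x * ι z)))

    -- A representative strictly between 0 and p is coprime to p; Bézout's identity, in either of
    -- its sign patterns, supplies the inverse.
    ∃-inverse : ∀ x → x ≢ ⟦ 0ℤ ⟧ → ∃ λ i → ι x * i ∼ 1ℤ
    ∃-inverse x x≢0 with toℕ x in eq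
    ... | zero = contradiction (trans (sym (⟦⟧-ι x)) (cong (⟦_⟧ ∘ +_) eq)) x≢0
    ... | n@(suc _) with coprime-Bézout (prime⇒coprime p-prime (subst (ℕ._< p) eq (Fin.toℕ<n x)))
    ...   | Bézout.+- a b id = - + b , difference (divides (- + a) (eq′ (+ n) (+ b) (+ a) (+ p) (lift b n a p id)))
      where
      lift : ∀ b n a m → 1 ℕ.+ b ℕ.* n ≡ a ℕ.* m → 1ℤ + + b * + n ≡ + a * + m
      lift b n a m e = trans (cong (_+_ 1ℤ) (sym (ℤₚ.pos-* b n))) (trans (cong +_ e) (ℤₚ.pos-* a m))
      eq₁ : ∀ n b → n * - b - 1ℤ ≡ - (1ℤ + b * n)
      eq₁ = solve-∀
      eq₂ : ∀ a p → - (a * p) ≡ - a * p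
      eq₂ = solve-∀
      eq′ : ∀ n b a p → 1ℤ + b * n ≡ a * p → n * - b - 1ℤ ≡ - a * p
      eq′ n b a p e = trans (eq₁ n b) (trans (cong -_ e) (eq₂ a p))
    ...   | Bézout.-+ a b id = + b , difference (divides (+ a) (eq′ (+ n) (+ b) (+ a) (+ p) (lift a p b n id)))
      where
      lift : ∀ b n a m → 1 ℕ.+ b ℕ.* n ≡ a ℕ.* m → 1ℤ + + b * + n ≡ + a * + m
      lift b n a m e = trans (cong (_+_ 1ℤ) (sym (ℤₚ.pos-* b n))) (trans (cong +_ e) (ℤₚ.pos-* a m))
      eq₁ : ∀ a p → 1ℤ + a * p - 1ℤ ≡ a * p
      eq₁ = solve-∀
      eq′ : ∀ n b a p → 1ℤ + a * p ≡ b * n → n * b - 1ℤ ≡ a * p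
      eq′ n b a p e = trans (cong (_- 1ℤ) (trans (ℤₚ.*-comm n b) (sym e))) (eq₁ a p)

    inv : Fin p → Fin p
    inv x with x Fin.≟ ⟦ 0ℤ ⟧
    ... | yes _ = ⟦ 0ℤ ⟧
    ... | no x≢0 = ⟦ proj₁ (∃-inverse x x≢0) ⟧

    inv-zero : inv ⟦ 0ℤ ⟧ ≡ ⟦ 0ℤ ⟧
    inv-zero with ⟦ 0ℤ ⟧ Fin.≟ ⟦ 0ℤ ⟧
    ... | yes _ = refl
    ... | no 0≢0 = contradiction refl 0≢0

    ⊗-inv : ∀ x → x ≢ ⟦ 0ℤ ⟧ → x ⊗ inv x ≡ ⟦ 1ℤ ⟧
    ⊗-inv x x≢0 with x Fin.≟ ⟦ 0ℤ ⟧
    ... | yes x≡0 = contradiction x≡0 x≢0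
    ... | no x≢0′ = reduce (∼-trans (∼-* (∼-refl {ι x}) (∼-ι (proj₁ (∃-inverse x x≢0′)))) (proj₂ (∃-inverse x x≢0′)))

-- Field identities and changes of variable.

module FieldProperties {p : ℕ} (𝔽 : FiniteField.PrimeField p) where

  open import Data.Integer using (+_; 0ℤ; 1ℤ; _<_; +<+)
  open import Data.Maybe using (Maybe; just; nothing)
  import Algebra.Solver.Ring
  import Algebra.Solver.Ring.AlmostCommutativeRing as ACR
  open Arithmetic using (_*_)
  open Sums
  open FiniteField.PrimeField 𝔽 public

  commutativeRing : CommutativeRing _ _
  commutativeRing = record { isCommutativeRing = isCommutativeRing }

  open CommutativeRing commutativeRing public
    using () renaming
    ( +-comm to ⊕-comm; *-comm to ⊗-comm; *-assoc to ⊗-assoc; *-identityˡ to ⊗-identityˡ; *-identityʳ to ⊗-identityʳ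
    ; zeroˡ to ⊗-zeroˡ; zeroʳ to ⊗-zeroʳ )

  private
    ℤ-hom : CommutativeRing.rawRing ℤₚ.+-*-commutativeRing ACR.-Raw-AlmostCommutative⟶ ACR.fromCommutativeRing commutativeRing
    ℤ-hom = record
      { ⟦_⟧ = ⟦_⟧ ; +-homo = ⟦⟧-+ ; *-homo = ⟦⟧-* ; -‿homo = ⟦⟧-neg ; 0-homo = refl ; 1-homo = refl }

    coefficients-equal? : ∀ i j → Maybe (⟦ i ⟧ ≡ ⟦ j ⟧)
    coefficients-equal? i j with i ℤₚ.≟ j
    ... | yes i≡j = just (cong ⟦_⟧ i≡j)
    ... | no _ = nothing

  module Solver = Algebra.Solver.Ring (CommutativeRing.rawRing ℤₚ.+-*-commutativeRing)
    (ACR.fromCommutativeRing commutativeRing) ℤ-hom coefficients-equal?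
  open Solver using (solve; _:=_; _:+_; _:*_; _:-_; :-_; con)

  infixl 6 _⊖_
  _⊖_ : Fin p → Fin p → Fin p
  x ⊖ y = x ⊕ ⊝ y

  O I : Fin p
  O = ⟦ 0ℤ ⟧
  I = ⟦ 1ℤ ⟧

  SumFreeIndicator InversionInvariant : (Fin p → ℤ) → Set
  SumFreeIndicator f = ∀ x y → f x * (f y * f (y ⊕ x)) ≡ 0ℤ
  InversionInvariant f = ∀ x → f (inv x) ≡ f x

  x⊕y⊖y≡x : ∀ x y → x ⊕ y ⊖ y ≡ x
  x⊕y⊖y≡x = solve 2 (λ x y → x :+ y :- y := x) refl

  x⊖y⊕y≡x : ∀ x y → x ⊖ y ⊕ y ≡ x
  x⊖y⊕y≡x = solve 2 (λ x y → x :- y :+ y := x) refl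

  x⊖[x⊖y]≡y : ∀ x y → x ⊖ (x ⊖ y) ≡ y
  x⊖[x⊖y]≡y = solve 2 (λ x y → x :- (x :- y) := y) refl

  x⊖x≡O : ∀ x → x ⊖ x ≡ O
  x⊖x≡O = solve 1 (λ x → x :- x := con 0ℤ) refl

  x⊖y≡O⇒x≡y : ∀ x y → x ⊖ y ≡ O → x ≡ y
  x⊖y≡O⇒x≡y x y eq = trans (sym (x⊖y⊕y≡x x y)) (trans (cong (_⊕ y) eq) (solve 1 (λ y → con 0ℤ :+ y := y) refl y))

  0<p : 0ℤ < + p
  0<p = +<+ (ℕ.≤-<-trans z≤n (Fin.toℕ<n O))

  inv-⊗ : ∀ {x} → x ≢ O → inv x ⊗ x ≡ I
  inv-⊗ {x} x≢O = trans (⊗-comm (inv x) x) (⊗-inv x x≢O)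

  ⊗-cancelˡ : ∀ {x y z} → x ≢ O → x ⊗ y ≡ x ⊗ z → y ≡ z
  ⊗-cancelˡ {x} {y} {z} x≢O eq =
    trans (sym (undo y)) (trans (cong (inv x ⊗_) eq) (undo z))
    where
    undo : ∀ w → inv x ⊗ (x ⊗ w) ≡ w
    undo w = trans (sym (⊗-assoc (inv x) x w)) (trans (cong (_⊗ w) (inv-⊗ x≢O)) (⊗-identityˡ w))

  ⊗-nonzero : ∀ {x y} → x ≢ O → y ≢ O → x ⊗ y ≢ O
  ⊗-nonzero {x} x≢O y≢O eq = y≢O (⊗-cancelˡ x≢O (trans eq (sym (⊗-zeroʳ x))))

  inv-unique : ∀ {x y} → x ⊗ y ≡ I → y ≡ inv x
  inv-unique {x} {y} xy≡1 with x Fin.≟ O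
  ... | no x≢O = ⊗-cancelˡ x≢O (trans xy≡1 (sym (⊗-inv x x≢O)))
  -- The interface does not say that `O` and `I` differ, so `O ⊗ y ≡ I` is not refuted; it collapses
  -- the field to a point, where any two elements agree.
  ... | yes refl = trans (trivial y) (sym (trivial (inv O)))
    where
    O≡I : O ≡ I
    O≡I = trans (sym (⊗-zeroˡ y)) xy≡1
    trivial : ∀ z → z ≡ O
    trivial z = trans (sym (⊗-identityˡ z)) (trans (cong (_⊗ z) (sym O≡I)) (⊗-zeroˡ z))

  inv-involutive : ∀ x → inv (inv x) ≡ x
  inv-involutive x with x Fin.≟ O
  ... | yes refl = trans (cong inv inv-zero) inv-zero
  ... | no x≢O = sym (inv-unique (inv-⊗ x≢O))

  ∑-shift : ∀ (f : Fin p → ℤ) a → ∑ f ≡ ∑[ x ] f (x ⊕ a)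
  ∑-shift f a = ∑-permute f (_⊕ a) (_⊖ a) (λ x → x⊖y⊕y≡x x a) (λ x → x⊕y⊖y≡x x a)

  ∑-unshift : ∀ (f : Fin p → ℤ) a → ∑ f ≡ ∑[ x ] f (x ⊖ a)
  ∑-unshift f a = ∑-permute f (_⊖ a) (_⊕ a) (λ x → x⊕y⊖y≡x x a) (λ x → x⊖y⊕y≡x x a)

  ∑-reflect : ∀ (f : Fin p → ℤ) a → ∑ f ≡ ∑[ x ] f (a ⊖ x)
  ∑-reflect f a = ∑-permute f (a ⊖_) (a ⊖_) (x⊖[x⊖y]≡y a) (x⊖[x⊖y]≡y a)

  ∑-inv : ∀ (f : Fin p → ℤ) → ∑ f ≡ ∑[ x ] f (inv x)
  ∑-inv f = ∑-permute f inv inv inv-involutive inv-involutive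

  ∑-scale : ∀ (f : Fin p → ℤ) {a} → a ≢ O → ∑ f ≡ ∑[ x ] f (x ⊗ a)
  ∑-scale f {a} a≢O = ∑-permute f (_⊗ a) (_⊗ inv a)
    (λ x → trans (⊗-assoc x (inv a) a) (trans (cong (x ⊗_) (inv-⊗ a≢O)) (⊗-identityʳ x)))
    (λ x → trans (⊗-assoc x a (inv a)) (trans (cong (x ⊗_) (⊗-inv a a≢O)) (⊗-identityʳ x)))

  -- A nonzero residue generates the additive group: `y` is reached from `x` in `(y ⊖ x) ⊗ inv d`
  -- steps of length `d`.
  shift-closed⇒everything : ∀ {d} (Q : Fin p → Set) → d ≢ O → (∀ x → Q x → Q (x ⊕ d)) → ∀ x y → Q x → Q y
  shift-closed⇒everything {d} Q d≢O step x y Qx = subst Q y-reached (multiples (toℕ k))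
    where
    k = (y ⊖ x) ⊗ inv d
    multiples : ∀ n → Q (x ⊕ ⟦ + n ⟧ ⊗ d)
    multiples zero = subst Q (sym (solve 2 (λ x d → x :+ con 0ℤ :* d := x) refl x d)) Qx
    multiples (suc n) = subst Q
      (trans (solve 3 (λ x n d → x :+ n :* d :+ d := x :+ (con 1ℤ :+ n) :* d) refl x ⟦ + n ⟧ d)
             (cong (λ m → x ⊕ m ⊗ d) (sym (⟦⟧-+ 1ℤ (+ n)))))
      (step _ (multiples n))
    y-reached : x ⊕ ⟦ + toℕ k ⟧ ⊗ d ≡ y
    y-reached = begin
      x ⊕ ⟦ + toℕ k ⟧ ⊗ d           ≡⟨ cong (λ m → x ⊕ m ⊗ d) (⟦⟧-toℕ k) ⟩
      x ⊕ (y ⊖ x) ⊗ inv d ⊗ d       ≡⟨ cong (x ⊕_) (⊗-assoc (y ⊖ x) (inv d) d) ⟩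
      x ⊕ (y ⊖ x) ⊗ (inv d ⊗ d)     ≡⟨ cong (λ m → x ⊕ (y ⊖ x) ⊗ m) (inv-⊗ d≢O) ⟩
      x ⊕ (y ⊖ x) ⊗ I               ≡⟨ solve 2 (λ x y → x :+ (y :- x) :* con 1ℤ := y) refl x y ⟩
      y                             ∎
      where open ≡-Reasoning

-- Croot-Sisask sampling by the method of conditional averages.

module Sampling {p : ℕ} (𝔽 : FiniteField.PrimeField p) (f : Fin p → ℤ) (f-ind : Sums.Indicator f) where

  open Arithmetic
  open Sums
  open FieldProperties 𝔽
  open Solver using (solve; _:=_; _:+_)

  P N : ℤ
  P = + p
  N = ∑ f

  h : Fin p → ℤ
  h x = ∑[ y ] (f y * f (y ⊕ x))

  0≤N : 0ℤ ≤ N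
  0≤N = ∑-nonneg (indicator-nonneg f-ind)

  h≤N : ∀ x → h x ≤ N
  h≤N x = ∑-mono (λ y → ≤-slack (f y * (1ℤ - f (y ⊕ x))) (indicator-nonneg f-ind y · gap (indicator-≤1 f-ind (y ⊕ x))) (eq (f y) (f (y ⊕ x))))
    where
    opaque
      unfolding _+_
      eq : ∀ a b → a * b + a * (1ℤ - b) ≡ a
      eq = solve-∀

  -- Each `t` of `T` is credited with `M` and charged the energy of its residual `ρ t`. A lower
  -- bound for this single quantity later shows both that `T` is large and that its residuals are
  -- small on average.
  Potential : ℤ → (Fin p → ℤ) → (Fin p → Fin p → ℤ) → ℤ
  Potential M T ρ = ∑[ t ] (T t * (M - ∑[ w ] (ρ t w) ²))

  -- As `a` runs over A, `N * f (a ⊕ y)` has mean `h y`. The cross term with `r` therefore vanishes,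
  -- and a sample adds a variance of at most `N ²`.
  sample-variance : ∀ r y → ∑[ a ] (f a * (r + (N * f (a ⊕ y) - h y)) ²) ≤ N * r ² + N * N ²
  sample-variance r y = ≤-trans (≤-reflexive expand)
    (≤-slack _ (0≤N · 0≤N · gap (h≤N y) ⊹ 0≤N · square-nonneg (h y)) (eq₂ N r (h y)))
    where
    H = h y
    expand : ∑[ a ] (f a * (r + (N * f (a ⊕ y) - H)) ²) ≡ (r - H) ² * N + (+ 2 * (r - H) * N + N ²) * H
    expand = trans (∑-cong pointwise) (∑-lin₂ ((r - H) ²) (+ 2 * (r - H) * N + N ²) f (λ a → f a * f (a ⊕ y)))
      where
      eq : ∀ f g g² r N H → g² ≡ g → f * ((r - H) * (r - H) + + 2 * (r - H) * N * g + N * N * g²)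
        ≡ (r - H) * (r - H) * f + (+ 2 * (r - H) * N + N * N) * (f * g)
      eq f g .g r N H refl = identity f g r N H
        where
        opaque
          unfolding _+_
          identity : ∀ f g r N H → f * ((r - H) * (r - H) + + 2 * (r - H) * N * g + N * N * g)
            ≡ (r - H) * (r - H) * f + (+ 2 * (r - H) * N + N * N) * (f * g)
          identity = solve-∀
      opaque
        unfolding _+_
        square : ∀ f g r N H → f * ((r + (N * g - H)) * (r + (N * g - H)))
          ≡ f * ((r - H) * (r - H) + + 2 * (r - H) * N * g + N * N * (g * g))
        square = solve-∀
      pointwise : ∀ a → f a * (r + (N * f (a ⊕ y) - H)) ² ≡ (r - H) ² * f a + (+ 2 * (r - H) * N + N ²) * (f a * f (a ⊕ y))
      pointwise a = trans (square (f a) (f (a ⊕ y)) r N H)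
        (eq (f a) (f (a ⊕ y)) _ r N H (indicator-idem f-ind (a ⊕ y)))
    opaque
      unfolding _+_
      eq₂ : ∀ N r H → (r - H) * (r - H) * N + (+ 2 * (r - H) * N + N * N) * H + (N * N * (N - H) + N * (H * H)) ≡ N * (r * r) + N * (N * N)
      eq₂ = solve-∀

  restrict : Fin p → (Fin p → ℤ) → Fin p → ℤ
  restrict c T t = T t * f (c ⊖ t)

  extend : Fin p → (Fin p → Fin p → ℤ) → Fin p → Fin p → ℤ
  extend c ρ t w = ρ t w + (N * f (w ⊕ c) - h (w ⊕ t))

  -- Substitute `c = a ⊕ t`: every `t` survives for exactly `N` choices of `c`, one for each `a` in
  -- A, and `extend` then adds the centred sample at `a`. By `sample-variance`, summed over the `P`
  -- values of `w`, this costs a surviving `t` at most `P * N ²` on average.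
  total-potential : ∀ M T ρ → Indicator T →
    N * Potential (M - P * N ²) T ρ ≤ ∑[ c ] Potential M (restrict c T) (extend c ρ)
  total-potential M T ρ T-ind = ≤-trans (≤-reflexive (sym (∑-*ˡ N _))) (≤-trans (∑-mono pointwise) (≤-reflexive (sym rearranged)))
    where
    inner : Fin p → ℤ
    inner t = ∑[ a ] (f a * (M - ∑[ w ] (ρ t w + (N * f (a ⊕ (w ⊕ t)) - h (w ⊕ t))) ²))

    rearranged : ∑[ c ] Potential M (restrict c T) (extend c ρ) ≡ ∑[ t ] (T t * inner t)
    rearranged = trans (∑-comm _) (∑-cong (λ t → trans (∑-shift _ t) (trans (∑-cong (λ a → cong₂ _*_
        (cong (λ x → T t * f x) (x⊕y⊖y≡x a t))
        (cong (_-_ M) (∑-cong (λ w → cong (λ x → (ρ t w + (N * f x - h (w ⊕ t))) ²) (swap w a t))))))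
      (trans (∑-cong (λ a → *-assoc (T t) (f a) _)) (∑-*ˡ (T t) _)))))
      where
      swap : ∀ w a t → w ⊕ (a ⊕ t) ≡ a ⊕ (w ⊕ t)
      swap = solve 3 (λ w a t → w :+ (a :+ t) := a :+ (w :+ t)) refl

    inner-bound : ∀ t → N * (M - P * N ² - ∑[ w ] (ρ t w) ²) ≤ inner t
    inner-bound t = ≤-slack _ (gap variance) (trans (eq N M P R V) (sym split))
      where
      R = ∑[ w ] (ρ t w) ²
      V = ∑[ w ] ∑[ a ] (f a * (ρ t w + (N * f (a ⊕ (w ⊕ t)) - h (w ⊕ t))) ²)
      variance : V ≤ N * R + P * (N * N ²)
      variance = ≤-trans (∑-mono (λ w → sample-variance (ρ t w) (w ⊕ t)))
        (≤-reflexive (trans (∑-+ _ _) (cong₂ _+_ (∑-*ˡ N _) (∑-const p _))))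
      split : inner t ≡ N * M - V
      split = trans (∑-cong (λ a → eq₁ (f a) M _)) (trans (∑-lin₂ M ((- 1ℤ)) f _)
        (trans (cong (λ v → M * N + (- 1ℤ) * v) (trans (∑-cong (λ a → sym (∑-*ˡ (f a) _))) (∑-comm _))) (eq₂ M N V)))
        where
        opaque
          unfolding _+_
          eq₁ : ∀ f M s → f * (M - s) ≡ M * f + (- 1ℤ) * (f * s)
          eq₁ = solve-∀
          eq₂ : ∀ M N V → M * N + (- 1ℤ) * V ≡ N * M - V
          eq₂ = solve-∀
      opaque
        unfolding _+_
        eq : ∀ N M P R V → N * (M - P * (N * N) - R) + (N * R + P * (N * (N * N)) - V) ≡ N * M - V
        eq = solve-∀

    pointwise : ∀ t → N * (T t * (M - P * N ² - ∑[ w ] (ρ t w) ²)) ≤ T t * inner t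
    pointwise t = ≤-trans (≤-reflexive (eq N (T t) _)) (*-monoˡ (indicator-nonneg T-ind t) (inner-bound t))
      where
      opaque
        unfolding _+_
        eq : ∀ a b c → a * (b * c) ≡ b * (a * c)
        eq = solve-∀

  -- In use, `φ w` is the number of centres `c` chosen so far with `w ⊕ c` in A. For every `t` in
  -- `T` it estimates `k * h (w ⊕ t) / N` from `k` samples. As one `φ` serves all `t`, small
  -- residuals force `h` to agree across shifts by elements of `T`.
  residual : ℤ → (Fin p → ℤ) → Fin p → Fin p → ℤ
  residual k φ t w = N * φ w - k * h (w ⊕ t)

  residual-extend : ∀ k φ c t w → extend c (residual k φ) t w ≡ residual (1ℤ + k) (λ w → φ w + f (w ⊕ c)) t w
  residual-extend k φ c t w = eq N (φ w) k (h (w ⊕ t)) (f (w ⊕ c))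
    where
    opaque
      unfolding _+_
      eq : ∀ N φ k h f → N * φ - k * h + (N * f - h) ≡ N * (φ + f) - (1ℤ + k) * h
      eq = solve-∀

  Potential-cong : ∀ M T {ρ ρ′} → (∀ t w → ρ t w ≡ ρ′ t w) → Potential M T ρ ≡ Potential M T ρ′
  Potential-cong M T ρ≡ρ′ = ∑-cong (λ t → cong (λ s → T t * (M - s)) (∑-cong (λ w → cong _² (ρ≡ρ′ t w))))

  Potential-start : ∀ M → Potential M (λ _ → 1ℤ) (residual 0ℤ (λ _ → 0ℤ)) ≡ P * M
  Potential-start M = trans
    (∑-cong (λ t → trans (cong (λ s → 1ℤ * (M - s)) (∑-zero (λ w → eq₁ N (h (w ⊕ t))))) (eq₂ M)))
    (∑-const p M)
    where
    opaque
      unfolding _+_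
      eq₁ : ∀ N h → (N * 0ℤ - 0ℤ * h) * (N * 0ℤ - 0ℤ * h) ≡ 0ℤ
      eq₁ = solve-∀
      eq₂ : ∀ M → 1ℤ * (M - 0ℤ) ≡ M
      eq₂ = solve-∀

  -- The number of samples appears both as the exponent `k` and as the integer `κ`, since `+ suc k`
  -- does not reduce to an opaque sum.
  Sample : ℤ → ℕ → ℤ → Set
  Sample κ k M = ∃ λ T → ∃ λ φ → Indicator T × N ^ k * (P * (M - κ * (P * N ²))) ≤ P ^ k * Potential M T (residual κ φ)

  0≤P^ : ∀ k → 0ℤ ≤ P ^ k
  0≤P^ zero = 0≤+ 1
  0≤P^ (suc k) = 0≤+ p · 0≤P^ k

  sampling-step : ∀ κ k M → Sample κ k (M - P * N ²) → Sample (1ℤ + κ) (suc k) M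
  sampling-step κ k M (T , φ , T-ind , bound)
    with ∃-above-average (λ c → Potential M (restrict c T) (extend c (residual κ φ))) 0<p (total-potential M T (residual κ φ) T-ind)
  ... | c , above = T′ , φ′ , product-indicator T-ind (λ t → f-ind (c ⊖ t)) , (begin
      N * N ^ k * (P * (M - (1ℤ + κ) * (P * N ²)))    ≡⟨ eq₁ N (N ^ k) P M κ (P * N ²) ⟩
      N * (N ^ k * (P * (M - P * N ² - κ * (P * N ²))))  ≤⟨ *-monoˡ 0≤N bound ⟩
      N * (P ^ k * V)                                   ≡⟨ eq₂ N (P ^ k) V ⟩
      P ^ k * (N * V)                                   ≤⟨ *-monoˡ (0≤P^ k) above ⟩
      P ^ k * (P * V′)                                  ≡⟨ eq₃ (P ^ k) P V′ ⟩
      P * P ^ k * V′                                    ≡⟨ cong (P * P ^ k *_) (Potential-cong M T′ (residual-extend κ φ c)) ⟩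
      P * P ^ k * Potential M T′ (residual (1ℤ + κ) φ′) ∎)
    where
    open ℤₚ.≤-Reasoning
    T′ = restrict c T
    φ′ = λ w → φ w + f (w ⊕ c)
    V = Potential (M - P * N ²) T (residual κ φ)
    V′ = Potential M T′ (extend c (residual κ φ))
    opaque
      unfolding _+_
      eq₁ : ∀ N X P M k Y → N * X * (P * (M - (1ℤ + k) * Y)) ≡ N * (X * (P * (M - Y - k * Y)))
      eq₁ = solve-∀
      eq₂ : ∀ a b c → a * (b * c) ≡ b * (a * c)
      eq₂ = solve-∀
      eq₃ : ∀ a b c → a * (b * c) ≡ b * a * c
      eq₃ = solve-∀

  -- The Croot–Sisask sampling argument, derandomised: T is an intersection of k translates of the
  -- reflected set, each chosen so that the potential does not fall below its average.
  sampling : ∀ k M → Sample (+ k) k M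
  sampling zero M = (λ _ → 1ℤ) , (λ _ → 0ℤ) , (λ _ → inj₂ refl) ,
    ≤-reflexive (trans (eq P M (P * N ²)) (trans (sym (Potential-start M)) (sym (*-identityˡ _))))
    where
    opaque
      unfolding _+_
      eq : ∀ P M X → 1ℤ * (P * (M - 0ℤ * X)) ≡ P * M
      eq = solve-∀
  sampling (suc k) M = subst (λ κ → Sample κ (suc k) M) (sym (pos-+ 1 k)) (sampling-step (+ k) k M (sampling k (M - P * N ²)))

-- Sums over a subset T.

module Averaging {p : ℕ} (T : Fin p → ℤ) (T-ind : Sums.Indicator T) where

  open Arithmetic
  open Sums

  b : ℤ
  b = ∑ T

  infixr 7.5 𝔼
  -- An average without the division by `b`: every nested `𝔼` carries a factor `b`, which accounts
  -- for the powers of `b` below.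
  𝔼 : (Fin p → ℤ) → ℤ
  𝔼 g = ∑[ t ] (T t * g t)

  syntax 𝔼 (λ t → e) = 𝔼[ t ] e

  0≤b : 0ℤ ≤ b
  0≤b = ∑-nonneg (indicator-nonneg T-ind)

  𝔼-cong : ∀ {g g′ : Fin p → ℤ} → (∀ t → g t ≡ g′ t) → 𝔼 g ≡ 𝔼 g′
  𝔼-cong g≡g′ = ∑-cong (λ t → cong (T t *_) (g≡g′ t))

  𝔼-mono : ∀ {g g′ : Fin p → ℤ} → (∀ t → g t ≤ g′ t) → 𝔼 g ≤ 𝔼 g′
  𝔼-mono g≤g′ = ∑-mono (λ t → *-monoˡ (indicator-nonneg T-ind t) (g≤g′ t))

  𝔼-nonneg : ∀ {g : Fin p → ℤ} → (∀ t → 0ℤ ≤ g t) → 0ℤ ≤ 𝔼 g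
  𝔼-nonneg 0≤g = ∑-nonneg (λ t → indicator-nonneg T-ind t · 0≤g t)

  𝔼-*ˡ : ∀ c (g : Fin p → ℤ) → 𝔼[ t ] (c * g t) ≡ c * 𝔼 g
  𝔼-*ˡ c g = trans (∑-cong (λ t → eq (T t) c (g t))) (∑-*ˡ c _)
    where
    opaque
      unfolding _+_
      eq : ∀ a b c → a * (b * c) ≡ b * (a * c)
      eq = solve-∀

  𝔼-*ʳ : ∀ (g : Fin p → ℤ) c → 𝔼[ t ] (g t * c) ≡ 𝔼 g * c
  𝔼-*ʳ g c = trans (𝔼-cong (λ t → *-comm (g t) c)) (trans (𝔼-*ˡ c g) (*-comm c (𝔼 g)))

  𝔼-affine : ∀ c d (g : Fin p → ℤ) → 𝔼[ t ] (c + d * g t) ≡ c * b + d * 𝔼 g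
  𝔼-affine c d g = trans (∑-cong (λ t → eq (T t) c d (g t))) (∑-lin₂ c d T _)
    where
    opaque
      unfolding _+_
      eq : ∀ t c d g → t * (c + d * g) ≡ c * t + d * (t * g)
      eq = solve-∀

  𝔼-const : ∀ c → 𝔼[ t ] c ≡ c * b
  𝔼-const c = trans (∑-cong (λ t → *-comm (T t) c)) (∑-*ˡ c T)

  ∑-𝔼-comm : ∀ {n} (g : Fin n → Fin p → ℤ) → ∑[ x ] 𝔼 (g x) ≡ 𝔼[ t ] ∑[ x ] g x t
  ∑-𝔼-comm g = trans (∑-comm _) (∑-cong (λ t → ∑-*ˡ (T t) _))

-- Solutions of a + a′ = a″ perturbed by elements of T.

module Container {p : ℕ} (𝔽 : FiniteField.PrimeField p) (f : Fin p → ℤ) (f-ind : Sums.Indicator f)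
  (f-sum-free : FieldProperties.SumFreeIndicator 𝔽 f) where

  open Arithmetic
  open Sums
  open FieldProperties 𝔽
  open Solver using (solve; _:=_; _:+_; _:-_)
  open Sampling 𝔽 f f-ind

  f*h≡0 : ∀ x → f x * h x ≡ 0ℤ
  f*h≡0 x = trans (sym (∑-*ˡ (f x) _)) (∑-zero (f-sum-free x))

  module Telescoping (T : Fin p → ℤ) (T-ind : Indicator T) (κ lam : ℤ) (φ : Fin p → ℤ) where

    open Averaging T T-ind

    r : Fin p → Fin p → ℤ
    r = residual κ φ

    E : Fin p → ℤ
    E t = ∑[ w ] (r t w) ²

    -- The number of solutions of `a + a′ + e = a″` in A with the defect `e = t₁ - t₂ + t₄ - t₃`.
    G : Fin p → Fin p → Fin p → Fin p → ℤ
    G t₁ t₂ t₃ t₄ = ∑[ z ] (f z * h (z ⊕ t₁ ⊖ t₂ ⊕ t₄ ⊖ t₃))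

    -- For `z` in A, `h z` vanishes, and the argument on the left is reached from `z` by two
    -- exchanges of elements of `T`: `t₄` for `t₃` at the base point `z ⊖ t₃`, then `t₁` for `t₂` at
    -- `z ⊖ t₂ ⊕ t₄ ⊖ t₃`. In each exchange the two residuals share a base point, so the unknown
    -- `N * φ` cancels. Four uses of `2 lam r ≤ lam² + r²` separate the residuals.
    pointwise : ∀ t₁ t₂ t₃ t₄ z → + 2 * lam * κ * (f z * h (z ⊕ t₁ ⊖ t₂ ⊕ t₄ ⊖ t₃)) ≤
      + 4 * lam ² + ((r t₁ (z ⊖ t₂ ⊕ t₄ ⊖ t₃)) ² + (r t₂ (z ⊖ t₂ ⊕ t₄ ⊖ t₃)) ² + (r t₃ (z ⊖ t₃)) ² + (r t₄ (z ⊖ t₃)) ²)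
    pointwise t₁ t₂ t₃ t₄ z with f-ind z | f*h≡0 z
    ... | inj₁ fz≡0 | _ rewrite fz≡0 = outside (+ 2 * lam * κ) (h (z ⊕ t₁ ⊖ t₂ ⊕ t₄ ⊖ t₃)) lam
        (r t₁ (z ⊖ t₂ ⊕ t₄ ⊖ t₃)) (r t₂ (z ⊖ t₂ ⊕ t₄ ⊖ t₃)) (r t₃ (z ⊖ t₃)) (r t₄ (z ⊖ t₃))
      where
      outside : ∀ c H l r₁ r₂ r₃ r₄ → c * (0ℤ * H) ≤ + 4 * l ² + (r₁ ² + r₂ ² + r₃ ² + r₄ ²)
      outside c H l r₁ r₂ r₃ r₄ = ≤-slack _
        (0≤+ 4 · square-nonneg l ⊹ (square-nonneg r₁ ⊹ square-nonneg r₂ ⊹ square-nonneg r₃ ⊹ square-nonneg r₄)) (eq c H _)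
        where
        opaque
          unfolding _+_
          eq : ∀ c H x → c * (0ℤ * H) + x ≡ x
          eq = solve-∀
    ... | inj₂ fz≡1 | hz≡0 rewrite fz≡1 | *-identityˡ (h z) =
      ≤-slack _ (square-nonneg (lam + r₁) ⊹ square-nonneg (lam - r₂) ⊹ square-nonneg (lam - r₃) ⊹ square-nonneg (lam + r₄))
        (identity lam κ H r₁ r₂ r₃ r₄ telescope)
      where
      H = h (z ⊕ t₁ ⊖ t₂ ⊕ t₄ ⊖ t₃)
      r₁ = r t₁ (z ⊖ t₂ ⊕ t₄ ⊖ t₃)
      r₂ = r t₂ (z ⊖ t₂ ⊕ t₄ ⊖ t₃)
      r₃ = r t₃ (z ⊖ t₃)
      r₄ = r t₄ (z ⊖ t₃)
      end₁ : ∀ z t₁ t₂ t₃ t₄ → z ⊖ t₂ ⊕ t₄ ⊖ t₃ ⊕ t₁ ≡ z ⊕ t₁ ⊖ t₂ ⊕ t₄ ⊖ t₃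
      end₁ = solve 5 (λ z t₁ t₂ t₃ t₄ → z :- t₂ :+ t₄ :- t₃ :+ t₁ := z :+ t₁ :- t₂ :+ t₄ :- t₃) refl
      end₂ : ∀ z t₂ t₃ t₄ → z ⊖ t₂ ⊕ t₄ ⊖ t₃ ⊕ t₂ ≡ z ⊖ t₃ ⊕ t₄
      end₂ = solve 4 (λ z t₂ t₃ t₄ → z :- t₂ :+ t₄ :- t₃ :+ t₂ := z :- t₃ :+ t₄) refl
      telescope : κ * H ≡ r₂ - r₁ + (r₃ - r₄)
      telescope = begin
        κ * H                                   ≡⟨ cong (λ x → κ * h x) (sym (end₁ z t₁ t₂ t₃ t₄)) ⟩
        κ * H₁                                  ≡⟨ eq₁ (κ * H₁) ⟩
        κ * H₁ - 0ℤ                             ≡⟨ cong (_-_ (κ * H₁)) (sym (trans (cong (κ *_) h-end) (*-zeroʳ κ))) ⟩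
        κ * H₁ - κ * H₃                         ≡⟨ eq₂ κ N (φ w) (φ w′) H₁ H₃ H₄ ⟩
        (N * φ w - κ * H₄) - r₁ + (r₃ - r₄)     ≡⟨ cong (λ x → (N * φ w - κ * h x) - r₁ + (r₃ - r₄)) (sym (end₂ z t₂ t₃ t₄)) ⟩
        r₂ - r₁ + (r₃ - r₄)                     ∎
        where
        open ≡-Reasoning
        w = z ⊖ t₂ ⊕ t₄ ⊖ t₃
        w′ = z ⊖ t₃
        H₁ = h (w ⊕ t₁)
        H₃ = h (w′ ⊕ t₃)
        H₄ = h (w′ ⊕ t₄)
        h-end : H₃ ≡ 0ℤ
        h-end = trans (cong h (x⊖y⊕y≡x z t₃)) hz≡0
        opaque
          unfolding _+_
          eq₁ : ∀ a → a ≡ a - 0ℤ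
          eq₁ = solve-∀
          eq₂ : ∀ κ N φ φ′ H₁ H₃ H₄ → κ * H₁ - κ * H₃ ≡
            (N * φ - κ * H₄) - (N * φ - κ * H₁) + ((N * φ′ - κ * H₃) - (N * φ′ - κ * H₄))
          eq₂ = solve-∀
      identity : ∀ l κ H r₁ r₂ r₃ r₄ → κ * H ≡ r₂ - r₁ + (r₃ - r₄) →
        + 2 * l * κ * (1ℤ * H) + ((l + r₁) * (l + r₁) + (l - r₂) * (l - r₂) + (l - r₃) * (l - r₃) + (l + r₄) * (l + r₄))
          ≡ + 4 * (l * l) + (r₁ * r₁ + r₂ * r₂ + r₃ * r₃ + r₄ * r₄)
      identity l κ H r₁ r₂ r₃ r₄ e = trans (cong (_+ _) (trans (eq₁ l κ H) (cong (+ 2 * l *_) e))) (eq₂ l r₁ r₂ r₃ r₄)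
        where
        opaque
          unfolding _+_
          eq₁ : ∀ l κ H → + 2 * l * κ * (1ℤ * H) ≡ + 2 * l * (κ * H)
          eq₁ = solve-∀
          eq₂ : ∀ l r₁ r₂ r₃ r₄ → + 2 * l * (r₂ - r₁ + (r₃ - r₄)) +
              ((l + r₁) * (l + r₁) + (l - r₂) * (l - r₂) + (l - r₃) * (l - r₃) + (l + r₄) * (l + r₄))
            ≡ + 4 * (l * l) + (r₁ * r₁ + r₂ * r₂ + r₃ * r₃ + r₄ * r₄)
          eq₂ = solve-∀

    C : ℤ
    C = P * (+ 4 * lam ²)

    G-bound : ∀ t₁ t₂ t₃ t₄ → + 2 * lam * κ * G t₁ t₂ t₃ t₄ ≤ C + 1ℤ * E t₂ + 1ℤ * E t₃ + 1ℤ * E t₄ + 1ℤ * E t₁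
    G-bound t₁ t₂ t₃ t₄ = ≤-trans (≤-reflexive (sym (∑-*ˡ (+ 2 * lam * κ) _)))
      (≤-trans (∑-mono (pointwise t₁ t₂ t₃ t₄)) (≤-reflexive total))
      where
      far : ∀ g → ∑[ z ] g (z ⊖ t₂ ⊕ t₄ ⊖ t₃) ≡ ∑ g
      far g = sym (trans (∑-unshift g t₃) (trans (∑-shift _ t₄) (∑-unshift _ t₂)))
      near : ∀ g → ∑[ z ] g (z ⊖ t₃) ≡ ∑ g
      near g = sym (∑-unshift g t₃)
      total : ∑[ z ] (+ 4 * lam ² + ((r t₁ (z ⊖ t₂ ⊕ t₄ ⊖ t₃)) ² + (r t₂ (z ⊖ t₂ ⊕ t₄ ⊖ t₃)) ² + (r t₃ (z ⊖ t₃)) ² + (r t₄ (z ⊖ t₃)) ²))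
        ≡ C + 1ℤ * E t₂ + 1ℤ * E t₃ + 1ℤ * E t₄ + 1ℤ * E t₁
      total = trans (trans (∑-+ _ _) (cong₂ _+_ (∑-const p _) (trans (∑-+ _ _) (cong₂ _+_ (trans (∑-+ _ _) (cong₂ _+_
          (trans (∑-+ _ _) (cong₂ _+_ (far (λ w → (r t₁ w) ²)) (far (λ w → (r t₂ w) ²)))) (near (λ w → (r t₃ w) ²)))) (near (λ w → (r t₄ w) ²))))))
        (eq C (E t₁) (E t₂) (E t₃) (E t₄))
        where
        opaque
          unfolding _+_
          eq : ∀ c a b d e → c + (a + b + d + e) ≡ c + 1ℤ * b + 1ℤ * d + 1ℤ * e + 1ℤ * a
          eq = solve-∀

    -- By `triples-α` this is `𝔼 (triples α)` with `t₄` as the shift, which is why `t₄` is the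
    -- outermost variable.
    W : ℤ
    W = 𝔼[ t₄ ] 𝔼[ t₂ ] 𝔼[ t₃ ] 𝔼[ t₁ ] G t₁ t₂ t₃ t₄

    W-bound : + 2 * lam * κ * W ≤ C * b ^ 4 + + 4 * b ^ 3 * 𝔼 E
    W-bound = ≤-trans (≤-reflexive pull) (≤-trans
      (𝔼-mono (λ t₄ → 𝔼-mono (λ t₂ → 𝔼-mono (λ t₃ → 𝔼-mono (λ t₁ → G-bound t₁ t₂ t₃ t₄))))) (≤-reflexive total))
      where
      c = + 2 * lam * κ
      pull : c * W ≡ 𝔼[ t₄ ] 𝔼[ t₂ ] 𝔼[ t₃ ] 𝔼[ t₁ ] (c * G t₁ t₂ t₃ t₄)
      pull = sym (trans (𝔼-cong (λ t₄ → trans (𝔼-cong (λ t₂ → trans (𝔼-cong (λ t₃ → 𝔼-*ˡ c _)) (𝔼-*ˡ c _))) (𝔼-*ˡ c _))) (𝔼-*ˡ c _))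
      R = 𝔼 E
      total : 𝔼[ t₄ ] 𝔼[ t₂ ] 𝔼[ t₃ ] 𝔼[ t₁ ] (C + 1ℤ * E t₂ + 1ℤ * E t₃ + 1ℤ * E t₄ + 1ℤ * E t₁) ≡ C * b ^ 4 + + 4 * b ^ 3 * R
      total = trans (𝔼-cong (λ t₄ → trans (𝔼-cong (λ t₂ → trans (𝔼-cong (λ t₃ →
            trans (𝔼-affine _ 1ℤ E) (eq₁ b C (E t₂) (E t₃) (E t₄) R)))
          (trans (𝔼-affine _ b E) (eq₂ b C (E t₂) (E t₄) R))))
          (trans (𝔼-affine _ (b * b) E) (eq₃ b C (E t₄) R))))
        (trans (𝔼-affine _ (b * b * b) E) (eq₄ b C R))
        where
        opaque
          unfolding _+_
          eq₁ : ∀ b C x y z R → (C + 1ℤ * x + 1ℤ * y + 1ℤ * z) * b + 1ℤ * R ≡ ((C + x + z) * b + R) + b * y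
          eq₁ = solve-∀
          eq₂ : ∀ b C x z R → ((C + x + z) * b + R) * b + b * R ≡ ((C + z) * (b * b) + + 2 * b * R) + b * b * x
          eq₂ = solve-∀
          eq₃ : ∀ b C z R → ((C + z) * (b * b) + + 2 * b * R) * b + b * b * R ≡ (C * (b * b * b) + + 3 * (b * b) * R) + b * b * b * z
          eq₃ = solve-∀
          eq₄ : ∀ b C R → (C * (b * b * b) + + 3 * (b * b) * R) * b + b * b * b * R
            ≡ C * (b * (b * (b * (b * 1ℤ)))) + + 4 * (b * (b * (b * 1ℤ))) * R
          eq₄ = solve-∀

-- Laws of powers.

module PowerLaws where

  open Arithmetic

  ^-pos : ∀ {a} → 0ℤ < a → ∀ k → 0ℤ < a ^ k
  ^-pos 0<a zero = 1≤⇒0< ≤-refl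
  ^-pos {a} 0<a (suc k) = *-pos 0<a (^-pos 0<a k)

  ^-mono : ∀ {a b} → 0ℤ ≤ a → 0ℤ ≤ b → a ≤ b → ∀ k → 0ℤ ≤ a ^ k × a ^ k ≤ b ^ k
  ^-mono 0≤a 0≤b a≤b zero = 0≤+ 1 , ≤-refl
  ^-mono 0≤a 0≤b a≤b (suc k) with ^-mono 0≤a 0≤b a≤b k
  ... | 0≤a^k , a^k≤b^k = 0≤a · 0≤a^k , *-mono 0≤a (≤-trans 0≤a^k a^k≤b^k) a≤b a^k≤b^k

  ^-*-distrib : ∀ a b k → (a * b) ^ k ≡ a ^ k * b ^ k
  ^-*-distrib a b zero = sym (*-identityˡ 1ℤ)
  ^-*-distrib a b (suc k) = trans (cong (a * b *_) (^-*-distrib a b k)) (eq a b (a ^ k) (b ^ k))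
    where
    opaque
      unfolding _+_
      eq : ∀ a b x y → a * b * (x * y) ≡ a * x * (b * y)
      eq = solve-∀

-- Counting solutions of v + w + d = u.

module Triples {p : ℕ} (𝔽 : FiniteField.PrimeField p) where

  open Arithmetic
  open Sums
  open FieldProperties 𝔽

  triples : (Fin p → ℤ) → Fin p → ℤ
  triples σ d = ∑[ v ] ∑[ w ] (σ v * (σ w * σ (v ⊕ w ⊕ d)))

  triples-nonneg : ∀ {σ} → (∀ x → 0ℤ ≤ σ x) → ∀ d → 0ℤ ≤ triples σ d
  triples-nonneg 0≤σ d = ∑-nonneg (λ v → ∑-nonneg (λ w → 0≤σ v · (0≤σ w · 0≤σ (v ⊕ w ⊕ d))))

  module Neighbourhoods (f T : Fin p → ℤ) (T-ind : Indicator T) where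

    open Averaging T T-ind

    α : Fin p → ℤ
    α u = 𝔼[ t ] f (u ⊕ t)

    -- The relevant σ marks the translates u + T with at least b / ℓ points in the set with indicator f.
    FewTriples : ℤ → Set
    FewTriples ℓ = ∀ σ → Indicator σ → (∀ u → b * σ u ≤ ℓ * α u) → ℓ ² * 𝔼 (triples σ) ≤ (+ p) ² * b

    -- The hypothesis is used once for each of the three factors, hence the cubes. The gain is that
    -- `triples α`, unlike `triples σ`, expands into solutions in A.
    triples-scale : ∀ ℓ {σ} → 0ℤ ≤ ℓ → (∀ x → 0ℤ ≤ f x) → (∀ x → 0ℤ ≤ σ x) → (∀ u → b * σ u ≤ ℓ * α u) →
      ∀ d → b ^ 3 * triples σ d ≤ ℓ ^ 3 * triples α d
    triples-scale ℓ {σ} 0≤ℓ 0≤f 0≤σ bσ≤ℓα d = subst₂ _≤_ (pull b σ) (pull ℓ α)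
      (∑-mono (λ v → ∑-mono (λ w → *-mono (bσ v) (ℓα w · ℓα _) (bσ≤ℓα v) (*-mono (bσ w) (ℓα _) (bσ≤ℓα w) (bσ≤ℓα _)))))
      where
      bσ : ∀ u → 0ℤ ≤ b * σ u
      bσ u = 0≤b · 0≤σ u
      ℓα : ∀ u → 0ℤ ≤ ℓ * α u
      ℓα u = 0≤ℓ · 𝔼-nonneg (λ t → 0≤f (u ⊕ t))
      pull : ∀ c g → ∑[ v ] ∑[ w ] (c * g v * (c * g w * (c * g (v ⊕ w ⊕ d)))) ≡ c ^ 3 * triples g d
      pull c g = trans (∑-cong (λ v → trans (∑-cong (λ w → eq c (g v) (g w) (g (v ⊕ w ⊕ d)))) (∑-*ˡ (c ^ 3) _))) (∑-*ˡ (c ^ 3) _)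
        where
        opaque
          unfolding _+_
          eq : ∀ c x y z → c * x * (c * y * (c * z)) ≡ c * (c * (c * 1ℤ)) * (x * (y * z))
          eq = solve-∀

-- The container lemma: few triples among the centres of rich translates.

module ContainerLemma {p : ℕ} (𝔽 : FiniteField.PrimeField p) (f : Fin p → ℤ) (f-ind : Sums.Indicator f)
  (f-sum-free : FieldProperties.SumFreeIndicator 𝔽 f) where

  open Arithmetic
  open Sums
  open PowerLaws
  open FieldProperties 𝔽
  open Solver using (solve; _:=_; _:+_; _:-_)
  open Sampling 𝔽 f f-ind
  open Container 𝔽 f f-ind f-sum-free
  open Triples 𝔽

  module _ (T : Fin p → ℤ) (T-ind : Indicator T) (κ lam : ℤ) (φ : Fin p → ℤ) where

    open Averaging T T-ind
    open Neighbourhoods f T T-ind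
    open Telescoping T T-ind κ lam φ

    -- Opening the three factors picks `y = v ⊕ t₂` and `z = w ⊕ t₃` in A, and the third point
    -- becomes `y ⊕ (z ⊕ t₁ ⊖ t₂ ⊕ d ⊖ t₃)`; so `d` takes the place of `t₄`.
    triples-α : ∀ d → triples α d ≡ 𝔼[ t₂ ] 𝔼[ t₃ ] 𝔼[ t₁ ] G t₁ t₂ t₃ d
    triples-α d = begin
      ∑[ v ] ∑[ w ] (α v * (α w * α (v ⊕ w ⊕ d)))
        ≡⟨ ∑-cong (λ v → ∑-cong (λ w → expand v w (v ⊕ w ⊕ d))) ⟩
      ∑[ v ] ∑[ w ] 𝔼[ t₂ ] 𝔼[ t₃ ] 𝔼[ t₁ ] F t₁ t₂ t₃ v w
        ≡⟨ ∑-cong (λ v → swap₃ (λ w t₂ t₃ t₁ → F t₁ t₂ t₃ v w)) ⟩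
      ∑[ v ] 𝔼[ t₂ ] 𝔼[ t₃ ] 𝔼[ t₁ ] ∑[ w ] F t₁ t₂ t₃ v w
        ≡⟨ swap₃ (λ v t₂ t₃ t₁ → ∑[ w ] F t₁ t₂ t₃ v w) ⟩
      𝔼[ t₂ ] 𝔼[ t₃ ] 𝔼[ t₁ ] ∑[ v ] ∑[ w ] F t₁ t₂ t₃ v w
        ≡⟨ 𝔼-cong (λ t₂ → 𝔼-cong (λ t₃ → 𝔼-cong (λ t₁ → substitute t₁ t₂ t₃))) ⟩
      𝔼[ t₂ ] 𝔼[ t₃ ] 𝔼[ t₁ ] G t₁ t₂ t₃ d ∎
      where
      open ≡-Reasoning
      F : Fin p → Fin p → Fin p → Fin p → Fin p → ℤ
      F t₁ t₂ t₃ v w = f (v ⊕ t₂) * (f (w ⊕ t₃) * f (v ⊕ w ⊕ d ⊕ t₁))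
      expand : ∀ v w u → α v * (α w * α u) ≡ 𝔼[ t₂ ] 𝔼[ t₃ ] 𝔼[ t₁ ] (f (v ⊕ t₂) * (f (w ⊕ t₃) * f (u ⊕ t₁)))
      expand v w u = trans (sym (𝔼-*ʳ _ _)) (𝔼-cong (λ t₂ → trans (cong (f (v ⊕ t₂) *_) (sym (𝔼-*ʳ _ _)))
        (trans (sym (𝔼-*ˡ _ _)) (𝔼-cong (λ t₃ → trans (cong (f (v ⊕ t₂) *_) (sym (𝔼-*ˡ _ _))) (sym (𝔼-*ˡ _ _)))))))
      swap₃ : ∀ (g : Fin p → Fin p → Fin p → Fin p → ℤ) →
        ∑[ x ] 𝔼[ r ] 𝔼[ s ] 𝔼[ t ] g x r s t ≡ 𝔼[ r ] 𝔼[ s ] 𝔼[ t ] ∑[ x ] g x r s t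
      swap₃ g = trans (∑-𝔼-comm _) (𝔼-cong (λ r → trans (∑-𝔼-comm _) (𝔼-cong (λ s → ∑-𝔼-comm _))))
      substitute : ∀ t₁ t₂ t₃ → ∑[ v ] ∑[ w ] F t₁ t₂ t₃ v w ≡ G t₁ t₂ t₃ d
      substitute t₁ t₂ t₃ = begin
        ∑[ v ] ∑[ w ] F t₁ t₂ t₃ v w
          ≡⟨ ∑-unshift _ t₂ ⟩
        ∑[ y ] ∑[ w ] F t₁ t₂ t₃ (y ⊖ t₂) w
          ≡⟨ ∑-cong (λ y → ∑-unshift _ t₃) ⟩
        ∑[ y ] ∑[ z ] F t₁ t₂ t₃ (y ⊖ t₂) (z ⊖ t₃)
          ≡⟨ ∑-comm _ ⟩
        ∑[ z ] ∑[ y ] F t₁ t₂ t₃ (y ⊖ t₂) (z ⊖ t₃)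
          ≡⟨ ∑-cong (λ z → trans (∑-cong (λ y → pointwise′ y z)) (∑-*ˡ (f z) _)) ⟩
        G t₁ t₂ t₃ d ∎
        where
        opaque
          unfolding _+_
          eq : ∀ a b c → a * (b * c) ≡ b * (a * c)
          eq = solve-∀
        place : ∀ y z t₁ t₂ t₃ d → y ⊖ t₂ ⊕ (z ⊖ t₃) ⊕ d ⊕ t₁ ≡ y ⊕ (z ⊕ t₁ ⊖ t₂ ⊕ d ⊖ t₃)
        place = solve 6 (λ y z t₁ t₂ t₃ d → y :- t₂ :+ (z :- t₃) :+ d :+ t₁ := y :+ (z :+ t₁ :- t₂ :+ d :- t₃)) refl
        pointwise′ : ∀ y z → F t₁ t₂ t₃ (y ⊖ t₂) (z ⊖ t₃) ≡ f z * (f y * f (y ⊕ (z ⊕ t₁ ⊖ t₂ ⊕ d ⊖ t₃)))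
        pointwise′ y z = trans (cong₂ _*_ (cong f (x⊖y⊕y≡x y t₂)) (cong₂ _*_ (cong f (x⊖y⊕y≡x z t₃)) (cong f (place y z t₁ t₂ t₃ d))))
          (eq (f y) (f z) _)

  -- `K²` samples determine `h` up to a relative error of order `1 / K`, and `lam = K P` matches the
  -- size of a typical residual. This gives `K W ≤ 6 P² b⁴`; passing from `σ` to `α` loses `ℓ³`, so
  -- `K = 6 ℓ⁵` leaves the factor `ℓ²` of `FewTriples`.
  container-lemma : ∀ (ℓ : ℤ) (K : ℕ) → 0ℤ < ℓ → + K ≡ + 6 * ℓ ^ 5 → P ≤ + 9 * N →
    ∃ λ T → Σ (Indicator T) λ T-ind → P ≤ + 2 * + 9 ^ (K ℕ* K) * ∑ T × Neighbourhoods.FewTriples f T T-ind ℓ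
  -- The credit `M` is twice the total variance `κ * (P * N ²)` of the samples, so half of it is
  -- left after they are paid for.
  container-lemma ℓ K 0<ℓ K≡6ℓ⁵ P≤9N with sampling (K ℕ* K) (+ 2 * + (K ℕ* K) * (P * N ²))
  ... | T , φ , T-ind , bound = T , T-ind , dense , few-triples
    where
    open Averaging T T-ind
    open Neighbourhoods f T T-ind
    k = K ℕ* K
    κ = + k
    Q = P * N ²
    M = + 2 * κ * Q
    open Telescoping T T-ind κ (+ K * P) φ

    0≤ℓ : 0ℤ ≤ ℓ
    0≤ℓ = <⇒≤ 0<ℓ
    0<6ℓ^ : ∀ n → 0ℤ < + 6 * ℓ ^ n
    0<6ℓ^ n = *-pos (+<+ (s≤s z≤n)) (^-pos 0<ℓ n)
    0<K : 0ℤ < + K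
    0<K = subst (0ℤ <_) (sym K≡6ℓ⁵) (0<6ℓ^ 5)
    κ≡K² : κ ≡ + K * + K
    κ≡K² = pos-* K K
    0<κ : 0ℤ < κ
    0<κ = subst (0ℤ <_) (sym κ≡K²) (*-pos 0<K 0<K)
    0<N : 0ℤ < N
    0<N = *-cancelˡ-< {+ 9} (0≤+ 9) (<-≤-trans (subst (_< P) (sym (*-zeroʳ (+ 9))) 0<p) P≤9N)
    0<κQ : 0ℤ < κ * Q
    0<κQ = *-pos 0<κ (*-pos 0<p (*-pos 0<N 0<N))
    N≤P : N ≤ P
    N≤P = ∑-indicator-≤ f-ind

    potential : Potential M T r ≡ M * b - 𝔼 E
    potential = trans (∑-cong (λ t → eq₁ (T t) M (E t))) (trans (∑-lin₂ M (- 1ℤ) T _) (eq₂ M b (𝔼 E)))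
      where
      opaque
        unfolding _+_
        eq₁ : ∀ t M e → t * (M - e) ≡ M * t + (- 1ℤ) * (t * e)
        eq₁ = solve-∀
        eq₂ : ∀ M b r → M * b + (- 1ℤ) * r ≡ M * b - r
        eq₂ = solve-∀

    -- Used twice: its left side is nonnegative, which bounds `𝔼 E` from above, and dropping `𝔼 E`
    -- from the right bounds `b` from below.
    lower : N ^ k * P * (κ * Q) ≤ P ^ k * (M * b - 𝔼 E)
    lower = subst₂ _≤_ (eq (N ^ k) P κ Q) (cong (P ^ k *_) potential) bound
      where
      opaque
        unfolding _+_
        eq : ∀ X P κ Q → X * (P * (+ 2 * κ * Q - κ * Q)) ≡ X * P * (κ * Q)
        eq = solve-∀

    residual-small : 𝔼 E ≤ M * b
    residual-small = gap⁻¹ (*-cancelˡ (^-pos 0<p k) (≤-trans (≤-reflexive (*-zeroʳ (P ^ k)))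
      (≤-trans (proj₁ (^-mono 0≤N 0≤N ≤-refl k) · 0≤+ p · <⇒≤ 0<κQ) lower)))

    dense : P ≤ + 2 * + 9 ^ k * b
    dense = *-cancelˡ (^-pos 0<p k) (begin
      P ^ k * P                   ≤⟨ *-mono (0≤P^ k) (0≤+ p) (proj₂ (^-mono (0≤+ p) (0≤+ 9 · 0≤N) P≤9N k)) ≤-refl ⟩
      (+ 9 * N) ^ k * P           ≡⟨ trans (cong (_* P) (^-*-distrib (+ 9) N k)) (*-assoc (+ 9 ^ k) (N ^ k) P) ⟩
      + 9 ^ k * (N ^ k * P)       ≤⟨ *-monoˡ (<⇒≤ (^-pos (+<+ (s≤s z≤n)) k)) N^kP≤2P^kb ⟩
      + 9 ^ k * (+ 2 * P ^ k * b) ≡⟨ eq (+ 9 ^ k) (P ^ k) b ⟩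
      P ^ k * (+ 2 * + 9 ^ k * b) ∎)
      where
      open ℤₚ.≤-Reasoning
      opaque
        unfolding _+_
        eq : ∀ x y b → x * (+ 2 * y * b) ≡ y * (+ 2 * x * b)
        eq = solve-∀
      N^kP≤2P^kb : N ^ k * P ≤ + 2 * P ^ k * b
      N^kP≤2P^kb = *-cancelˡ 0<κQ (≤-slack _ (gap lower ⊹ 0≤P^ k · 𝔼-nonneg (λ t → ∑-nonneg (λ w → square-nonneg (r t w))))
        (eq′ (N ^ k) P κ Q (P ^ k) b (𝔼 E)))
        where
        opaque
          unfolding _+_
          eq′ : ∀ X P κ Q Y b R → κ * Q * (X * P) + ((Y * (+ 2 * κ * Q * b - R) - X * P * (κ * Q)) + Y * R) ≡ κ * Q * (+ 2 * Y * b)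
          eq′ = solve-∀

    0<b : 0ℤ < b
    0<b = *-cancelˡ-< {+ 2 * + 9 ^ k} (0≤+ 2 · <⇒≤ (^-pos (+<+ (s≤s z≤n)) k))
      (<-≤-trans (subst (_< P) (sym (*-zeroʳ (+ 2 * + 9 ^ k))) 0<p) dense)

    -- The terms of `W-bound` contribute 4 and, by `residual-small` and `N ≤ P`, 8 multiples of
    -- `K² P³ b⁴`; dividing by `2 K² P` leaves 6.
    W-small : + K * W ≤ + 6 * P ² * b ^ 4
    W-small = *-cancelˡ (*-pos (*-pos {+ 2} (+<+ (s≤s z≤n)) (*-pos 0<K 0<K)) 0<p) (≤-slack _
      (gap W-bound ⊹ 0≤+ 4 · 0≤b^3 · gap residual-small ⊹ 0≤+ 8 · (0≤b · 0≤b^3) · square-nonneg (+ K) · 0≤+ p · gap (*-mono 0≤N (0≤+ p) N≤P N≤P))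
      (trans (cong (λ κ → + 2 * (+ K * + K) * P * (+ K * W) + ((C * b ^ 4 + + 4 * b ^ 3 * 𝔼 E - + 2 * (+ K * P) * κ * W)
          + + 4 * b ^ 3 * (+ 2 * κ * Q * b - 𝔼 E) + + 8 * (b * b ^ 3) * (+ K) ² * P * (P * P - N * N))) κ≡K²)
        (eq (+ K) P W b (𝔼 E) N)))
      where
      0≤b^3 : 0ℤ ≤ b ^ 3
      0≤b^3 = proj₁ (^-mono 0≤b 0≤b ≤-refl 3)
      opaque
        unfolding _+_
        eq : ∀ K P W b R N → + 2 * (K * K) * P * (K * W) + ((P * (+ 4 * (K * P * (K * P))) * (b * (b * (b * (b * 1ℤ)))) + + 4 * (b * (b * (b * 1ℤ))) * R
              - + 2 * (K * P) * (K * K) * W) + + 4 * (b * (b * (b * 1ℤ))) * (+ 2 * (K * K) * (P * (N * N)) * b - R)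
              + + 8 * (b * (b * (b * (b * 1ℤ)))) * (K * K) * P * (P * P - N * N))
          ≡ + 2 * (K * K) * P * (+ 6 * (P * P) * (b * (b * (b * (b * 1ℤ)))))
        eq = solve-∀

    few-triples : FewTriples ℓ
    few-triples σ σ-ind bσ≤ℓα = *-cancelˡ (*-pos (0<6ℓ^ 3) (^-pos 0<b 3)) (begin
      + 6 * ℓ ^ 3 * b ^ 3 * (ℓ ² * Z)   ≡⟨ eq₁ ℓ (b ^ 3) Z ⟩
      + 6 * ℓ ^ 5 * (b ^ 3 * Z)         ≡⟨ cong (_* (b ^ 3 * Z)) (sym K≡6ℓ⁵) ⟩
      + K * (b ^ 3 * Z)                 ≤⟨ *-monoˡ (0≤+ K) scaled ⟩
      + K * (ℓ ^ 3 * W)                 ≡⟨ eq₂ (+ K) (ℓ ^ 3) W ⟩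
      ℓ ^ 3 * (+ K * W)                 ≤⟨ *-monoˡ (<⇒≤ (^-pos 0<ℓ 3)) W-small ⟩
      ℓ ^ 3 * (+ 6 * P ² * b ^ 4)       ≡⟨ eq₃ (ℓ ^ 3) P b (b ^ 3) ⟩
      + 6 * ℓ ^ 3 * b ^ 3 * (P ² * b)   ∎)
      where
      open ℤₚ.≤-Reasoning
      Z = 𝔼 (triples σ)
      scaled : b ^ 3 * Z ≤ ℓ ^ 3 * W
      scaled = subst₂ _≤_ (𝔼-*ˡ (b ^ 3) _) (trans (𝔼-*ˡ (ℓ ^ 3) _) (cong (ℓ ^ 3 *_) (𝔼-cong (triples-α T T-ind κ (+ K * P) φ))))
        (𝔼-mono (triples-scale ℓ 0≤ℓ (indicator-nonneg f-ind) (indicator-nonneg σ-ind) bσ≤ℓα))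
      opaque
        unfolding _+_
        eq₁ : ∀ l c Z → + 6 * (l * (l * (l * 1ℤ))) * c * (l * l * Z) ≡ + 6 * (l * (l * (l * (l * (l * 1ℤ))))) * (c * Z)
        eq₁ = solve-∀
        eq₂ : ∀ a b c → a * (b * c) ≡ b * (a * c)
        eq₂ = solve-∀
        eq₃ : ∀ l P b c → l * (+ 6 * (P * P) * (b * c)) ≡ + 6 * l * c * (P * P * b)
        eq₃ = solve-∀

-- Pollard's theorem on sums counted with truncated multiplicity.

module Pollard {p : ℕ} (𝔽 : FiniteField.PrimeField p) where

  open import Data.Integer using (_⊓_)
  open import Relation.Nullary.Decidable using (_×-dec_)
  open Arithmetic
  open Sums
  open FieldProperties 𝔽
  open Solver using (solve; _:=_; _:+_; _:-_)

  P : ℤ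
  P = + p

  infixl 7 _∗_
  _∗_ : (Fin p → ℤ) → (Fin p → ℤ) → Fin p → ℤ
  (A ∗ B) z = ∑[ y ] (A y * B (z ⊖ y))

  ∗-comm : ∀ A B z → (A ∗ B) z ≡ (B ∗ A) z
  ∗-comm A B z = trans (∑-reflect _ z)
    (∑-cong (λ y → trans (cong (λ x → A (z ⊖ y) * B x) (x⊖[x⊖y]≡y z y)) (*-comm _ _)))

  ∑-∗ : ∀ A B → ∑ (A ∗ B) ≡ ∑ A * ∑ B
  ∑-∗ A B = trans (∑-comm _) (trans (∑-cong (λ y → trans (∑-*ˡ (A y) _) (cong (A y *_) (sym (∑-unshift B y))))) (∑-*ʳ A (∑ B)))

  module _ {A B : Fin p → ℤ} (A-ind : Indicator A) (B-ind : Indicator B) where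

    ∗-nonneg : ∀ z → 0ℤ ≤ (A ∗ B) z
    ∗-nonneg z = ∑-nonneg (λ y → indicator-nonneg A-ind y · indicator-nonneg B-ind (z ⊖ y))

    ∗-≤ : ∀ z → (A ∗ B) z ≤ ∑ B
    ∗-≤ z = ≤-trans (∑-mono (λ y → ≤-slack _ (gap (indicator-≤1 A-ind y) · indicator-nonneg B-ind (z ⊖ y)) (eq (A y) (B (z ⊖ y)))))
      (≤-reflexive (sym (∑-reflect B z)))
      where
      opaque
        unfolding _+_
        eq : ∀ a b → a * b + (1ℤ - a) * b ≡ b
        eq = solve-∀

  opaque
    unfolding _+_

    1-1*0≡1 : 1ℤ - 1ℤ * 0ℤ ≡ 1ℤ
    1-1*0≡1 = refl

    1-1*1≡0 : 1ℤ - 1ℤ * 1ℤ ≡ 0ℤ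
    1-1*1≡0 = refl

  opaque
    unfolding _+_
    0-0*b≡0 : ∀ b → 0ℤ - 0ℤ * b ≡ 0ℤ
    0-0*b≡0 = solve-∀

  opaque
    unfolding _+_
    0+b-0*b≡b : ∀ b → 0ℤ + b - 0ℤ * b ≡ b
    0+b-0*b≡b = solve-∀

  opaque
    unfolding _+_
    1+b-1*b≡1 : ∀ b → 1ℤ + b - 1ℤ * b ≡ 1ℤ
    1+b-1*b≡1 = solve-∀

  _∩_ _∪_ _∖_ : (Fin p → ℤ) → (Fin p → ℤ) → Fin p → ℤ
  (A ∩ B) x = A x * B x
  (A ∪ B) x = A x + B x - A x * B x
  (A ∖ B) x = A x - A x * B x

  module _ {A B : Fin p → ℤ} (A-ind : Indicator A) (B-ind : Indicator B) where

    difference-indicator : Indicator (A ∖ B)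
    difference-indicator x with A-ind x | B-ind x
    ... | inj₁ a | _ rewrite a = inj₁ (0-0*b≡0 (B x))
    ... | inj₂ a | inj₁ b rewrite a | b = inj₂ 1-1*0≡1
    ... | inj₂ a | inj₂ b rewrite a | b = inj₁ 1-1*1≡0

    union-indicator : Indicator (A ∪ B)
    union-indicator x with A-ind x
    ... | inj₁ a rewrite a | 0+b-0*b≡b (B x) = B-ind x
    ... | inj₂ a rewrite a = inj₂ (1+b-1*b≡1 (B x))

    ∈-difference : ∀ x → (A ∖ B) x ≡ 1ℤ → A x ≡ 1ℤ × B x ≡ 0ℤ
    ∈-difference x member with A-ind x | B-ind x
    ... | inj₁ a | _ rewrite a = contradiction (trans (sym member) (0-0*b≡0 (B x))) (λ ())
    ... | inj₂ a | inj₁ b = a , b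
    ... | inj₂ a | inj₂ b rewrite a | b = contradiction (trans (sym member) 1-1*1≡0) (λ ())

  translate : Fin p → (Fin p → ℤ) → Fin p → ℤ
  translate e B x = B (x ⊖ e)

  ∑-∪ : ∀ A B → ∑ (A ∪ B) ≡ ∑ A + ∑ B - ∑ (A ∩ B)
  ∑-∪ A B = trans (∑-cong (λ x → eq₁ (A x) (B x))) (trans (∑-lin₃ 1ℤ 1ℤ (- 1ℤ) A B _) (eq₂ (∑ A) (∑ B) (∑ (A ∩ B))))
    where
    opaque
      unfolding _+_
      eq₁ : ∀ a b → a + b - a * b ≡ 1ℤ * a + 1ℤ * b + (- 1ℤ) * (a * b)
      eq₁ = solve-∀
      eq₂ : ∀ a b c → 1ℤ * a + 1ℤ * b + (- 1ℤ) * c ≡ a + b - c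
      eq₂ = solve-∀

  ∑-∖ : ∀ A B → ∑ (A ∖ B) ≡ ∑ A - ∑ (A ∩ B)
  ∑-∖ A B = trans (∑-cong (λ x → eq₁ (A x) (B x))) (trans (∑-lin₂ 1ℤ (- 1ℤ) A _) (eq₂ (∑ A) (∑ (A ∩ B))))
    where
    opaque
      unfolding _+_
      eq₁ : ∀ a b → a - a * b ≡ 1ℤ * a + (- 1ℤ) * (a * b)
      eq₁ = solve-∀
      eq₂ : ∀ a c → 1ℤ * a + (- 1ℤ) * c ≡ a - c
      eq₂ = solve-∀

  another-member : ∀ {B} → Indicator B → + 2 ≤ ∑ B → ∀ x → B x ≡ 1ℤ → ∃ λ y → B y ≡ 1ℤ × y ≢ x
  another-member {B} B-ind 2≤∑B x Bx = other (∃-indicator (difference-indicator B-ind (δ-indicator x)) 1≤∑B∖x)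
    where
    ∑B∩x : ∑ (B ∩ δ x) ≡ 1ℤ
    ∑B∩x = trans (∑-cong (λ y → *-comm (B y) (δ x y))) (trans (∑-δ x B) Bx)
    1≤∑B∖x : 1ℤ ≤ ∑ (B ∖ δ x)
    1≤∑B∖x = ≤-slack (∑ B - + 2) (gap 2≤∑B) (trans (eq (∑ B)) (sym (trans (∑-∖ B (δ x)) (cong (_-_ (∑ B)) ∑B∩x))))
      where
      opaque
        unfolding _+_
        eq : ∀ b → 1ℤ + (b - + 2) ≡ b - 1ℤ
        eq = solve-∀
    other : ∃ (λ y → (B ∖ δ x) y ≡ 1ℤ) → ∃ λ y → B y ≡ 1ℤ × y ≢ x
    other (y , member) with ∈-difference B-ind (δ-indicator x) y member
    ... | By , δ≡0 = y , By , λ y≡x → contradiction (trans (sym δ≡0) (δ-refl (sym y≡x))) (λ ())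

  -- Split both sets along their intersection `I`, with remainders `A′` and `C′`. As `∗` is
  -- commutative, both sides become `I ∗ I + A′ ∗ I + I ∗ C′ + A′ ∗ C′`.
  ∗-decompose : ∀ A C z → (A ∗ C) z ≡ ((A ∪ C) ∗ (A ∩ C)) z + ((A ∖ C) ∗ (C ∖ A)) z
  ∗-decompose A C z = sym (begin
      ((A ∪ C) ∗ (A ∩ C)) z + ((A ∖ C) ∗ (C ∖ A)) z
        ≡⟨ sym (∑-+ _ _) ⟩
      ∑[ y ] ((A ∪ C) y * (A ∩ C) (z ⊖ y) + (A ∖ C) y * (C ∖ A) (z ⊖ y))
        ≡⟨ ∑-cong (λ y → eq₁ (A y) (C y) (A (z ⊖ y)) (C (z ⊖ y))) ⟩
      ∑[ y ] (1ℤ * (A y * C (z ⊖ y)) + 1ℤ * (C y * (A ∩ C) (z ⊖ y)) + (- 1ℤ) * ((A ∩ C) y * C (z ⊖ y)))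
        ≡⟨ ∑-lin₃ 1ℤ 1ℤ (- 1ℤ) _ _ _ ⟩
      1ℤ * (A ∗ C) z + 1ℤ * (C ∗ (A ∩ C)) z + (- 1ℤ) * ((A ∩ C) ∗ C) z
        ≡⟨ cong (λ s → 1ℤ * (A ∗ C) z + 1ℤ * (C ∗ (A ∩ C)) z + (- 1ℤ) * s) (∗-comm (A ∩ C) C z) ⟩
      1ℤ * (A ∗ C) z + 1ℤ * (C ∗ (A ∩ C)) z + (- 1ℤ) * (C ∗ (A ∩ C)) z
        ≡⟨ eq₂ ((A ∗ C) z) ((C ∗ (A ∩ C)) z) ⟩
      (A ∗ C) z ∎)
    where
    open ≡-Reasoning
    opaque
      unfolding _+_
      eq₁ : ∀ a c a′ c′ → (a + c - a * c) * (a′ * c′) + (a - a * c) * (c′ - c′ * a′)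
        ≡ 1ℤ * (a * c′) + 1ℤ * (c * (a′ * c′)) + (- 1ℤ) * (a * c * c′)
      eq₁ = solve-∀
      eq₂ : ∀ x y → 1ℤ * x + 1ℤ * y + (- 1ℤ) * y ≡ x
      eq₂ = solve-∀

  truncated : ℤ → (Fin p → ℤ) → (Fin p → ℤ) → ℤ
  truncated t A B = ∑[ z ] (t ⊓ (A ∗ B) z)

  truncated-translate : ∀ t A B e → truncated t A (translate e B) ≡ truncated t A B
  truncated-translate t A B e = trans
    (∑-cong (λ z → cong (t ⊓_) (∑-cong (λ y → cong (λ x → A y * B x) (place z y e)))))
    (sym (∑-unshift (λ z → t ⊓ (A ∗ B) z) e))
    where
    place : ∀ z y e → z ⊖ y ⊖ e ≡ z ⊖ e ⊖ y
    place = solve 3 (λ z y e → z :- y :- e := z :- e :- y) refl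

  module _ {A B : Fin p → ℤ} (A-ind : Indicator A) (B-ind : Indicator B) {t : ℤ} (1≤t : 1ℤ ≤ t) (t≤∑A : t ≤ ∑ A) where

    private
      0≤t : 0ℤ ≤ t
      0≤t = 1≤⇒0≤ 1≤t

    -- Here `∑ B` equals `t`, so the truncation is void and the sum is `∑ A * ∑ B`.
    ∑B≤t⇒pollard : ∑ B ≤ t → t ≤ ∑ B → ∀ {X} → X ≤ ∑ A + ∑ B - t → t * X ≤ truncated t A B
    ∑B≤t⇒pollard ∑B≤t t≤∑B {X} X≤ = ≤-trans (≤-slack _ (0≤t · gap X≤ ⊹ gap t≤∑B · gap t≤∑A) (eq (∑ A) (∑ B) t X))
      (≤-reflexive (trans (sym (∑-∗ A B)) (∑-cong (λ z → sym (ℤₚ.i≥j⇒i⊓j≡j (≤-trans (∗-≤ A-ind B-ind z) ∑B≤t))))))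
      where
      opaque
        unfolding _+_
        eq : ∀ a b t x → t * x + (t * (a + b - t - x) + (b - t) * (a - t)) ≡ a * b
        eq = solve-∀

    everything⇒pollard : (∀ x → A x ≡ 1ℤ) → t ≤ ∑ B → ∀ {X} → X ≤ P → t * X ≤ truncated t A B
    everything⇒pollard A≡1 t≤∑B X≤P = ≤-trans (*-monoˡ 0≤t X≤P) (≤-reflexive (trans (*-comm t P) (trans (sym (∑-const p t))
      (∑-cong (λ z → sym (ℤₚ.i≤j⇒i⊓j≡i (subst (t ≤_) (full z) t≤∑B)))))))
      where
      full : ∀ z → ∑ B ≡ (A ∗ B) z
      full z = trans (∑-reflect B z) (∑-cong (λ y → sym (trans (cong (_* B (z ⊖ y)) (A≡1 y)) (*-identityˡ _))))

    -- Translating B so that its point `b₀` lands on `y` in A puts the whole translate into A,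
    -- including `y ⊕ (b₁ ⊖ b₀)`. So A is closed under a nonzero shift.
    no-partial-overlap⇒everything : 1ℤ + t ≤ ∑ B →
      (∀ e → 1ℤ ≤ ∑ (A ∩ translate e B) → ∑ B ≤ ∑ (A ∩ translate e B)) → ∀ x → A x ≡ 1ℤ
    no-partial-overlap⇒everything 1+t≤∑B absorb x = from-members (∃-indicator A-ind (≤-trans 1≤t t≤∑A))
        (∃-indicator B-ind (≤-trans (≤-slack t 0≤t refl) 1+t≤∑B))
      where
      2≤∑B : + 2 ≤ ∑ B
      2≤∑B = ≤-trans (≤-slack (t - 1ℤ) (gap 1≤t) (eq t)) 1+t≤∑B
        where
        opaque
          unfolding _+_
          eq : ∀ t → + 2 + (t - 1ℤ) ≡ 1ℤ + t
          eq = solve-∀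
      step : ∀ {b₀ b₁} → B b₀ ≡ 1ℤ → B b₁ ≡ 1ℤ → ∀ y → A y ≡ 1ℤ → A (y ⊕ (b₁ ⊖ b₀)) ≡ 1ℤ
      step {b₀} {b₁} Bb₀ Bb₁ y Ay with A-ind (y ⊕ (b₁ ⊖ b₀))
      ... | inj₂ member = member
      ... | inj₁ missing = contradiction (≤-trans 1≤loss (subst (_≤ 0ℤ) (sym ∑loss) loss≤0)) (λ { (+≤+ ()) })
        where
        C = translate (y ⊖ b₀) B
        C-ind : Indicator C
        C-ind x = B-ind (x ⊖ (y ⊖ b₀))
        ∑C : ∑ B ≡ ∑ C
        ∑C = ∑-unshift B (y ⊖ b₀)
        meets : 1ℤ ≤ ∑ (A ∩ C)
        meets = subst (_≤ ∑ (A ∩ C)) (trans (cong₂ _*_ Ay (trans (cong B (x⊖[x⊖y]≡y y b₀)) Bb₀)) (*-identityˡ 1ℤ))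
          (term≤∑ (λ x → indicator-nonneg A-ind x · indicator-nonneg C-ind x) y)
        ∑loss : ∑ (C ∖ A) ≡ ∑ B - ∑ (A ∩ C)
        ∑loss = trans (∑-∖ C A) (cong₂ _-_ (sym ∑C) (∑-cong (λ x → *-comm (C x) (A x))))
        loss≤0 : ∑ B - ∑ (A ∩ C) ≤ 0ℤ
        loss≤0 = ≤-slack _ (gap (absorb (y ⊖ b₀) meets)) (eq (∑ B) (∑ (A ∩ C)))
          where
          opaque
            unfolding _+_
            eq : ∀ a b → a - b + (b - a) ≡ 0ℤ
            eq = solve-∀
        1≤loss : 1ℤ ≤ ∑ (C ∖ A)
        1≤loss = subst (_≤ ∑ (C ∖ A)) (trans (cong₂ (λ c a → c - c * a) (trans (cong B (place y b₀ b₁)) Bb₁) missing) 1-1*0≡1)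
          (term≤∑ (indicator-nonneg (difference-indicator C-ind A-ind)) (y ⊕ (b₁ ⊖ b₀)))
          where
          place : ∀ y b₀ b₁ → y ⊕ (b₁ ⊖ b₀) ⊖ (y ⊖ b₀) ≡ b₁
          place = solve 3 (λ y b₀ b₁ → y :+ (b₁ :- b₀) :- (y :- b₀) := b₁) refl
      from-members : (∃ λ a → A a ≡ 1ℤ) → (∃ λ b₀ → B b₀ ≡ 1ℤ) → A x ≡ 1ℤ
      from-members (a , Aa) (b₀ , Bb₀) with another-member B-ind 2≤∑B b₀ Bb₀
      ... | b₁ , Bb₁ , b₁≢b₀ =
        shift-closed⇒everything (λ y → A y ≡ 1ℤ) (b₁≢b₀ ∘ x⊖y≡O⇒x≡y b₁ b₀) (step Bb₀ Bb₁) a x Aa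

  -- The first convolution of `∗-decompose` never exceeds `∑ (A ∩ C)`; it passes the truncation
  -- whole and leaves at least `t - ∑ (A ∩ C)` for the second.
  truncated-split : ∀ {A C} → Indicator A → Indicator C → ∀ t →
    ∑ (A ∪ C) * ∑ (A ∩ C) + truncated (t - ∑ (A ∩ C)) (A ∖ C) (C ∖ A) ≤ truncated t A C
  truncated-split {A} {C} A-ind C-ind t = subst (_≤ truncated t A C)
    (trans (∑-+ _ _) (cong (_+ truncated (t - s) (A ∖ C) (C ∖ A)) (∑-∗ (A ∪ C) (A ∩ C)))) (∑-mono pointwise)
    where
    s = ∑ (A ∩ C)
    pointwise : ∀ z → ((A ∪ C) ∗ (A ∩ C)) z + ((t - s) ⊓ ((A ∖ C) ∗ (C ∖ A)) z) ≤ t ⊓ (A ∗ C) z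
    pointwise z = ℤₚ.⊓-glb
      (≤-trans (+-mono-≤ (∗-≤ (union-indicator A-ind C-ind) (product-indicator A-ind C-ind) z) (ℤₚ.i⊓j≤i (t - s) _)) (≤-reflexive (eq s t)))
      (≤-trans (+-mono-≤ ≤-refl (ℤₚ.i⊓j≤j (t - s) _)) (≤-reflexive (sym (∗-decompose A C z))))
      where
      opaque
        unfolding _+_
        eq : ∀ s t → s + (t - s) ≡ t
        eq = solve-∀

  truncated-∪∩ : ∀ {A C} → Indicator A → Indicator C → ∀ t → truncated t (A ∪ C) (A ∩ C) ≤ truncated t A C
  truncated-∪∩ {A} {C} A-ind C-ind t = ∑-mono (λ z → ℤₚ.⊓-monoʳ-≤ t
    (≤-trans (≤-slack _ (∗-nonneg (difference-indicator A-ind C-ind) (difference-indicator C-ind A-ind) z) refl)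
      (≤-reflexive (sym (∗-decompose A C z)))))

  -- `X` stands for the smaller of `P` and `∑ A + ∑ B - t`, and `n` bounds the second set for the
  -- induction. If a translate C of B meets A in some but not all of its points, the pair is
  -- replaced by union and intersection when the overlap has at least `t` points, and otherwise by
  -- the two differences with `t` lowered by the overlap. Both moves shrink the second set. If no
  -- such translate exists, A is the whole field.
  pollard : ∀ n {t A B} → Indicator A → Indicator B → 1ℤ ≤ t → t ≤ ∑ A → t ≤ ∑ B → ∑ B ≤ + n →
    ∀ {X} → X ≤ P → X ≤ ∑ A + ∑ B - t → t * X ≤ truncated t A B
  pollard zero A-ind B-ind 1≤t t≤∑A t≤∑B ∑B≤n = contradiction (≤-trans 1≤t (≤-trans t≤∑B ∑B≤n)) (λ { (+≤+ ()) })
  pollard (suc n) {t} {A} {B} A-ind B-ind 1≤t t≤∑A t≤∑B ∑B≤n {X} X≤P X≤ with ∑ B ≤? t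
  ... | yes ∑B≤t = ∑B≤t⇒pollard A-ind B-ind 1≤t t≤∑A ∑B≤t t≤∑B X≤
  ... | no ∑B≰t with Fin.any? (λ e → (1ℤ ≤? ∑ (A ∩ translate e B)) ×-dec (1ℤ + ∑ (A ∩ translate e B) ≤? ∑ B))
  ...   | no none = everything⇒pollard A-ind B-ind 1≤t t≤∑A
          (no-partial-overlap⇒everything A-ind B-ind 1≤t t≤∑A (≰⇒1+≤ ∑B≰t) absorb) t≤∑B X≤P
    where
    absorb : ∀ e → 1ℤ ≤ ∑ (A ∩ translate e B) → ∑ B ≤ ∑ (A ∩ translate e B)
    absorb e 1≤s with ∑ B ≤? ∑ (A ∩ translate e B)
    ... | yes le = le
    ... | no nle = contradiction (e , 1≤s , ≰⇒1+≤ nle) none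
  ...   | yes (e , 1≤s , s<∑B) = subst (t * X ≤_) (truncated-translate t A B e) (by-size (t ≤? s))
    where
    C = translate e B
    C-ind : Indicator C
    C-ind x = B-ind (x ⊖ e)
    s = ∑ (A ∩ C)
    ∑C : ∑ B ≡ ∑ C
    ∑C = ∑-unshift B e
    ∑∪ : ∑ (A ∪ C) ≡ ∑ A + ∑ B - s
    ∑∪ = trans (∑-∪ A C) (cong (λ c → ∑ A + c - s) (sym ∑C))
    ∑A∖C : ∑ (A ∖ C) ≡ ∑ A - s
    ∑A∖C = ∑-∖ A C
    ∑C∖A : ∑ (C ∖ A) ≡ ∑ B - s
    ∑C∖A = trans (∑-∖ C A) (cong₂ _-_ (sym ∑C) (∑-cong (λ x → *-comm (C x) (A x))))
    ∪-ind = union-indicator A-ind C-ind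
    ∩-ind = product-indicator A-ind C-ind
    +n : + suc n ≡ 1ℤ + + n
    +n = pos-+ 1 n
    s≤n : s ≤ + n
    s≤n = gap⁻¹ (subst (0ℤ ≤_) (trans (cong (λ m → m - ∑ B + (∑ B - (1ℤ + s))) +n) (eq (+ n) (∑ B) s)) (gap ∑B≤n ⊹ gap s<∑B))
      where
      opaque
        unfolding _+_
        eq : ∀ n b s → 1ℤ + n - b + (b - (1ℤ + s)) ≡ n - s
        eq = solve-∀
    ∑∪≤P : ∑ A + ∑ B - s ≤ P
    ∑∪≤P = subst (_≤ P) ∑∪ (∑-indicator-≤ ∪-ind)
    by-size : Dec (t ≤ s) → t * X ≤ truncated t A C
    by-size (yes t≤s) = ≤-trans
      (pollard n ∪-ind ∩-ind 1≤t
        (subst (t ≤_) (sym ∑∪) (≤-trans t≤∑A (≤-slack _ (gap (<⇒≤ (1+≤⇒< s<∑B))) (eq₁ (∑ A) (∑ B) s)))) t≤s s≤n X≤P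
        (≤-trans X≤ (≤-reflexive (trans (eq₂ (∑ A) (∑ B) s t) (cong (λ u → u + s - t) (sym ∑∪))))))
      (truncated-∪∩ A-ind C-ind t)
      where
      opaque
        unfolding _+_
        eq₁ : ∀ a b s → a + (b - s) ≡ a + b - s
        eq₁ = solve-∀
        eq₂ : ∀ a b s t → a + b - t ≡ a + b - s + s - t
        eq₂ = solve-∀
    -- With `u = ∑ A + ∑ B - s`, the induction hypothesis and the split add up exactly:
    -- `(t - s)(u - t) + u s = t (∑ A + ∑ B - t)`.
    by-size (no t≰s) = ≤-trans (≤-slack _
        (gap (pollard n (difference-indicator A-ind C-ind) (difference-indicator C-ind A-ind)
          1≤t-s (below ∑A∖C t≤∑A) (below ∑C∖A t≤∑B) ∑C∖A≤n {∑ A + ∑ B - s - t} smaller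
          (≤-reflexive (trans (eq₁ (∑ A) (∑ B) s t) (cong₂ (λ u v → u + v - (t - s)) (sym ∑A∖C) (sym ∑C∖A)))))
          ⊹ 1≤⇒0≤ 1≤t · gap X≤)
        (eq₂ (∑ A) (∑ B) s t X (truncated (t - s) (A ∖ C) (C ∖ A))))
      (≤-trans (≤-reflexive (cong (λ u → u * s + truncated (t - s) (A ∖ C) (C ∖ A)) (sym ∑∪))) (truncated-split A-ind C-ind t))
      where
      1≤t-s : 1ℤ ≤ t - s
      1≤t-s = ≤-slack _ (gap (≰⇒1+≤ t≰s)) (eq t s)
        where
        opaque
          unfolding _+_
          eq : ∀ t s → 1ℤ + (t - (1ℤ + s)) ≡ t - s
          eq = solve-∀
      below : ∀ {u v} → u ≡ v - s → t ≤ v → t - s ≤ u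
      below {u} {v} u≡v-s t≤v = subst (t - s ≤_) (sym u≡v-s) (+-mono-≤ t≤v ≤-refl)
      ∑C∖A≤n : ∑ (C ∖ A) ≤ + n
      ∑C∖A≤n = subst (_≤ + n) (sym ∑C∖A) (gap⁻¹ (subst (0ℤ ≤_) (trans (cong (λ m → m - ∑ B + (s - 1ℤ)) +n) (eq (+ n) (∑ B) s))
          (gap ∑B≤n ⊹ gap 1≤s)))
        where
        opaque
          unfolding _+_
          eq : ∀ n b s → 1ℤ + n - b + (s - 1ℤ) ≡ n - (b - s)
          eq = solve-∀
      smaller : ∑ A + ∑ B - s - t ≤ P
      smaller = ≤-trans (≤-slack t (1≤⇒0≤ 1≤t) (eq (∑ A + ∑ B - s) t)) ∑∪≤P
        where
        opaque
          unfolding _+_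
          eq : ∀ u t → u - t + t ≡ u
          eq = solve-∀
      opaque
        unfolding _+_
        eq₁ : ∀ a b s t → a + b - s - t ≡ a - s + (b - s) - (t - s)
        eq₁ = solve-∀
        eq₂ : ∀ a b s t x r → t * x + (r - (t - s) * (a + b - s - t) + t * (a + b - t - x)) ≡ (a + b - s) * s + r
        eq₂ = solve-∀

-- A set with few triples has density at most about 1/3.

module AlmostSumFree {p : ℕ} (𝔽 : FiniteField.PrimeField p) (σ : Fin p → ℤ) (σ-ind : Sums.Indicator σ) where

  open import Data.Integer using (_⊓_)
  import Data.Nat as ℕ
  import Data.Nat.DivMod as ℕ
  open Arithmetic
  open Sums
  open FieldProperties 𝔽
  open Solver using (solve; _:=_; _:+_; _:-_)
  open Pollard 𝔽
  open Triples 𝔽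

  s : ℤ
  s = ∑ σ

  0≤σ : ∀ x → 0ℤ ≤ σ x
  0≤σ = indicator-nonneg σ-ind

  triples-∗ : ∀ d → triples σ d ≡ ∑[ z ] (σ (z ⊕ d) * (σ ∗ σ) z)
  triples-∗ d = trans (∑-cong (λ v → trans (∑-unshift _ v) (∑-cong (λ z → pointwise v z))))
      (trans (∑-comm _) (∑-cong (λ z → ∑-*ˡ (σ (z ⊕ d)) _)))
    where
    place : ∀ v z d → v ⊕ (z ⊖ v) ⊕ d ≡ z ⊕ d
    place = solve 3 (λ v z d → v :+ (z :- v) :+ d := z :+ d) refl
    pointwise : ∀ v z → σ v * (σ (z ⊖ v) * σ (v ⊕ (z ⊖ v) ⊕ d)) ≡ σ (z ⊕ d) * (σ v * σ (z ⊖ v))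
    pointwise v z = trans (cong (λ x → σ v * (σ (z ⊖ v) * σ x)) (place v z d)) (eq (σ v) (σ (z ⊖ v)) (σ (z ⊕ d)))
      where
      opaque
        unfolding _+_
        eq : ∀ a b c → a * (b * c) ≡ c * (a * b)
        eq = solve-∀

  -- Where `z ⊕ d` lies outside the set the truncated value is at most `t`; elsewhere the whole
  -- convolution counts triples.
  truncated-≤ : ∀ {t} → 0ℤ ≤ t → ∀ d → truncated t σ σ ≤ t * (P - s) + triples σ d
  truncated-≤ {t} 0≤t d = ≤-trans (∑-mono pointwise) (≤-reflexive total)
    where
    pointwise : ∀ z → t ⊓ (σ ∗ σ) z ≤ t * (1ℤ - σ (z ⊕ d)) + σ (z ⊕ d) * (σ ∗ σ) z
    pointwise z with σ-ind (z ⊕ d)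
    ... | inj₁ e rewrite e = ≤-trans (ℤₚ.i⊓j≤i t _) (≤-reflexive (eq t _))
      where
      opaque
        unfolding _+_
        eq : ∀ t c → t ≡ t * (1ℤ - 0ℤ) + 0ℤ * c
        eq = solve-∀
    ... | inj₂ e rewrite e = ≤-trans (ℤₚ.i⊓j≤j t _) (≤-reflexive (eq t _))
      where
      opaque
        unfolding _+_
        eq : ∀ t c → c ≡ t * (1ℤ - 1ℤ) + 1ℤ * c
        eq = solve-∀
    total : ∑[ z ] (t * (1ℤ - σ (z ⊕ d)) + σ (z ⊕ d) * (σ ∗ σ) z) ≡ t * (P - s) + triples σ d
    total = trans (∑-+ _ _) (cong₂ _+_ (trans (∑-*ˡ t _) (cong (t *_) complement)) (sym (triples-∗ d)))
      where
      opaque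
        unfolding _+_
        eq₁ : ∀ x → 1ℤ - x ≡ 1ℤ * 1ℤ + (- 1ℤ) * x
        eq₁ = solve-∀
        eq₂ : ∀ p s → 1ℤ * (p * 1ℤ) + (- 1ℤ) * s ≡ p - s
        eq₂ = solve-∀
      complement : ∑[ z ] (1ℤ - σ (z ⊕ d)) ≡ P - s
      complement = trans (∑-cong (λ z → eq₁ (σ (z ⊕ d)))) (trans (∑-lin₂ 1ℤ (- 1ℤ) _ _)
        (trans (cong₂ (λ u v → 1ℤ * u + (- 1ℤ) * v) (∑-const p 1ℤ) (sym (∑-shift σ d))) (eq₂ P s)))

  -- `truncated-≤` is played against Pollard's lower bound. If `s + s - t ≤ P`, this gives the claim
  -- even without the factor 2. Otherwise it gives only `t * s ≤ triples σ d`, and the 2 comes from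
  -- `3 s - P - t ≤ 2 s`.
  many-triples : ∀ {t} → 1ℤ ≤ t → t ≤ s → ∀ d → t * (+ 3 * s - P - t) ≤ + 2 * triples σ d
  many-triples {t} 1≤t t≤s d with (s + s - t) ≤? P
  ... | yes small = ≤-slack _ (gap (apply small ≤-refl) ⊹ gap (truncated-≤ 0≤t d) ⊹ triples-nonneg 0≤σ d)
        (eq t s P (truncated t σ σ) (triples σ d))
    where
    0≤t = 1≤⇒0≤ 1≤t
    apply : ∀ {X} → X ≤ P → X ≤ s + s - t → t * X ≤ truncated t σ σ
    apply = pollard p σ-ind σ-ind 1≤t t≤s t≤s (∑-indicator-≤ σ-ind)
    opaque
      unfolding _+_
      eq : ∀ t s P τ Z → t * (+ 3 * s - P - t) + ((τ - t * (s + s - t)) + (t * (P - s) + Z - τ) + Z) ≡ + 2 * Z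
      eq = solve-∀
  ... | no large = ≤-slack _ (0≤+ 2 · gap (apply ≤-refl (<⇒≤ (≰⇒> large))) ⊹ 0≤+ 2 · gap (truncated-≤ 0≤t d)
        ⊹ 0≤t · gap (∑-indicator-≤ σ-ind) ⊹ 0≤t · 0≤t)
        (eq t s P (truncated t σ σ) (triples σ d))
    where
    0≤t = 1≤⇒0≤ 1≤t
    apply : ∀ {X} → X ≤ P → X ≤ s + s - t → t * X ≤ truncated t σ σ
    apply = pollard p σ-ind σ-ind 1≤t t≤s t≤s (∑-indicator-≤ σ-ind)
    opaque
      unfolding _+_
      eq : ∀ t s P τ Z → t * (+ 3 * s - P - t) + (+ 2 * (τ - t * P) + + 2 * (t * (P - s) + Z - τ) + t * (P - s) + t * t) ≡ + 2 * Z
      eq = solve-∀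

  -- The floor of `p / L` is at least 1 because `L ≤ p`, so rounding down loses no more than a
  -- factor 2.
  approximate-quotient : ∀ L .{{_ : ℕ.NonZero L}} → L ℕ.≤ p → ∃ λ t → 1ℤ ≤ t × + L * t ≤ P × P ≤ + 2 * + L * t
  approximate-quotient L L≤p = + q , +≤+ (ℕ.m≥n⇒m/n>0 L≤p) , subst (_≤ P) (trans (cong +_ (ℕ.*-comm q L)) (pos-* L q)) (+≤+ (ℕ.m/n*n≤m p L)) ,
      ≤-slack _ (gap (+≤+ (ℕ.<⇒≤ (ℕ.m%n<n p L))) ⊹ 0≤+ L · gap (+≤+ {1} (ℕ.m≥n⇒m/n>0 L≤p)))
        (trans (cong (_+ (+ L - + r + + L * (+ q - 1ℤ))) decomposition) (eq (+ L) (+ q) (+ r)))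
    where
    q = p ℕ./ L
    r = p ℕ.% L
    decomposition : P ≡ + r + + q * + L
    decomposition = trans (cong +_ (ℕ.m≡m%n+[m/n]*n p L)) (trans (pos-+ r _) (cong (_+_ (+ r)) (pos-* q L)))
    opaque
      unfolding _+_
      eq : ∀ L q r → r + q * L + (L - r + L * (q - 1ℤ)) ≡ + 2 * L * q
      eq = solve-∀

  -- Take `t` close to `P / L`. Averaging `many-triples` over `T` gives
  -- `L² t (3 s - P - t) ≤ 2 P² ≤ 8 L² t²`, so `3 s ≤ P + 9 t`, and `L t ≤ P` finishes. If `s < t`,
  -- then `s` is below `P / L` already.
  size-≤ : ∀ (T : Fin p → ℤ) (T-ind : Indicator T) L .{{_ : ℕ.NonZero L}} → L ℕ.≤ p → let open Averaging T T-ind in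
    0ℤ < b → (+ L) ² * 𝔼 (triples σ) ≤ P ² * b → + 3 * + L * s ≤ (+ L + + 9) * P
  size-≤ T T-ind L L≤p 0<b few with approximate-quotient L L≤p
  ... | t , 1≤t , Lt≤P , P≤2Lt = by-size (t ≤? s)
    where
    open Averaging T T-ind
    ℓ = + L
    0≤t : 0ℤ ≤ t
    0≤t = 1≤⇒0≤ 1≤t
    0<ℓ : 0ℤ < ℓ
    0<ℓ = +<+ (ℕ.>-nonZero⁻¹ L)
    Z = 𝔼 (triples σ)
    by-size : Dec (t ≤ s) → + 3 * ℓ * s ≤ (ℓ + + 9) * P
    by-size (no t≰s) = ≤-slack _ (0≤+ 3 · 0≤+ L · gap (<⇒≤ (≰⇒> t≰s)) ⊹ 0≤+ 3 · gap Lt≤P ⊹ (0≤+ L ⊹ 0≤+ 6) · 0≤+ p) (eq ℓ s t P)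
      where
      opaque
        unfolding _+_
        eq : ∀ l s t P → + 3 * l * s + (+ 3 * l * (t - s) + + 3 * (P - l * t) + (l + + 6) * P) ≡ (l + + 9) * P
        eq = solve-∀
    by-size (yes t≤s) = ≤-slack _ (0≤+ L · gap slack₂ ⊹ 0≤+ 9 · gap Lt≤P) (eq ℓ s t P)
      where
      opaque
        unfolding _+_
        eq : ∀ l s t P → + 3 * l * s + (l * (+ 8 * t - (+ 3 * s - P - t)) + + 9 * (P - l * t)) ≡ (l + + 9) * P
        eq = solve-∀
      averaged : b * (t * (+ 3 * s - P - t)) ≤ + 2 * Z
      averaged = subst₂ _≤_ (trans (𝔼-const _) (*-comm _ b)) (𝔼-*ˡ (+ 2) _) (𝔼-mono (many-triples 1≤t t≤s))
      slack₁ : ℓ ² * (t * (+ 3 * s - P - t)) ≤ + 2 * P ²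
      slack₁ = *-cancelˡ 0<b (≤-slack _ (square-nonneg ℓ · gap averaged ⊹ 0≤+ 2 · gap few) (eq′ b ℓ (t * (+ 3 * s - P - t)) P Z))
        where
        opaque
          unfolding _+_
          eq′ : ∀ b l x P Z → b * (l * l * x) + (l * l * (+ 2 * Z - b * x) + + 2 * (P * P * b - l * l * Z)) ≡ b * (+ 2 * (P * P))
          eq′ = solve-∀
      slack₂ : + 3 * s - P - t ≤ + 8 * t
      slack₂ = *-cancelˡ (*-pos (*-pos 0<ℓ 0<ℓ) (1≤⇒0< 1≤t)) (≤-slack _
        (gap slack₁ ⊹ 0≤+ 2 · gap (*-mono (0≤+ p) (0≤+ 2 · 0≤+ L · 0≤t) P≤2Lt P≤2Lt)) (eq′ ℓ t (+ 3 * s - P - t) P))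
        where
        opaque
          unfolding _+_
          eq′ : ∀ l t x P → l * l * t * x + ((+ 2 * (P * P) - l * l * (t * x)) + + 2 * (+ 2 * l * t * (+ 2 * l * t) - P * P)) ≡ l * l * t * (+ 8 * t)
          eq′ = solve-∀

-- Conics given by equal differences of inverses.

module Hyperbolas {p : ℕ} (𝔽 : FiniteField.PrimeField p) where

  open Arithmetic
  open Sums
  open FieldProperties 𝔽
  open Solver using (solve; _:=_; _:*_; _:-_; con)

  P : ℤ
  P = + p

  g : Fin p → Fin p → Fin p
  g t x = inv x ⊖ inv (x ⊖ t)

  coincide : Fin p → Fin p → Fin p → Fin p → ℤ
  coincide t t′ x x′ = δ (g t x) (g t′ x′)

  δ≡1⇒≡ : ∀ {x y : Fin p} → δ x y ≡ 1ℤ → x ≡ y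
  δ≡1⇒≡ {x} {y} δ≡1 with x Fin.≟ y
  ... | yes x≡y = x≡y
  ... | no x≢y = contradiction (trans (sym (δ-≢ x≢y)) δ≡1) (λ ())

  δ-sym : ∀ (x y : Fin p) → δ x y ≡ δ y x
  δ-sym x y with x Fin.≟ y
  ... | yes refl = refl
  ... | no x≢y = trans (δ-≢ x≢y) (sym (δ-≢ (x≢y ∘ sym)))

  inv-injective : ∀ {x y} → inv x ≡ inv y → x ≡ y
  inv-injective {x} {y} eq = trans (sym (inv-involutive x)) (trans (cong inv eq) (inv-involutive y))

  ⊖-cancelˡ : ∀ {a x y} → a ⊖ x ≡ a ⊖ y → x ≡ y
  ⊖-cancelˡ {a} {x} {y} eq = trans (sym (x⊖[x⊖y]≡y a x)) (trans (cong (a ⊖_) eq) (x⊖[x⊖y]≡y a y))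

  ⊖-cancelʳ : ∀ {a x y} → x ⊖ a ≡ y ⊖ a → x ≡ y
  ⊖-cancelʳ {a} {x} {y} eq = trans (sym (x⊖y⊕y≡x x a)) (trans (cong (_⊕ a) eq) (x⊖y⊕y≡x y a))

  module Conic {t t′ x x′ : Fin p} (x≢O : x ≢ O) (x≢t : x ≢ t) (x′≢O : x′ ≢ O) (x′≢t′ : x′ ≢ t′) where

    -- Away from the poles `g t x` equals `-t / (x (x - t))`, so cross-multiplication removes all
    -- inverses.
    conic : g t x ≡ g t′ x′ → t ⊗ (x′ ⊗ (x′ ⊖ t′)) ≡ t′ ⊗ (x ⊗ (x ⊖ t))
    conic eq = begin
      t ⊗ (x′ ⊗ (x′ ⊖ t′))                                        ≡⟨ cleared x≢O x≢t (x′ ⊗ (x′ ⊖ t′)) ⟩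
      O ⊖ (x ⊗ (x ⊖ t)) ⊗ (x′ ⊗ (x′ ⊖ t′)) ⊗ g t x                ≡⟨ cong (λ y → O ⊖ (x ⊗ (x ⊖ t)) ⊗ (x′ ⊗ (x′ ⊖ t′)) ⊗ y) eq ⟩
      O ⊖ (x ⊗ (x ⊖ t)) ⊗ (x′ ⊗ (x′ ⊖ t′)) ⊗ g t′ x′              ≡⟨ cong (λ y → O ⊖ y ⊗ g t′ x′) (⊗-comm _ _) ⟩
      O ⊖ (x′ ⊗ (x′ ⊖ t′)) ⊗ (x ⊗ (x ⊖ t)) ⊗ g t′ x′              ≡⟨ cleared x′≢O x′≢t′ (x ⊗ (x ⊖ t)) ⟨
      t′ ⊗ (x ⊗ (x ⊖ t))                                          ∎
      where
      open ≡-Reasoning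
      cleared : ∀ {t x} → x ≢ O → x ≢ t → ∀ y → t ⊗ y ≡ O ⊖ (x ⊗ (x ⊖ t)) ⊗ y ⊗ g t x
      cleared {t} {x} x≢O x≢t y = begin
        t ⊗ y
          ≡⟨ solve 3 (λ t x y → t :* y := con 0ℤ :- (con 1ℤ :* (x :- t) :* y :- x :* (con 1ℤ :* y))) refl t x y ⟩
        O ⊖ (I ⊗ (x ⊖ t) ⊗ y ⊖ x ⊗ (I ⊗ y))
          ≡⟨ cong₂ (λ u v → O ⊖ (u ⊗ (x ⊖ t) ⊗ y ⊖ x ⊗ (v ⊗ y))) (sym (⊗-inv x x≢O)) (sym (⊗-inv (x ⊖ t) (x≢t ∘ x⊖y≡O⇒x≡y x t))) ⟩
        O ⊖ (x ⊗ inv x ⊗ (x ⊖ t) ⊗ y ⊖ x ⊗ ((x ⊖ t) ⊗ inv (x ⊖ t) ⊗ y))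
          ≡⟨ solve 5 (λ x d y i j → con 0ℤ :- (x :* i :* d :* y :- x :* (d :* j :* y)) := con 0ℤ :- (x :* d) :* y :* (i :- j)) refl
               x (x ⊖ t) y (inv x) (inv (x ⊖ t)) ⟩
        O ⊖ (x ⊗ (x ⊖ t)) ⊗ y ⊗ g t x ∎

  -- The conic g t x = g t′ x′ passes through the origin, so it is parametrised by the slope x′ / x.
  slope-equation : ∀ {t t′ x m} → x ≢ O → x ≢ t → m ⊗ x ≢ O → m ⊗ x ≢ t′ → g t x ≡ g t′ (m ⊗ x) →
    t ⊗ m ⊗ (m ⊗ x ⊖ t′) ≡ t′ ⊗ (x ⊖ t)
  slope-equation {t} {t′} {x} {m} x≢O x≢t mx≢O mx≢t′ eq = ⊗-cancelˡ x≢O (begin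
    x ⊗ (t ⊗ m ⊗ (m ⊗ x ⊖ t′))       ≡⟨ solve 4 (λ x t m t′ → x :* (t :* m :* (m :* x :- t′)) := t :* (m :* x :* (m :* x :- t′))) refl x t m t′ ⟩
    t ⊗ (m ⊗ x ⊗ (m ⊗ x ⊖ t′))       ≡⟨ Conic.conic x≢O x≢t mx≢O mx≢t′ eq ⟩
    t′ ⊗ (x ⊗ (x ⊖ t))               ≡⟨ solve 3 (λ x t t′ → t′ :* (x :* (x :- t)) := x :* (t′ :* (x :- t))) refl x t t′ ⟩
    x ⊗ (t′ ⊗ (x ⊖ t))               ∎)
    where open ≡-Reasoning

  -- For a fixed slope the equation is linear in `x`, with leading coefficient `t m² - t′` and
  -- constant term `t t′ (1 - m)`. Two distinct roots make both vanish, whence `m = 1` and `t = t′`.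
  slope-unique : ∀ {t t′ m x y} → t ≢ O → t′ ≢ O → ¬ (m ≡ I × t ≡ t′) →
    t ⊗ m ⊗ (m ⊗ x ⊖ t′) ≡ t′ ⊗ (x ⊖ t) → t ⊗ m ⊗ (m ⊗ y ⊖ t′) ≡ t′ ⊗ (y ⊖ t) → x ≡ y
  slope-unique {t} {t′} {m} {x} {y} t≢O t′≢O generic eqx eqy with x Fin.≟ y
  ... | yes x≡y = x≡y
  ... | no x≢y = contradiction (m≡I , t≡t′) generic
    where
    open ≡-Reasoning
    leading : t ⊗ m ⊗ m ≡ t′
    leading = x⊖y≡O⇒x≡y _ _ (⊗-cancelˡ (x≢y ∘ x⊖y≡O⇒x≡y x y) (begin
      (x ⊖ y) ⊗ (t ⊗ m ⊗ m ⊖ t′)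
        ≡⟨ solve 5 (λ x y t m t′ → (x :- y) :* (t :* m :* m :- t′) :=
             t :* m :* (m :* x :- t′) :- t′ :* (x :- t) :- (t :* m :* (m :* y :- t′) :- t′ :* (y :- t))) refl x y t m t′ ⟩
      t ⊗ m ⊗ (m ⊗ x ⊖ t′) ⊖ t′ ⊗ (x ⊖ t) ⊖ (t ⊗ m ⊗ (m ⊗ y ⊖ t′) ⊖ t′ ⊗ (y ⊖ t))
        ≡⟨ cong₂ (λ u v → u ⊖ t′ ⊗ (x ⊖ t) ⊖ (v ⊖ t′ ⊗ (y ⊖ t))) eqx eqy ⟩
      t′ ⊗ (x ⊖ t) ⊖ t′ ⊗ (x ⊖ t) ⊖ (t′ ⊗ (y ⊖ t) ⊖ t′ ⊗ (y ⊖ t))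
        ≡⟨ solve 3 (λ a b c → a :- a :- (b :- b) := c :* con 0ℤ) refl _ _ _ ⟩
      (x ⊖ y) ⊗ O ∎))
    m≡I : m ≡ I
    m≡I = ⊗-cancelˡ (⊗-nonzero t≢O t′≢O) (begin
      t ⊗ t′ ⊗ m
        ≡⟨ solve 4 (λ t t′ m x → t :* t′ :* m := t :* m :* m :* x :- t :* m :* (m :* x :- t′)) refl t t′ m x ⟩
      t ⊗ m ⊗ m ⊗ x ⊖ t ⊗ m ⊗ (m ⊗ x ⊖ t′)
        ≡⟨ cong₂ (λ u v → u ⊗ x ⊖ v) leading eqx ⟩
      t′ ⊗ x ⊖ t′ ⊗ (x ⊖ t)
        ≡⟨ solve 3 (λ t t′ x → t′ :* x :- t′ :* (x :- t) := t :* t′ :* con 1ℤ) refl t t′ x ⟩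
      t ⊗ t′ ⊗ I ∎)
    t≡t′ : t ≡ t′
    t≡t′ = trans (solve 1 (λ t → t := t :* con 1ℤ :* con 1ℤ) refl t) (trans (cong (λ m → t ⊗ m ⊗ m) (sym m≡I)) leading)

  off : Fin p → Fin p → ℤ
  off a x = 1ℤ - δ a x

  opaque
    unfolding _+_

    1-0≡1 : 1ℤ - 0ℤ ≡ 1ℤ
    1-0≡1 = refl

    1-1≡0 : 1ℤ - 1ℤ ≡ 0ℤ
    1-1≡0 = refl

  off-indicator : ∀ a → Indicator (off a)
  off-indicator a x with δ-indicator a x
  ... | inj₁ e rewrite e = inj₂ 1-0≡1
  ... | inj₂ e rewrite e = inj₁ 1-1≡0

  off≡1⇒≢ : ∀ {a x} → off a x ≡ 1ℤ → x ≢ a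
  off≡1⇒≢ off≡1 x≡a = contradiction (trans (sym off≡1) (trans (cong (_-_ 1ℤ) (δ-refl (sym x≡a))) 1-1≡0)) (λ ())

-- Counting points on the conics.

module HyperbolaCount {p : ℕ} (𝔽 : FiniteField.PrimeField p) where

  open Arithmetic
  open Sums
  open FieldProperties 𝔽
  open Solver using (solve; _:=_; _:-_; con)
  open Hyperbolas 𝔽

  ≤-left : ∀ {e a b} → e ≤ a → 0ℤ ≤ b → e ≤ a + b
  ≤-left {b = b} e≤a 0≤b = ≤-trans e≤a (≤-slack b 0≤b refl)

  ≤-right : ∀ {e a b} → 0ℤ ≤ a → e ≤ b → e ≤ a + b
  ≤-right {e} 0≤a e≤b = subst (_≤ _) (+-identityˡ e) (+-mono-≤ 0≤a e≤b)

  g-O : ∀ x → g O x ≡ O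
  g-O x = trans (cong (λ y → inv x ⊖ inv y) (solve 1 (λ x → x :- con 0ℤ := x) refl x)) (x⊖x≡O (inv x))

  g≡O⇒≡O : ∀ t x → g t x ≡ O → t ≡ O
  g≡O⇒≡O t x gtx≡O = ⊖-cancelˡ (trans (sym (inv-injective (x⊖y≡O⇒x≡y _ _ gtx≡O))) (solve 1 (λ x → x := x :- con 0ℤ) refl x))

  generic : Fin p → Fin p → Fin p → Fin p → ℤ
  generic t t′ x x′ = coincide t t′ x x′ * (off O x * (off t x * (off O x′ * (off t′ x′ * (off O t * off O t′)))))

  coincide-bit : ∀ t t′ x x′ → Bit (coincide t t′ x x′)
  coincide-bit t t′ x x′ = δ-indicator (g t x) (g t′ x′)

  generic-bit : ∀ t t′ x x′ → Bit (generic t t′ x x′)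
  generic-bit t t′ x x′ = bit-* (coincide-bit t t′ x x′) (bit-* (off-indicator O x) (bit-* (off-indicator t x)
    (bit-* (off-indicator O x′) (bit-* (off-indicator t′ x′) (bit-* (off-indicator O t) (off-indicator O t′))))))

  bit-nonneg : ∀ {a} → Bit a → 0ℤ ≤ a
  bit-nonneg (inj₁ refl) = ≤-refl
  bit-nonneg (inj₂ refl) = 0≤+ 1

  record Generic (t t′ x x′ : Fin p) : Set where
    field
      g≡g : g t x ≡ g t′ x′
      x≢O : x ≢ O
      x≢t : x ≢ t
      x′≢O : x′ ≢ O
      x′≢t′ : x′ ≢ t′
      t≢O : t ≢ O
      t′≢O : t′ ≢ O

  generic≡1⇒Generic : ∀ t t′ x x′ → generic t t′ x x′ ≡ 1ℤ → Generic t t′ x x′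
  generic≡1⇒Generic t t′ x x′ is-1 with bit-*≡1 (coincide-bit t t′ x x′) is-1
  ... | c₀ , is-1 with bit-*≡1 (off-indicator O x) is-1
  ... | c₁ , is-1 with bit-*≡1 (off-indicator t x) is-1
  ... | c₂ , is-1 with bit-*≡1 (off-indicator O x′) is-1
  ... | c₃ , is-1 with bit-*≡1 (off-indicator t′ x′) is-1
  ... | c₄ , is-1 with bit-*≡1 (off-indicator O t) is-1
  ... | c₅ , c₆ = record { g≡g = δ≡1⇒≡ c₀ ; x≢O = off≡1⇒≢ c₁ ; x≢t = off≡1⇒≢ c₂
    ; x′≢O = off≡1⇒≢ c₃ ; x′≢t′ = off≡1⇒≢ c₄ ; t≢O = off≡1⇒≢ c₅ ; t′≢O = off≡1⇒≢ c₆ }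

  -- The poles, where the convention for `inv O` replaces the algebra, and `t = t′ = O`, where both
  -- sides vanish identically. If just one of `t`, `t′` is zero there is no coincidence, since
  -- `g t x ≡ O` forces `t ≡ O`.
  degenerate : Fin p → Fin p → Fin p → Fin p → ℤ
  degenerate t t′ x x′ = δ O x * c + δ t x * c + δ O x′ * c + δ t′ x′ * c + δ O t * δ O t′
    where c = coincide t t′ x x′

  bit-≤1 : ∀ {a} → Bit a → a ≤ 1ℤ
  bit-≤1 (inj₁ refl) = 0≤+ 1
  bit-≤1 (inj₂ refl) = ≤-refl

  ≢⇒off≡1 : ∀ {a x : Fin p} → x ≢ a → off a x ≡ 1ℤ
  ≢⇒off≡1 {a} {x} x≢a = trans (cong (_-_ 1ℤ) (δ-≢ (x≢a ∘ sym))) 1-0≡1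

  module _ (t t′ x x′ : Fin p) where

    private
      c : ℤ
      c = coincide t t′ x x′

      hit : ∀ {a y : Fin p} → y ≡ a → c ≤ δ a y * c
      hit y≡a = ≤-reflexive (sym (trans (cong (_* c) (δ-refl (sym y≡a))) (*-identityˡ c)))

      n : ∀ (a y : Fin p) → 0ℤ ≤ δ a y * c
      n a y = bit-nonneg (δ-indicator a y) · bit-nonneg (coincide-bit t t′ x x′)

      n₅ : 0ℤ ≤ δ O t * δ O t′
      n₅ = bit-nonneg (bit-* (δ-indicator O t) (δ-indicator O t′))

      n₆ : 0ℤ ≤ generic t t′ x x′
      n₆ = bit-nonneg (generic-bit t t′ x x′)

      n₄ : 0ℤ ≤ δ O x * c + δ t x * c + δ O x′ * c + δ t′ x′ * c
      n₄ = n O x ⊹ n t x ⊹ n O x′ ⊹ n t′ x′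

    coincide-≤-regular : x ≢ O → x ≢ t → x′ ≢ O → x′ ≢ t′ → Dec (t ≡ O) → Dec (t′ ≡ O) →
      c ≤ degenerate t t′ x x′ + generic t t′ x x′
    coincide-≤-regular x≢O x≢t x′≢O x′≢t′ = regular
      where
      none : g t x ≢ g t′ x′ → c ≤ degenerate t t′ x x′ + generic t t′ x x′
      none differ = ≤-trans (≤-reflexive (δ-≢ differ)) (n₄ ⊹ n₅ ⊹ n₆)
      drop : ∀ {a y : Fin p} {b} → y ≢ a → b ≡ 1ℤ → off a y * b ≡ 1ℤ
      drop y≢a b≡1 = trans (cong₂ _*_ (≢⇒off≡1 y≢a) b≡1) (*-identityˡ 1ℤ)
      regular : Dec (t ≡ O) → Dec (t′ ≡ O) → c ≤ degenerate t t′ x x′ + generic t t′ x x′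
      regular (yes t≡O) (yes t′≡O) = ≤-left (≤-right n₄ (≤-trans (bit-≤1 (coincide-bit t t′ x x′))
          (≤-reflexive (sym (trans (cong₂ _*_ (δ-refl (sym t≡O)) (δ-refl (sym t′≡O))) (*-identityˡ 1ℤ)))))) n₆
      regular (yes t≡O) (no t′≢O) = none (λ eq → t′≢O (g≡O⇒≡O t′ x′ (trans (sym eq) (trans (cong (λ s → g s x) t≡O) (g-O x)))))
      regular (no t≢O) (yes t′≡O) = none (λ eq → t≢O (g≡O⇒≡O t x (trans eq (trans (cong (λ s → g s x′) t′≡O) (g-O x′)))))
      regular (no t≢O) (no t′≢O) = ≤-right (n₄ ⊹ n₅) (≤-reflexive (sym (trans (cong (c *_)
          (drop x≢O (drop x≢t (drop x′≢O (drop x′≢t′ (drop t≢O (≢⇒off≡1 t′≢O))))))) (*-identityʳ c))))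

    coincide-≤ : c ≤ degenerate t t′ x x′ + generic t t′ x x′
    coincide-≤ with x Fin.≟ O | x Fin.≟ t | x′ Fin.≟ O | x′ Fin.≟ t′
    ... | yes x≡O | _ | _ | _ = ≤-left (≤-left (≤-left (≤-left (≤-left (hit x≡O) (n t x)) (n O x′)) (n t′ x′)) n₅) n₆
    ... | no _ | yes x≡t | _ | _ = ≤-left (≤-left (≤-left (≤-left (≤-right (n O x) (hit x≡t)) (n O x′)) (n t′ x′)) n₅) n₆
    ... | no _ | no _ | yes x′≡O | _ = ≤-left (≤-left (≤-left (≤-right (n O x ⊹ n t x) (hit x′≡O)) (n t′ x′)) n₅) n₆
    ... | no _ | no _ | no _ | yes x′≡t′ = ≤-left (≤-left (≤-right (n O x ⊹ n t x ⊹ n O x′) (hit x′≡t′)) n₅) n₆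
    ... | no x≢O | no x≢t | no x′≢O | no x′≢t′ = coincide-≤-regular x≢O x≢t x′≢O x′≢t′ (t Fin.≟ O) (t′ Fin.≟ O)

  -- Each of the `P` slopes carries at most one point; only slope 1 with `t = t′` can carry more,
  -- and then at most `P`.
  ∑-generic-≤ : ∀ t t′ → ∑[ x ] ∑[ x′ ] generic t t′ x x′ ≤ P + P * δ t t′
  ∑-generic-≤ t t′ = begin
      ∑[ x ] ∑[ x′ ] generic t t′ x x′               ≡⟨ ∑-cong by-slope ⟩
      ∑[ x ] ∑[ m ] generic t t′ x (m ⊗ x)           ≡⟨ ∑-comm _ ⟩
      ∑[ m ] ∑[ x ] generic t t′ x (m ⊗ x)           ≤⟨ ∑-mono per-slope ⟩
      ∑[ m ] (1ℤ + P * δ t t′ * (δ I m * 1ℤ))        ≡⟨ ∑-+ _ _ ⟩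
      ∑ {p} (λ _ → 1ℤ) + ∑[ m ] (P * δ t t′ * (δ I m * 1ℤ))
        ≡⟨ cong₂ _+_ (trans (∑-const p 1ℤ) (*-identityʳ P)) (trans (∑-*ˡ (P * δ t t′) _) (trans (cong (P * δ t t′ *_) (∑-δ I (λ _ → 1ℤ))) (*-identityʳ _))) ⟩
      P + P * δ t t′                                  ∎
    where
    open ℤₚ.≤-Reasoning
    at-O : ∀ x′ → generic t t′ O x′ ≡ 0ℤ
    at-O x′ = trans (cong (coincide t t′ O x′ *_) (trans (cong₂ _*_ (trans (cong (_-_ 1ℤ) (δ-refl {x = O} refl)) 1-1≡0) refl) (*-zeroˡ _))) (*-zeroʳ _)
    by-slope : ∀ x → ∑[ x′ ] generic t t′ x x′ ≡ ∑[ m ] generic t t′ x (m ⊗ x)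
    by-slope x with x Fin.≟ O
    ... | no x≢O = ∑-scale (generic t t′ x) x≢O
    -- At the origin `x′ = m ⊗ x` is no change of variable, but the factor `off O x` annihilates
    -- both sums.
    ... | yes refl = trans (∑-zero at-O) (sym (∑-zero (λ m → at-O (m ⊗ O))))
    equation : ∀ {m x} → Generic t t′ x (m ⊗ x) → t ⊗ m ⊗ (m ⊗ x ⊖ t′) ≡ t′ ⊗ (x ⊖ t)
    equation G = slope-equation x≢O x≢t x′≢O x′≢t′ g≡g
      where open Generic G
    unique : ∀ {m} → ¬ (m ≡ I × t ≡ t′) → ∑[ x ] generic t t′ x (m ⊗ x) ≤ 1ℤ
    unique {m} proper = ∑-at-most-one (λ x → generic-bit t t′ x (m ⊗ x)) same
      where
      same : ∀ x y → generic t t′ x (m ⊗ x) ≡ 1ℤ → generic t t′ y (m ⊗ y) ≡ 1ℤ → x ≡ y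
      same x y x-on y-on = slope-unique (Generic.t≢O X) (Generic.t′≢O X) proper (equation X) (equation Y)
        where
        X = generic≡1⇒Generic t t′ x (m ⊗ x) x-on
        Y = generic≡1⇒Generic t t′ y (m ⊗ y) y-on
    per-slope : ∀ m → ∑[ x ] generic t t′ x (m ⊗ x) ≤ 1ℤ + P * δ t t′ * (δ I m * 1ℤ)
    per-slope m with m Fin.≟ I | t Fin.≟ t′
    ... | yes refl | yes refl = ≤-right (0≤+ 1) (≤-trans (∑-indicator-≤ (λ x → generic-bit t t x (I ⊗ x)))
            (≤-reflexive (sym (trans (cong₂ (λ u v → P * u * (v * 1ℤ)) (δ-refl {x = t} refl) (δ-refl {x = I} refl)) (eq P)))))
      where
      opaque
        unfolding _+_
        eq : ∀ P → P * 1ℤ * (1ℤ * 1ℤ) ≡ P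
        eq = solve-∀
    ... | no m≢I | _ = ≤-left (unique (m≢I ∘ proj₁)) (0≤+ p · bit-nonneg (δ-indicator t t′) · (bit-nonneg (δ-indicator I m) · 0≤+ 1))
    ... | yes _ | no t≢t′ = ≤-left (unique (t≢t′ ∘ proj₂)) (0≤+ p · bit-nonneg (δ-indicator t t′) · (bit-nonneg (δ-indicator I m) · 0≤+ 1))

  ∑∑-δ-left : ∀ a t t′ → ∑[ x ] ∑[ x′ ] (δ a x * coincide t t′ x x′) ≡ ∑[ x′ ] coincide t t′ a x′
  ∑∑-δ-left a t t′ = trans (∑-cong (λ x → ∑-*ˡ (δ a x) _)) (∑-δ a _)

  ∑∑-δ-right : ∀ a t t′ → ∑[ x ] ∑[ x′ ] (δ a x′ * coincide t t′ x x′) ≡ ∑[ x ] coincide t t′ x a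
  ∑∑-δ-right a t t′ = ∑-cong (λ x → ∑-δ a _)

  ∑-injective-≤1 : ∀ (φ : Fin p → Fin p) y → (∀ {s t} → φ s ≡ φ t → s ≡ t) → ∑[ t ] δ (φ t) y ≤ 1ℤ
  ∑-injective-≤1 φ y φ-inj = ∑-at-most-one (λ t → δ-indicator (φ t) y)
    (λ s t s-on t-on → φ-inj (trans (δ≡1⇒≡ s-on) (sym (δ≡1⇒≡ t-on))))

  -- Once `x` is fixed at the pole `c t`, injectivity lets `t′` and `x′` determine `t`.
  few-left : ∀ (c : Fin p → Fin p) → (∀ {s t} → g s (c s) ≡ g t (c t) → s ≡ t) →
    ∑[ t ] ∑[ t′ ] ∑[ x ] ∑[ x′ ] (δ (c t) x * coincide t t′ x x′) ≤ P ²
  few-left c inj = begin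
    ∑[ t ] ∑[ t′ ] ∑[ x ] ∑[ x′ ] (δ (c t) x * coincide t t′ x x′)  ≡⟨ ∑-cong (λ t → ∑-cong (λ t′ → ∑∑-δ-left (c t) t t′)) ⟩
    ∑[ t ] ∑[ t′ ] ∑[ x′ ] coincide t t′ (c t) x′                   ≡⟨ ∑-comm _ ⟩
    ∑[ t′ ] ∑[ t ] ∑[ x′ ] coincide t t′ (c t) x′                   ≡⟨ ∑-cong (λ t′ → ∑-comm _) ⟩
    ∑[ t′ ] ∑[ x′ ] ∑[ t ] coincide t t′ (c t) x′                   ≤⟨ ∑-≤-const (P * 1ℤ) (λ t′ → ∑-≤-const 1ℤ (λ x′ → ∑-injective-≤1 (λ t → g t (c t)) (g t′ x′) inj)) ⟩
    P * (P * 1ℤ)                                                     ≡⟨ cong (P *_) (*-identityʳ P) ⟩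
    P ²                                                              ∎
    where open ℤₚ.≤-Reasoning

  few-right : ∀ (c : Fin p → Fin p) → (∀ {s t} → g s (c s) ≡ g t (c t) → s ≡ t) →
    ∑[ t ] ∑[ t′ ] ∑[ x ] ∑[ x′ ] (δ (c t′) x′ * coincide t t′ x x′) ≤ P ²
  few-right c inj = begin
    ∑[ t ] ∑[ t′ ] ∑[ x ] ∑[ x′ ] (δ (c t′) x′ * coincide t t′ x x′)  ≡⟨ ∑-cong (λ t → ∑-cong (λ t′ → ∑∑-δ-right (c t′) t t′)) ⟩
    ∑[ t ] ∑[ t′ ] ∑[ x ] coincide t t′ x (c t′)                      ≡⟨ ∑-cong (λ t → ∑-comm _) ⟩
    ∑[ t ] ∑[ x ] ∑[ t′ ] coincide t t′ x (c t′)                      ≤⟨ ∑-≤-const (P * 1ℤ) (λ t → ∑-≤-const 1ℤ (λ x → at-most-one t x)) ⟩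
    P * (P * 1ℤ)                                                       ≡⟨ cong (P *_) (*-identityʳ P) ⟩
    P ²                                                                ∎
    where
    open ℤₚ.≤-Reasoning
    at-most-one : ∀ t x → ∑[ t′ ] coincide t t′ x (c t′) ≤ 1ℤ
    at-most-one t x = ≤-trans (≤-reflexive (∑-cong (λ t′ → δ-sym (g t x) (g t′ (c t′))))) (∑-injective-≤1 (λ t′ → g t′ (c t′)) (g t x) inj)

  g-at-O-injective : ∀ {s t} → g s O ≡ g t O → s ≡ t
  g-at-O-injective eq = ⊖-cancelˡ (inv-injective (⊖-cancelˡ eq))

  g-diagonal-injective : ∀ {s t} → g s s ≡ g t t → s ≡ t
  g-diagonal-injective {s} {t} eq =
    inv-injective (⊖-cancelʳ (trans eq (cong (λ y → inv t ⊖ inv y) (trans (x⊖x≡O t) (sym (x⊖x≡O s))))))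

  ∑-degenerate-≤ : ∑[ t ] ∑[ t′ ] ∑[ x ] ∑[ x′ ] degenerate t t′ x x′ ≤ + 5 * P ²
  ∑-degenerate-≤ = begin
    ∑[ t ] ∑[ t′ ] ∑[ x ] ∑[ x′ ] degenerate t t′ x x′
      ≡⟨ trans (∑⁴-+ _ _) (cong₂ _+_ (trans (∑⁴-+ _ _) (cong₂ _+_ (trans (∑⁴-+ _ _) (cong₂ _+_ (∑⁴-+ _ _) refl)) refl)) refl) ⟩
    ∑⁴ (λ t t′ x x′ → δ O x * coincide t t′ x x′) + ∑⁴ (λ t t′ x x′ → δ t x * coincide t t′ x x′)
      + ∑⁴ (λ t t′ x x′ → δ O x′ * coincide t t′ x x′) + ∑⁴ (λ t t′ x x′ → δ t′ x′ * coincide t t′ x x′)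
      + ∑⁴ (λ t t′ x x′ → δ O t * δ O t′)
      ≤⟨ +-mono-≤ (+-mono-≤ (+-mono-≤ (+-mono-≤
          (few-left (λ _ → O) g-at-O-injective) (few-left (λ t → t) g-diagonal-injective))
          (few-right (λ _ → O) g-at-O-injective)) (few-right (λ t → t) g-diagonal-injective)) (≤-reflexive both-zero) ⟩
    P ² + P ² + P ² + P ² + P ²
      ≡⟨ eq (P ²) ⟩
    + 5 * P ² ∎
    where
    open ℤₚ.≤-Reasoning
    ∑⁴ : (Fin p → Fin p → Fin p → Fin p → ℤ) → ℤ
    ∑⁴ F = ∑[ t ] ∑[ t′ ] ∑[ x ] ∑[ x′ ] F t t′ x x′
    ∑⁴-+ : ∀ F G → ∑⁴ (λ t t′ x x′ → F t t′ x x′ + G t t′ x x′) ≡ ∑⁴ F + ∑⁴ G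
    ∑⁴-+ F G = trans (∑-cong (λ t → trans (∑-cong (λ t′ → trans (∑-cong (λ x → ∑-+ _ _)) (∑-+ _ _))) (∑-+ _ _))) (∑-+ _ _)
    opaque
      unfolding _+_
      eq : ∀ a → a + a + a + a + a ≡ + 5 * a
      eq = solve-∀
      eq₁ : ∀ P a b → P * (P * (a * b)) ≡ P * P * (a * (b * 1ℤ))
      eq₁ = solve-∀
    both-zero : ∑⁴ (λ t t′ x x′ → δ O t * δ O t′) ≡ P ²
    both-zero = trans (∑-cong (λ t → trans (∑-cong (λ t′ → trans (trans (∑-cong (λ x → ∑-const p _)) (∑-const p _)) (eq₁ P (δ O t) (δ O t′))))
        (trans (∑-*ˡ (P ²) _) (cong (P ² *_) (trans (∑-*ˡ (δ O t) _) (cong (δ O t *_) (∑-δ O (λ _ → 1ℤ))))))))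
      (trans (∑-*ˡ (P ²) _) (trans (cong (P ² *_) (∑-δ O (λ _ → 1ℤ))) (*-identityʳ (P ²))))

  -- `P * (∑ r) ²` is what `P` coincidences for each pair `t`, `t′` would give. Of the error `6 P⁴`,
  -- five parts come from degenerate points and one from the diagonal `t = t′`, both by `r t ≤ P`.
  energy : ∀ (r : Fin p → ℤ) → (∀ t → 0ℤ ≤ r t) → (∀ t → r t ≤ P) →
    ∑[ t ] ∑[ t′ ] (r t * r t′ * ∑[ x ] ∑[ x′ ] coincide t t′ x x′) ≤ P * (∑ r) ² + + 6 * P ^ 4
  energy r 0≤r r≤P = begin
    ∑[ t ] ∑[ t′ ] (r t * r t′ * ∑[ x ] ∑[ x′ ] coincide t t′ x x′)
      ≤⟨ ∑-mono (λ t → ∑-mono (λ t′ → pointwise t t′)) ⟩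
    ∑[ t ] ∑[ t′ ] (P ² * D t t′ + (P * (r t * r t′) + P * (δ t t′ * (r t * r t′))))
      ≡⟨ trans (∑-cong (λ t → trans (∑-+ _ _) (cong₂ _+_ (∑-*ˡ (P ²) _) (trans (∑-+ _ _) (cong₂ _+_ (∑-*ˡ P _) (trans (∑-*ˡ P _) (cong (P *_) (∑-δ t _)))))))) 
           (trans (∑-+ _ _) (cong₂ _+_ (∑-*ˡ (P ²) _) (trans (∑-+ _ _) (cong₂ _+_ (trans (∑-*ˡ P _) (cong (P *_) (∑-product r r))) (∑-*ˡ P _))))) ⟩
    P ² * ∑[ t ] ∑[ t′ ] D t t′ + (P * (∑ r * ∑ r) + P * ∑[ t ] (r t * r t))
      ≤⟨ +-mono-≤ (*-monoˡ (square-nonneg P) ∑-degenerate-≤) (+-mono-≤ ≤-refl (*-monoˡ (0≤+ p)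
           (∑-≤-const (P ²) (λ t → *-mono (0≤r t) (0≤+ p) (r≤P t) (r≤P t))))) ⟩
    P ² * (+ 5 * P ²) + (P * (∑ r * ∑ r) + P * (P * P ²))
      ≡⟨ eq P (∑ r) ⟩
    P * (∑ r) ² + + 6 * P ^ 4 ∎
    where
    open ℤₚ.≤-Reasoning
    D : Fin p → Fin p → ℤ
    D t t′ = ∑[ x ] ∑[ x′ ] degenerate t t′ x x′
    opaque
      unfolding _+_
      eq : ∀ P s → P * P * (+ 5 * (P * P)) + (P * (s * s) + P * (P * (P * P))) ≡ P * (s * s) + + 6 * (P * (P * (P * (P * 1ℤ))))
      eq = solve-∀
      eq₁ : ∀ r r′ D P d → r * r′ * (D + (P + P * d)) ≡ r * r′ * D + (P * (r * r′) + P * (d * (r * r′)))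
      eq₁ = solve-∀
    0≤D : ∀ t t′ → 0ℤ ≤ D t t′
    0≤D t t′ = ∑-nonneg (λ x → ∑-nonneg (λ x′ → d O x (c x x′) ⊹ d t x (c x x′) ⊹ d O x′ (c x x′) ⊹ d t′ x′ (c x x′)
        ⊹ bit-nonneg (bit-* (δ-indicator O t) (δ-indicator O t′))))
      where
      c : ∀ x x′ → Bit (coincide t t′ x x′)
      c x x′ = coincide-bit t t′ x x′
      d : ∀ (a y : Fin p) {e} → Bit e → 0ℤ ≤ δ a y * e
      d a y e-bit = bit-nonneg (bit-* (δ-indicator a y) e-bit)
    pointwise : ∀ t t′ → r t * r t′ * ∑[ x ] ∑[ x′ ] coincide t t′ x x′ ≤
      P ² * D t t′ + (P * (r t * r t′) + P * (δ t t′ * (r t * r t′)))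
    pointwise t t′ = begin
      r t * r t′ * ∑[ x ] ∑[ x′ ] coincide t t′ x x′
        ≤⟨ *-monoˡ (0≤r t · 0≤r t′) (∑-mono (λ x → ∑-mono (λ x′ → coincide-≤ t t′ x x′))) ⟩
      r t * r t′ * ∑[ x ] ∑[ x′ ] (degenerate t t′ x x′ + generic t t′ x x′)
        ≡⟨ cong (r t * r t′ *_) (trans (∑-cong (λ x → ∑-+ _ _)) (∑-+ _ _)) ⟩
      r t * r t′ * (D t t′ + ∑[ x ] ∑[ x′ ] generic t t′ x x′)
        ≤⟨ *-monoˡ (0≤r t · 0≤r t′) (+-mono-≤ ≤-refl (∑-generic-≤ t t′)) ⟩
      r t * r t′ * (D t t′ + (P + P * δ t t′))
        ≡⟨ eq₁ (r t) (r t′) (D t t′) P (δ t t′) ⟩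
      r t * r t′ * D t t′ + (P * (r t * r t′) + P * (δ t t′ * (r t * r t′)))
        ≤⟨ +-mono-≤ (*-mono (0≤r t · 0≤r t′) (0≤D t t′) (*-mono (0≤r t) (0≤+ p) (r≤P t) (r≤P t′)) ≤-refl) ≤-refl ⟩
      P ² * D t t′ + (P * (r t * r t′) + P * (δ t t′ * (r t * r t′))) ∎

-- Inversion mixes the translates of a dense set.

module Mixing {p : ℕ} (𝔽 : FiniteField.PrimeField p) (T : Fin p → ℤ) (T-ind : Sums.Indicator T) where

  open Arithmetic
  open Sums
  open FieldProperties 𝔽
  open Solver using (solve; _:=_; _:+_; _:-_)
  open Hyperbolas 𝔽
  open HyperbolaCount 𝔽
  open Averaging T T-ind using (b)

  r : Fin p → ℤ
  r d = ∑[ c ] (T (c ⊕ d) * T c)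

  0≤r : ∀ d → 0ℤ ≤ r d
  0≤r d = ∑-nonneg (λ c → indicator-nonneg T-ind (c ⊕ d) · indicator-nonneg T-ind c)

  r≤P : ∀ d → r d ≤ P
  r≤P d = ∑-indicator-≤ (λ c → bit-* (T-ind (c ⊕ d)) (T-ind c))

  r-difference : ∀ x y → ∑[ u ] (T (x ⊖ u) * T (y ⊖ u)) ≡ r (x ⊖ y)
  r-difference x y = trans (∑-reflect _ y) (∑-cong (λ c → cong₂ (λ v w → T v * T w) (place x y c) (x⊖[x⊖y]≡y y c)))
    where
    place : ∀ x y c → x ⊖ (y ⊖ c) ≡ c ⊕ (x ⊖ y)
    place = solve 3 (λ x y c → x :- (y :- c) := c :+ (x :- y)) refl

  ∑r : ∑ r ≡ b * b
  ∑r = trans (∑-comm _) (trans (∑-cong (λ c → trans (∑-*ʳ _ (T c)) (cong (_* T c)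
    (sym (trans (∑-shift T c) (∑-cong (λ d → cong T (swap d c)))))))) (∑-*ˡ b T))
    where
    swap : ∀ d c → d ⊕ c ≡ c ⊕ d
    swap = ⊕-comm

  Y : Fin p → ℤ
  Y s = ∑[ x ] r (inv x ⊖ inv (x ⊖ s))

  ∑Y : ∑ Y ≡ P * (b * b)
  ∑Y = begin
    ∑[ s ] ∑[ x ] r (inv x ⊖ inv (x ⊖ s))   ≡⟨ ∑-comm _ ⟩
    ∑[ x ] ∑[ s ] r (inv x ⊖ inv (x ⊖ s))   ≡⟨ ∑-cong (λ x → sym (trans (∑-reflect r (inv x)) (trans (∑-inv _) (∑-reflect _ x)))) ⟩
    ∑ {p} (λ _ → ∑ r)                       ≡⟨ ∑-const p _ ⟩
    P * ∑ r                                 ≡⟨ cong (P *_) ∑r ⟩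
    P * (b * b)                             ∎
    where open ≡-Reasoning

  D : Fin p → Fin p → ℤ
  D t s = ∑[ x ] δ (g t x) s

  -- `Y s` fixes the difference `s` of two points and weighs the difference of their inverses.
  -- Inverting both points exchanges the two roles, so that the weight no longer depends on `x`.
  Y-as-D : ∀ s → Y s ≡ ∑[ t ] (r t * D t s)
  Y-as-D s = begin
    ∑[ x ] r (inv x ⊖ inv (x ⊖ s))
      ≡⟨ ∑-cong (λ x → sym (∑-δ (x ⊖ s) (λ y → r (inv x ⊖ inv y)))) ⟩
    ∑[ x ] ∑[ y ] (δ (x ⊖ s) y * r (inv x ⊖ inv y))
      ≡⟨ trans (∑-inv _) (∑-cong (λ X → trans (∑-inv _) (∑-reflect _ X))) ⟩
    ∑[ X ] ∑[ t ] (δ (inv X ⊖ s) (inv (X ⊖ t)) * r (inv (inv X) ⊖ inv (inv (X ⊖ t))))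
      ≡⟨ ∑-cong (λ X → ∑-cong (λ t → trans (cong₂ _*_ (flip X t) (cong r (same X t))) (*-comm _ (r t)))) ⟩
    ∑[ X ] ∑[ t ] (r t * δ (g t X) s)
      ≡⟨ trans (∑-comm _) (∑-cong (λ t → ∑-*ˡ (r t) _)) ⟩
    ∑[ t ] (r t * D t s) ∎
    where
    open ≡-Reasoning
    same : ∀ X t → inv (inv X) ⊖ inv (inv (X ⊖ t)) ≡ t
    same X t = trans (cong₂ _⊖_ (inv-involutive X) (inv-involutive (X ⊖ t))) (x⊖[x⊖y]≡y X t)
    flip : ∀ X t → δ (inv X ⊖ s) (inv (X ⊖ t)) ≡ δ (g t X) s
    flip X t with g t X Fin.≟ s
    ... | yes refl = trans (δ-refl (x⊖[x⊖y]≡y (inv X) (inv (X ⊖ t)))) (sym (δ-refl {x = g t X} refl))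
    ... | no g≢s = trans (δ-≢ (λ eq → g≢s (trans (cong (inv X ⊖_) (sym eq)) (x⊖[x⊖y]≡y (inv X) s)))) (sym (δ-≢ g≢s))

  ∑Y² : ∑[ s ] (Y s) ² ≡ ∑[ t ] ∑[ t′ ] (r t * r t′ * ∑[ x ] ∑[ x′ ] coincide t t′ x x′)
  ∑Y² = begin
    ∑[ s ] (Y s) ²
      ≡⟨ ∑-cong (λ s → trans (cong _² (Y-as-D s)) (sym (∑-product _ _))) ⟩
    ∑[ s ] ∑[ t ] ∑[ t′ ] (r t * D t s * (r t′ * D t′ s))
      ≡⟨ trans (∑-comm _) (∑-cong (λ t → ∑-comm _)) ⟩
    ∑[ t ] ∑[ t′ ] ∑[ s ] (r t * D t s * (r t′ * D t′ s))
      ≡⟨ ∑-cong (λ t → ∑-cong (λ t′ → trans (∑-cong (λ s → eq (r t) (D t s) (r t′) (D t′ s)))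
           (trans (∑-*ˡ (r t * r t′) _) (cong (r t * r t′ *_) (meet t t′))))) ⟩
    ∑[ t ] ∑[ t′ ] (r t * r t′ * ∑[ x ] ∑[ x′ ] coincide t t′ x x′) ∎
    where
    open ≡-Reasoning
    opaque
      unfolding _+_
      eq : ∀ a b c d → a * b * (c * d) ≡ a * c * (b * d)
      eq = solve-∀
    meet : ∀ t t′ → ∑[ s ] (D t s * D t′ s) ≡ ∑[ x ] ∑[ x′ ] coincide t t′ x x′
    meet t t′ = begin
      ∑[ s ] (D t s * D t′ s)
        ≡⟨ ∑-cong (λ s → sym (∑-product _ _)) ⟩
      ∑[ s ] ∑[ x ] ∑[ x′ ] (δ (g t x) s * δ (g t′ x′) s)
        ≡⟨ trans (∑-comm _) (∑-cong (λ x → ∑-comm _)) ⟩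
      ∑[ x ] ∑[ x′ ] ∑[ s ] (δ (g t x) s * δ (g t′ x′) s)
        ≡⟨ ∑-cong (λ x → ∑-cong (λ x′ → trans (∑-δ (g t x) (δ (g t′ x′))) (δ-sym (g t′ x′) (g t x)))) ⟩
      ∑[ x ] ∑[ x′ ] coincide t t′ x x′ ∎

  -- The mean of `Y` is `b * b`, and `P` times its square is exactly the main term of `energy`, so
  -- only the error term is left.
  Y-variance : ∑[ s ] (Y s - b * b) ² ≤ + 6 * P ^ 4
  Y-variance = ≤-slack _ (gap (energy r 0≤r r≤P))
    (trans (cong₂ (λ u v → u + (P * v ² + + 6 * P ^ 4 - E)) expand ∑r) (eq P b E (P ^ 4)))
    where
    E = ∑[ t ] ∑[ t′ ] (r t * r t′ * ∑[ x ] ∑[ x′ ] coincide t t′ x x′)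
    expand : ∑[ s ] (Y s - b * b) ² ≡ E - P * (b * b * (b * b))
    expand = trans (∑-cong (λ s → eq₁ (Y s) (b * b))) (trans (∑-lin₃ 1ℤ (- (+ 2 * (b * b))) (b * b * (b * b)) _ Y (λ _ → 1ℤ))
      (trans (cong₂ _+_ (cong₂ (λ u v → 1ℤ * u + (- (+ 2 * (b * b))) * v) ∑Y² ∑Y) (cong (b * b * (b * b) *_) (∑-const p 1ℤ))) (eq₂ P (b * b) E)))
      where
      opaque
        unfolding _+_
        eq₁ : ∀ y c → (y - c) * (y - c) ≡ 1ℤ * (y * y) + (- (+ 2 * c)) * y + c * c * 1ℤ
        eq₁ = solve-∀
        eq₂ : ∀ P c E → 1ℤ * E + (- (+ 2 * c)) * (P * c) + c * c * (P * 1ℤ) ≡ E - P * (c * c)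
        eq₂ = solve-∀
    opaque
      unfolding _+_
      eq : ∀ P b E q → E - P * (b * b * (b * b)) + (P * (b * b * (b * b)) + + 6 * q - E) ≡ + 6 * q
      eq = solve-∀

  -- The size of `(u + T) ∩ (v + T)*`.
  M : Fin p → Fin p → ℤ
  M u v = ∑[ x ] (T (x ⊖ u) * T (inv x ⊖ v))

  ∑T-reflect : ∀ x → ∑[ u ] T (x ⊖ u) ≡ b
  ∑T-reflect x = sym (∑-reflect T x)

  ∑∑M : ∑[ u ] ∑[ v ] M u v ≡ P * (b * b)
  ∑∑M = begin
    ∑[ u ] ∑[ v ] ∑[ x ] (T (x ⊖ u) * T (inv x ⊖ v))    ≡⟨ trans (∑-cong (λ u → ∑-comm _)) (∑-comm _) ⟩
    ∑[ x ] ∑[ u ] ∑[ v ] (T (x ⊖ u) * T (inv x ⊖ v))    ≡⟨ ∑-cong (λ x → trans (∑-product _ _) (cong₂ _*_ (∑T-reflect x) (∑T-reflect (inv x)))) ⟩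
    ∑ {p} (λ _ → b * b)                                  ≡⟨ ∑-const p _ ⟩
    P * (b * b)                                          ∎
    where open ≡-Reasoning

  -- For each pair `x`, `y` the sums over `u` and `v` factor into `r (x ⊖ y)` and
  -- `r (inv x ⊖ inv y)`; grouping by `s = x ⊖ y` yields `Y`.
  ∑∑M² : ∑[ u ] ∑[ v ] (M u v) ² ≡ ∑[ s ] (r s * Y s)
  ∑∑M² = begin
    ∑[ u ] ∑[ v ] (M u v) ²
      ≡⟨ ∑-cong (λ u → ∑-cong (λ v → sym (∑-product _ _))) ⟩
    ∑[ u ] ∑[ v ] ∑[ x ] ∑[ y ] F u v x y
      ≡⟨ trans (∑-cong (λ u → trans (∑-comm _) (∑-cong (λ x → ∑-comm _)))) (trans (∑-comm _) (∑-cong (λ x → ∑-comm _))) ⟩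
    ∑[ x ] ∑[ y ] ∑[ u ] ∑[ v ] F u v x y
      ≡⟨ ∑-cong (λ x → ∑-cong (λ y → trans (∑-cong (λ u → ∑-cong (λ v → eq (T (x ⊖ u)) (T (inv x ⊖ v)) (T (y ⊖ u)) (T (inv y ⊖ v)))))
           (trans (∑-product _ _) (cong₂ _*_ (r-difference x y) (r-difference (inv x) (inv y)))))) ⟩
    ∑[ x ] ∑[ y ] (r (x ⊖ y) * r (inv x ⊖ inv y))
      ≡⟨ ∑-cong (λ x → trans (∑-reflect _ x) (∑-cong (λ s → cong (λ z → r z * r (inv x ⊖ inv (x ⊖ s))) (x⊖[x⊖y]≡y x s)))) ⟩
    ∑[ x ] ∑[ s ] (r s * r (inv x ⊖ inv (x ⊖ s)))
      ≡⟨ trans (∑-comm _) (∑-cong (λ s → ∑-*ˡ (r s) _)) ⟩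
    ∑[ s ] (r s * Y s) ∎
    where
    open ≡-Reasoning
    F : Fin p → Fin p → Fin p → Fin p → ℤ
    F u v x y = T (x ⊖ u) * T (inv x ⊖ v) * (T (y ⊖ u) * T (inv y ⊖ v))
    opaque
      unfolding _+_
      eq : ∀ a b c d → a * b * (c * d) ≡ a * c * (b * d)
      eq = solve-∀

  module _ (θ : ℤ) (θ⁴≤P : (θ ²) ² ≤ P) where

    -- The integer `θ` does duty for the fourth root of `P`. Arithmetic-geometric means pair
    -- `θ² r s` with `Y s - b²`; their squares sum to at most `P⁴` and `6 P⁴`.
    second-moment : + 2 * θ ² * (∑[ s ] (r s * Y s) - b ² * b ²) ≤ + 7 * P ^ 4
    second-moment = ≤-trans (≤-reflexive left) (≤-trans (∑-mono (λ s → am-gm (θ ² * r s) (Y s - b * b))) (≤-trans (≤-reflexive right)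
      (≤-slack _ (gap Y-variance ⊹ (0≤+ p · (0≤+ p · 0≤+ p)) · gap θ⁴≤P ⊹ square-nonneg (θ ²) · gap ∑r²≤)
        (eq (θ ²) (∑[ s ] (r s * r s)) V P))))
      where
      V = ∑[ s ] (Y s - b * b) ²
      ∑r²≤ : ∑[ s ] (r s * r s) ≤ P * P ²
      ∑r²≤ = ∑-≤-const (P ²) (λ s → *-mono (0≤r s) (0≤+ p) (r≤P s) (r≤P s))
      left : + 2 * θ ² * (∑[ s ] (r s * Y s) - b ² * b ²) ≡ ∑[ s ] (+ 2 * (θ ² * r s) * (Y s - b * b))
      left = sym (trans (∑-cong (λ s → eq₁ (θ ²) (r s) (Y s) (b * b))) (trans (∑-lin₂ (+ 2 * θ ²) (- (+ 2 * θ ² * (b * b))) _ r)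
        (trans (cong (λ z → + 2 * θ ² * ∑[ s ] (r s * Y s) + (- (+ 2 * θ ² * (b * b))) * z) ∑r) (eq₂ (θ ²) (∑[ s ] (r s * Y s)) (b * b)))))
        where
        opaque
          unfolding _+_
          eq₁ : ∀ q r y c → + 2 * (q * r) * (y - c) ≡ + 2 * q * (r * y) + (- (+ 2 * q * c)) * r
          eq₁ = solve-∀
          eq₂ : ∀ q s c → + 2 * q * s + (- (+ 2 * q * c)) * c ≡ + 2 * q * (s - c * c)
          eq₂ = solve-∀
      right : ∑[ s ] ((θ ² * r s) ² + (Y s - b * b) ²) ≡ (θ ²) ² * ∑[ s ] (r s * r s) + V
      right = trans (∑-+ _ _) (cong (_+ V) (trans (∑-cong (λ s → eq₁ (θ ²) (r s))) (∑-*ˡ ((θ ²) ²) _)))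
        where
        opaque
          unfolding _+_
          eq₁ : ∀ q r → q * r * (q * r) ≡ q * q * (r * r)
          eq₁ = solve-∀
      opaque
        unfolding _+_
        eq : ∀ q R V P → q * q * R + V + (+ 6 * (P * (P * (P * (P * 1ℤ)))) - V + P * (P * P) * (P - q * q) + q * q * (P * (P * P) - R))
          ≡ + 7 * (P * (P * (P * (P * 1ℤ))))
        eq = solve-∀

    variance : + 2 * θ ² * ∑[ u ] ∑[ v ] (P * M u v - b ²) ² ≤ + 7 * P ^ 6
    variance = ≤-slack _ ((0≤+ p · 0≤+ p) · gap second-moment)
      (trans (cong (λ z → + 2 * θ ² * z + P * P * (+ 7 * P ^ 4 - + 2 * θ ² * (S - b ² * b ²))) expand) (eq (θ ²) S (b ²) P))
      where
      S = ∑[ s ] (r s * Y s)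
      expand : ∑[ u ] ∑[ v ] (P * M u v - b ²) ² ≡ P * P * (S - b ² * b ²)
      expand = begin
        ∑[ u ] ∑[ v ] (P * M u v - b ²) ²
          ≡⟨ ∑-cong (λ u → trans (∑-cong (λ v → eq₁ P (M u v) (b ²))) (∑-lin₃ (P * P) (- (+ 2 * P * b ²)) (b ² * b ²) _ (M u) (λ _ → 1ℤ))) ⟩
        ∑[ u ] (P * P * ∑[ v ] (M u v) ² + (- (+ 2 * P * b ²)) * ∑ (M u) + b ² * b ² * ∑ {p} (λ _ → 1ℤ))
          ≡⟨ ∑-lin₃ (P * P) (- (+ 2 * P * b ²)) (b ² * b ²) _ _ _ ⟩
        P * P * ∑[ u ] ∑[ v ] (M u v) ² + (- (+ 2 * P * b ²)) * ∑[ u ] ∑ (M u) + b ² * b ² * ∑ {p} (λ _ → ∑ {p} (λ _ → 1ℤ))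
          ≡⟨ cong₂ _+_ (cong₂ (λ x y → P * P * x + (- (+ 2 * P * b ²)) * y) ∑∑M² ∑∑M)
               (cong (b ² * b ² *_) (trans (∑-const p _) (cong (P *_) (∑-const p 1ℤ)))) ⟩
        P * P * S + (- (+ 2 * P * b ²)) * (P * (b * b)) + b ² * b ² * (P * (P * 1ℤ))
          ≡⟨ eq₂ P S (b ²) ⟩
        P * P * (S - b ² * b ²) ∎
        where
        open ≡-Reasoning
        opaque
          unfolding _+_
          eq₁ : ∀ P m c → (P * m - c) * (P * m - c) ≡ P * P * (m * m) + (- (+ 2 * P * c)) * m + c * c * 1ℤ
          eq₁ = solve-∀
          eq₂ : ∀ P S c → P * P * S + (- (+ 2 * P * c)) * (P * c) + c * c * (P * (P * 1ℤ)) ≡ P * P * (S - c * c)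
          eq₂ = solve-∀
      opaque
        unfolding _+_
        eq : ∀ q S c P → + 2 * q * (P * P * (S - c * c)) + P * P * (+ 7 * (P * (P * (P * (P * 1ℤ)))) - + 2 * q * (S - c * c))
          ≡ + 7 * (P * (P * (P * (P * (P * (P * 1ℤ))))))
        eq = solve-∀

    -- A second such pairing, of `P²` with `θ (P M - b²)`, over the pairs `u`, `v` selected by `σ`.
    -- The 9 is 2 from the `P²` terms plus 7 from `variance`.
    mixing : 0ℤ < P → ∀ {σ} → Indicator σ →
      + 4 * θ * (P * ∑[ u ] ∑[ v ] (σ u * σ v * M u v) - (∑ σ) ² * b ²) ≤ + 9 * P ^ 4
    mixing 0<P {σ} σ-ind = *-cancelˡ (*-pos 0<P 0<P) (≤-slack _ (gap variance ⊹ 0≤+ 2 · gap summed)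
        (eq θ (P * Σ′ - (∑ σ) ² * b ²) P V))
      where
      V = ∑[ u ] ∑[ v ] (P * M u v - b ²) ²
      Σ′ = ∑[ u ] ∑[ v ] (σ u * σ v * M u v)
      pointwise : ∀ u v → + 2 * P ² * θ * (σ u * σ v * (P * M u v - b ²)) ≤ P ² * P ² + θ ² * (P * M u v - b ²) ²
      pointwise u v with bit-* (σ-ind u) (σ-ind v)
      ... | inj₁ out rewrite out = ≤-slack _ (square-nonneg (P ²) ⊹ square-nonneg θ · square-nonneg (P * M u v - b ²)) (eq₁ (+ 2 * P ² * θ) (P * M u v - b ²) _)
        where
        opaque
          unfolding _+_
          eq₁ : ∀ c m x → c * (0ℤ * m) + x ≡ x
          eq₁ = solve-∀
      ... | inj₂ on rewrite on = ≤-slack _ (square-nonneg (P ² - θ * (P * M u v - b ²))) (eq₁ (P ²) θ (P * M u v - b ²))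
        where
        opaque
          unfolding _+_
          eq₁ : ∀ c t m → + 2 * c * t * (1ℤ * m) + (c - t * m) * (c - t * m) ≡ c * c + t * t * (m * m)
          eq₁ = solve-∀
      left : ∑[ u ] ∑[ v ] (+ 2 * P ² * θ * (σ u * σ v * (P * M u v - b ²))) ≡ + 2 * P ² * θ * (P * Σ′ - (∑ σ) ² * b ²)
      left = begin
        ∑[ u ] ∑[ v ] (c * (σ u * σ v * (P * M u v - b ²)))
          ≡⟨ ∑-cong (λ u → trans (∑-cong (λ v → eq₁ c P (σ u) (σ v) (M u v) (b ²))) (∑-lin₂ (c * P) (- (c * b ²)) _ _)) ⟩
        ∑[ u ] (c * P * ∑[ v ] (σ u * σ v * M u v) + (- (c * b ²)) * ∑[ v ] (σ u * σ v))
          ≡⟨ ∑-lin₂ (c * P) (- (c * b ²)) _ _ ⟩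
        c * P * Σ′ + (- (c * b ²)) * ∑[ u ] ∑[ v ] (σ u * σ v)
          ≡⟨ cong (λ z → c * P * Σ′ + (- (c * b ²)) * z) (∑-product σ σ) ⟩
        c * P * Σ′ + (- (c * b ²)) * (∑ σ * ∑ σ)
          ≡⟨ eq₂ c P Σ′ (b ²) (∑ σ) ⟩
        c * (P * Σ′ - (∑ σ) ² * b ²) ∎
        where
        open ≡-Reasoning
        c = + 2 * P ² * θ
        opaque
          unfolding _+_
          eq₁ : ∀ c P x y m q → c * (x * y * (P * m - q)) ≡ c * P * (x * y * m) + (- (c * q)) * (x * y)
          eq₁ = solve-∀
          eq₂ : ∀ c P S q s → c * P * S + (- (c * q)) * (s * s) ≡ c * (P * S - s * s * q)
          eq₂ = solve-∀
      right : ∑[ u ] ∑[ v ] (P ² * P ² + θ ² * (P * M u v - b ²) ²) ≡ P * (P * (P ² * P ²)) + θ ² * V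
      right = trans (∑-cong (λ u → trans (∑-+ _ _) (cong₂ _+_ (∑-const p _) (∑-*ˡ (θ ²) _))))
        (trans (∑-+ _ _) (cong₂ _+_ (∑-const p _) (∑-*ˡ (θ ²) _)))
      summed : + 2 * P ² * θ * (P * Σ′ - (∑ σ) ² * b ²) ≤ P * (P * (P ² * P ²)) + θ ² * V
      summed = subst₂ _≤_ left right (∑-mono (λ u → ∑-mono (λ v → pointwise u v)))
      opaque
        unfolding _+_
        eq : ∀ t d P V → P * P * (+ 4 * t * d) + (+ 7 * (P * (P * (P * (P * (P * (P * 1ℤ)))))) - + 2 * (t * t) * V
            + + 2 * (P * (P * (P * P * (P * P))) + t * t * V - + 2 * (P * P) * t * d)) ≡ P * P * (+ 9 * (P * (P * (P * (P * 1ℤ)))))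
        eq = solve-∀

-- The density bound with explicit error.

module DensityBound {p : ℕ} (𝔽 : FiniteField.PrimeField p) (f : Fin p → ℤ) (f-ind : Sums.Indicator f)
  (f-sum-free : FieldProperties.SumFreeIndicator 𝔽 f)
  (f-inv : FieldProperties.InversionInvariant 𝔽 f) where

  import Data.Nat as ℕ
  open Arithmetic
  open Sums
  open PowerLaws
  open FieldProperties 𝔽

  P N : ℤ
  P = + p
  N = ∑ f

  module Covering (T : Fin p → ℤ) (T-ind : Indicator T) (ℓ : ℤ) (0≤ℓ : 0ℤ ≤ ℓ) where

    open Averaging T T-ind
    open Triples.Neighbourhoods 𝔽 f T T-ind
    open Mixing 𝔽 T T-ind using (M; ∑T-reflect)

    threshold : ∀ {u} → Dec (b ≤ ℓ * α u) → ℤ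
    threshold (yes _) = 1ℤ
    threshold (no _) = 0ℤ

    σ : Fin p → ℤ
    σ u = threshold (b ≤? ℓ * α u)

    σ-ind : Indicator σ
    σ-ind u with b ≤? ℓ * α u
    ... | yes _ = inj₂ refl
    ... | no _ = inj₁ refl

    bσ≤ℓα : ∀ u → b * σ u ≤ ℓ * α u
    bσ≤ℓα u with b ≤? ℓ * α u
    ... | yes b≤ℓα = ≤-trans (≤-reflexive (*-identityʳ b)) b≤ℓα
    ... | no _ = ≤-trans (≤-reflexive (*-zeroʳ b)) (0≤ℓ · 𝔼-nonneg (λ t → indicator-nonneg f-ind (u ⊕ t)))

    uncovered : Fin p → ℤ
    uncovered u = 1ℤ - σ u

    0≤uncovered : ∀ u → 0ℤ ≤ uncovered u
    0≤uncovered u = gap (indicator-≤1 σ-ind u)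

    uncovered-small : ∀ u → ℓ * (uncovered u * α u) ≤ b
    uncovered-small u with b ≤? ℓ * α u
    ... | yes _ = ≤-trans (≤-reflexive (eq ℓ (α u))) 0≤b
      where
      opaque
        unfolding _+_
        eq : ∀ l a → l * ((1ℤ - 1ℤ) * a) ≡ 0ℤ
        eq = solve-∀
    ... | no b≰ℓα = ≤-trans (≤-reflexive (eq ℓ (α u))) (<⇒≤ (≰⇒> b≰ℓα))
      where
      opaque
        unfolding _+_
        eq : ∀ l a → l * ((1ℤ - 0ℤ) * a) ≡ l * a
        eq = solve-∀

    α-direct : ∀ u → ∑[ x ] (f x * T (x ⊖ u)) ≡ α u
    α-direct u = trans (∑-shift _ u) (∑-cong (λ t → trans (cong₂ _*_ (cong f (⊕-comm t u)) (cong T (x⊕y⊖y≡x t u))) (*-comm _ _)))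

    -- This is where A = A* enters: replacing `x` by its inverse turns a count in `(v + T)*` into a
    -- count in `v + T`.
    α-inverse : ∀ v → ∑[ x ] (f x * T (inv x ⊖ v)) ≡ α v
    α-inverse v = trans (∑-inv _) (trans (∑-cong (λ x → cong₂ _*_ (f-inv x) (cong (λ y → T (y ⊖ v)) (inv-involutive x)))) (α-direct v))

    leak : ℓ * ∑[ u ] (uncovered u * α u) ≤ P * b
    leak = ≤-trans (≤-reflexive (sym (∑-*ˡ ℓ _))) (∑-≤-const b uncovered-small)

    covered : ℓ * (N * b ²) ≤ + 2 * P * b ² + ℓ * ∑[ u ] ∑[ v ] (σ u * σ v * M u v)
    covered = begin
      ℓ * (N * b ²)
        ≡⟨ cong (ℓ *_) (sym total) ⟩
      ℓ * ∑[ x ] ∑[ u ] ∑[ v ] τ x u v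
        ≤⟨ *-monoˡ 0≤ℓ (∑-mono (λ x → ∑-mono (λ u → ∑-mono (λ v → pointwise x u v)))) ⟩
      ℓ * ∑[ x ] ∑[ u ] ∑[ v ] (uncovered u * τ x u v + uncovered v * τ x u v + σ u * σ v * (T (x ⊖ u) * T (inv x ⊖ v)))
        ≡⟨ cong (ℓ *_) (trans (∑³-+ _ _) (cong₂ _+_ (trans (∑³-+ _ _) (cong₂ _+_ first second)) third)) ⟩
      ℓ * (b * U + b * U + Σ′)
        ≤⟨ ≤-slack _ (0≤+ 2 · 0≤b · gap leak) (eq ℓ b U Σ′ P) ⟩
      + 2 * P * b ² + ℓ * Σ′ ∎
      where
      open ℤₚ.≤-Reasoning
      τ : Fin p → Fin p → Fin p → ℤ
      τ x u v = f x * (T (x ⊖ u) * T (inv x ⊖ v))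
      U = ∑[ u ] (uncovered u * α u)
      Σ′ = ∑[ u ] ∑[ v ] (σ u * σ v * M u v)
      opaque
        unfolding _+_
        eq : ∀ l b U S P → l * (b * U + b * U + S) + + 2 * b * (P * b - l * U) ≡ + 2 * P * (b * b) + l * S
        eq = solve-∀
      total : ∑[ x ] ∑[ u ] ∑[ v ] τ x u v ≡ N * b ²
      total = trans (∑-cong (λ x → trans (trans (∑-cong (λ u → ∑-*ˡ (f x) _)) (∑-*ˡ (f x) _))
        (cong (f x *_) (trans (∑-product _ _) (cong₂ _*_ (∑T-reflect x) (∑T-reflect (inv x))))))) (∑-*ʳ f (b * b))
      ∑³-+ : ∀ (F G : Fin p → Fin p → Fin p → ℤ) → ∑[ x ] ∑[ u ] ∑[ v ] (F x u v + G x u v)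
        ≡ ∑[ x ] ∑[ u ] ∑[ v ] F x u v + ∑[ x ] ∑[ u ] ∑[ v ] G x u v
      ∑³-+ F G = trans (∑-cong (λ x → trans (∑-cong (λ u → ∑-+ _ _)) (∑-+ _ _))) (∑-+ _ _)
      -- A union bound. Its slack consists of the points of A counted twice because neither `u` nor
      -- `v` is selected, and of points outside A with both selected.
      pointwise : ∀ x u v → τ x u v ≤ uncovered u * τ x u v + uncovered v * τ x u v + σ u * σ v * (T (x ⊖ u) * T (inv x ⊖ v))
      pointwise x u v = ≤-slack _
        (indicator-nonneg f-ind x · 0≤TT · 0≤uncovered u · 0≤uncovered v
          ⊹ gap (indicator-≤1 f-ind x) · 0≤TT · indicator-nonneg σ-ind u · indicator-nonneg σ-ind v)
        (eq′ (f x) (T (x ⊖ u) * T (inv x ⊖ v)) (σ u) (σ v))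
        where
        0≤TT = indicator-nonneg T-ind (x ⊖ u) · indicator-nonneg T-ind (inv x ⊖ v)
        opaque
          unfolding _+_
          eq′ : ∀ f t a c → f * t + (f * t * (1ℤ - a) * (1ℤ - c) + (1ℤ - f) * t * a * c)
            ≡ (1ℤ - a) * (f * t) + (1ℤ - c) * (f * t) + a * c * t
          eq′ = solve-∀
      first : ∑[ x ] ∑[ u ] ∑[ v ] (uncovered u * τ x u v) ≡ b * U
      first = begin-equality
        ∑[ x ] ∑[ u ] ∑[ v ] (uncovered u * τ x u v)
          ≡⟨ ∑-cong (λ x → ∑-cong (λ u → trans (∑-cong (λ v → eq′ (uncovered u) (f x) (T (x ⊖ u)) (T (inv x ⊖ v))))
               (trans (∑-*ˡ _ _) (trans (cong (uncovered u * (f x * T (x ⊖ u)) *_) (∑T-reflect (inv x))) (*-comm _ b))))) ⟩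
        ∑[ x ] ∑[ u ] (b * (uncovered u * (f x * T (x ⊖ u))))
          ≡⟨ trans (∑-comm _) (∑-cong (λ u → trans (∑-*ˡ b _) (cong (b *_) (trans (∑-*ˡ (uncovered u) _) (cong (uncovered u *_) (α-direct u)))))) ⟩
        ∑[ u ] (b * (uncovered u * α u))
          ≡⟨ ∑-*ˡ b _ ⟩
        b * U ∎
        where
        opaque
          unfolding _+_
          eq′ : ∀ a f t t′ → a * (f * (t * t′)) ≡ a * (f * t) * t′
          eq′ = solve-∀
      second : ∑[ x ] ∑[ u ] ∑[ v ] (uncovered v * τ x u v) ≡ b * U
      second = begin-equality
        ∑[ x ] ∑[ u ] ∑[ v ] (uncovered v * τ x u v)
          ≡⟨ ∑-cong (λ x → trans (∑-comm _) (∑-cong (λ v → trans (∑-cong (λ u → eq′ (uncovered v) (f x) (T (x ⊖ u)) (T (inv x ⊖ v))))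
               (trans (∑-*ˡ _ _) (trans (cong (uncovered v * (f x * T (inv x ⊖ v)) *_) (∑T-reflect x)) (*-comm _ b)))))) ⟩
        ∑[ x ] ∑[ v ] (b * (uncovered v * (f x * T (inv x ⊖ v))))
          ≡⟨ trans (∑-comm _) (∑-cong (λ v → trans (∑-*ˡ b _) (cong (b *_) (trans (∑-*ˡ (uncovered v) _) (cong (uncovered v *_) (α-inverse v)))))) ⟩
        ∑[ v ] (b * (uncovered v * α v))
          ≡⟨ ∑-*ˡ b _ ⟩
        b * U ∎
        where
        opaque
          unfolding _+_
          eq′ : ∀ a f t t′ → a * (f * (t * t′)) ≡ a * (f * t′) * t
          eq′ = solve-∀
      third : ∑[ x ] ∑[ u ] ∑[ v ] (σ u * σ v * (T (x ⊖ u) * T (inv x ⊖ v))) ≡ Σ′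
      third = trans (∑-comm _) (∑-cong (λ u → trans (∑-comm _) (∑-cong (λ v → ∑-*ˡ (σ u * σ v) _))))

  module FromContainer (L : ℕ) .{{_ : ℕ.NonZero L}} (90≤L : 90 ℕ.≤ L) (L≤p : L ℕ.≤ p)
    (T : Fin p → ℤ) (T-ind : Indicator T) (Δ : ℤ) (0<Δ : 0ℤ < Δ) (dense : P ≤ Δ * ∑ T)
    (few : Triples.Neighbourhoods.FewTriples 𝔽 f T T-ind (+ L))
    (θ : ℤ) (θ≡ : θ ≡ + 3 * (+ L) ² * Δ ²) (θ⁴≤P : (θ ²) ² ≤ P) where

    open Averaging T T-ind
    ℓ = + L
    open Covering T T-ind ℓ (0≤+ L)
    open Mixing 𝔽 T T-ind using (M; mixing)
    s = ∑ σ
    Σ′ = ∑[ u ] ∑[ v ] (σ u * σ v * M u v)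
    E = P * Σ′ - s ² * b ²
    0<ℓ : 0ℤ < ℓ
    0<ℓ = +<+ (ℕ.>-nonZero⁻¹ L)
    0≤s : 0ℤ ≤ s
    0≤s = ∑-nonneg (indicator-nonneg σ-ind)
    0<b : 0ℤ < b
    0<b = *-cancelˡ-< (<⇒≤ 0<Δ) (<-≤-trans (subst (_< P) (sym (*-zeroʳ Δ)) 0<p) dense)
    0<ℓPb² : 0ℤ < ℓ * P * b ²
    0<ℓPb² = *-pos (*-pos 0<ℓ 0<p) (*-pos 0<b 0<b)
    size : + 3 * ℓ * s ≤ (ℓ + + 9) * P
    size = AlmostSumFree.size-≤ 𝔽 σ σ-ind T T-ind L L≤p 0<b (few σ σ-ind bσ≤ℓα)
    -- With `θ = 3 ℓ² Δ²`, `mixing` bounds `12 ℓ² Δ² E` by `9 P⁴`, and `P ≤ Δ b` turns this into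
    -- `9 Δ² P² b²`; a quarter of the bound is to spare.
    small-error : ℓ ² * E ≤ P ² * b ²
    small-error = *-cancelˡ (*-pos {+ 12} (+<+ (s≤s z≤n)) (*-pos 0<Δ 0<Δ)) (≤-slack _
      (gap (mixing θ θ⁴≤P 0<p σ-ind) ⊹ 0≤+ 9 · square-nonneg P · gap (*-mono (0≤+ p) (<⇒≤ 0<Δ · 0≤b) dense dense)
        ⊹ 0≤+ 3 · square-nonneg Δ · square-nonneg P · square-nonneg b)
      (trans (cong (λ θ → + 12 * (Δ * Δ) * (ℓ ² * E) + (+ 9 * P ^ 4 - + 4 * θ * E + + 9 * P ² * (Δ * b * (Δ * b) - P * P) + + 3 * Δ ² * P ² * b ²)) θ≡)
        (eq′ ℓ P b Δ E)))
      where
      opaque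
        unfolding _+_
        eq′ : ∀ l P b D E → + 12 * (D * D) * (l * l * E) + (+ 9 * (P * (P * (P * (P * 1ℤ)))) - + 4 * (+ 3 * (l * l) * (D * D)) * E
            + + 9 * (P * P) * (D * b * (D * b) - P * P) + + 3 * (D * D) * (P * P) * (b * b)) ≡ + 12 * (D * D) * (P * P * (b * b))
        eq′ = solve-∀
    opaque
      unfolding _+_
      eq : ∀ l P N b s S → l * P * (b * b) * (+ 9 * l * N) + (+ 9 * l * P * (+ 2 * P * (b * b) + l * S - l * (N * (b * b)))
          + + 9 * (P * P * (b * b) - l * l * (P * S - s * s * (b * b)))
          + ((l + + 9) * P * ((l + + 9) * P) - + 3 * l * s * (+ 3 * l * s)) * (b * b)
          + (l - + 90) * (P * P) * (b * b)) ≡ l * P * (b * b) * ((l + + 37) * P)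
      eq = solve-∀

    -- After division by `P b²`, the three estimates add up to `9 ℓ² N ≤ (18 ℓ + 9 + (ℓ + 9)²) P =
    -- (ℓ² + 36 ℓ + 90) P`, and `90 ≤ ℓ` absorbs the constant into `37 ℓ`.
    bound : + 9 * ℓ * N ≤ (ℓ + + 37) * P
    bound = *-cancelˡ 0<ℓPb² (≤-slack _
        (0≤+ 9 · 0≤+ L · 0≤+ p · gap covered
          ⊹ 0≤+ 9 · gap small-error
          ⊹ gap (*-mono (0≤+ 3 · 0≤+ L · 0≤s) ((0≤+ L ⊹ 0≤+ 9) · 0≤+ p) size size) · square-nonneg b
          ⊹ gap (+≤+ 90≤L) · square-nonneg P · square-nonneg b)
        (eq ℓ P N b s Σ′))

  -- Below density 1/9 the claim is immediate; above it, `P ≤ 9 N` is what gives the sampled set its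
  -- density `1 / (2 · 9^(K²))`.
  density-bound : ∀ L .{{_ : ℕ.NonZero L}} → 90 ℕ.≤ L → L ℕ.≤ p → ∀ K → + K ≡ + 6 * (+ L) ^ 5 →
    ∀ θ → θ ≡ + 3 * (+ L) ² * (+ 2 * + 9 ^ (K ℕ* K)) ² → (θ ²) ² ≤ P → + 9 * + L * N ≤ (+ L + + 37) * P
  density-bound L 90≤L L≤p K K≡ θ θ≡ θ⁴≤P = by-density (P ≤? + 9 * N)
    where
    opaque
      unfolding _+_
      eq : ∀ l N P → + 9 * l * N + (l * (P - + 9 * N) + + 37 * P) ≡ (l + + 37) * P
      eq = solve-∀
    0<Δ : 0ℤ < + 2 * + 9 ^ (K ℕ* K)
    0<Δ = *-pos (+<+ (s≤s z≤n)) (^-pos (+<+ (s≤s z≤n)) (K ℕ* K))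
    by-density : Dec (P ≤ + 9 * N) → + 9 * + L * N ≤ (+ L + + 37) * P
    by-density (no P≰9N) = ≤-slack _ (0≤+ L · gap (<⇒≤ (≰⇒> P≰9N)) ⊹ 0≤+ 37 · 0≤+ p) (eq (+ L) N P)
    by-density (yes P≤9N) =
      let T , T-ind , dense , few = ContainerLemma.container-lemma 𝔽 f f-ind f-sum-free (+ L) K (+<+ (ℕ.>-nonZero⁻¹ L)) K≡ P≤9N
      in FromContainer.bound L 90≤L L≤p T T-ind (+ 2 * + 9 ^ (K ℕ* K)) 0<Δ dense few θ θ≡ θ⁴≤P

-- From subsets of residues to indicator functions.

module Translation where

  open import Data.Bool using (Bool; true; false)
  open import Data.Fin.Subset using (Subset; _∈_; ∣_∣)
  open import Data.Nat using (_≤_; _<_; NonZero) renaming (_^_ to infixr 8 _ℕ^_)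
  open import Data.Nat.Primality using (Prime)
  open import Data.Vec using ([]; _∷_; lookup)
  open import Data.Vec.Properties using ([]=⇒lookup; lookup⇒[]=)
  open import Defs
  open Arithmetic hiding (_≤_; _<_)
  open Sums

  bit : Bool → ℤ
  bit true = 1ℤ
  bit false = 0ℤ

  bit-Bit : ∀ x → Bit (bit x)
  bit-Bit true = inj₂ refl
  bit-Bit false = inj₁ refl

  member : ∀ {p} → Subset p → Fin p → ℤ
  member A x = bit (lookup A x)

  ∑-member : ∀ {p} (A : Subset p) → ∑ (member A) ≡ + ∣ A ∣
  ∑-member [] = ∑-zero-dim _
  ∑-member (true ∷ A) = trans (∑-suc _) (trans (cong (_+_ 1ℤ) (∑-member A)) (sym (pos-+ 1 ∣ A ∣)))
  ∑-member (false ∷ A) = trans (∑-suc _) (trans (cong (_+_ 0ℤ) (∑-member A)) (+-identityˡ _))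

  ∈⇒member : ∀ {p} {A : Subset p} {x} → x ∈ A → member A x ≡ 1ℤ
  ∈⇒member x∈A = cong bit ([]=⇒lookup x∈A)

  member⇒∈ : ∀ {p} {A : Subset p} {x} → member A x ≡ 1ℤ → x ∈ A
  member⇒∈ {A = A} {x} in-A with lookup A x in eq
  member⇒∈ {A = A} {x} in-A | true = lookup⇒[]= x A eq

  pos-^ : ∀ m n → + (m ℕ^ n) ≡ (+ m) ^ n
  pos-^ m zero = refl
  pos-^ m (suc n) = trans (pos-* m (m ℕ^ n)) (cong (+ m *_) (pos-^ m n))

  module _ {p : ℕ} (𝔽 : FiniteField.PrimeField p) (A : Subset p) where

    private
      module F = FieldProperties 𝔽
      f = member A
    open F using (_⊕_; _⊗_; inv; ⟦_⟧)

    member-sum-free : SumFree p A → ∀ x y → f x * (f y * f (y ⊕ x)) ≡ 0ℤ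
    member-sum-free sum-free x y with bit-* {f x} (bit-Bit _) (bit-* {f y} {f (y ⊕ x)} (bit-Bit _) (bit-Bit _))
    ... | inj₁ vanishes = vanishes
    ... | inj₂ on with bit-*≡1 {f x} (bit-Bit _) on
    ...   | fx , on′ with bit-*≡1 {f y} (bit-Bit _) on′
    ...     | fy , fyx = contradiction (F.⟦⟧-injective {+ (toℕ y ℕ+ toℕ x)} {+ toℕ (y ⊕ x)} sum-residue) (sum-free y x (y ⊕ x) (member⇒∈ fy) (member⇒∈ fx) (member⇒∈ fyx))
      where
      sum-residue : ⟦ + (toℕ y ℕ+ toℕ x) ⟧ ≡ ⟦ + toℕ (y ⊕ x) ⟧
      sum-residue = trans (cong ⟦_⟧ (ℤₚ.pos-+ (toℕ y) (toℕ x))) (trans (F.⟦⟧-+ _ _)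
        (trans (cong₂ _⊕_ (F.⟦⟧-toℕ y) (F.⟦⟧-toℕ x)) (sym (F.⟦⟧-toℕ (y ⊕ x)))))

    inv-closed : SelfInverse p A → ∀ x → x ∈ A → inv x ∈ A
    inv-closed self-inverse x x∈A with proj₁ (self-inverse x) x∈A
    ... | a , a∈A , ax≡1 = subst (_∈ A) (F.inv-unique (trans (F.⊗-comm x a) a⊗x≡1)) a∈A
      where
      a⊗x≡1 : a ⊗ x ≡ F.I
      a⊗x≡1 = trans (cong₂ _⊗_ (sym (F.⟦⟧-toℕ a)) (sym (F.⟦⟧-toℕ x))) (trans (sym (F.⟦⟧-* _ _))
        (trans (cong ⟦_⟧ (sym (ℤₚ.pos-* (toℕ a) (toℕ x)))) (F.⟦⟧-cong {+ (toℕ a ℕ* toℕ x)} {1ℤ} ax≡1)))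

    member-inv : SelfInverse p A → ∀ x → f (inv x) ≡ f x
    member-inv self-inverse x with bit-Bit (lookup A x) | bit-Bit (lookup A (inv x))
    ... | inj₁ out | inj₁ out′ = trans out′ (sym out)
    ... | inj₂ on | _ = trans (∈⇒member (inv-closed self-inverse x (member⇒∈ on))) (sym on)
    ... | inj₁ out | inj₂ on = contradiction (trans (sym out) (∈⇒member (subst (_∈ A) (F.inv-involutive x)
          (inv-closed self-inverse (inv x) (member⇒∈ on))))) (λ ())

  asymptotic-bound : ∀ L .{{_ : NonZero L}} → 90 ≤ L → ∃ λ P → ∀ p → Prime p → P ≤ p → (A : Subset p) →
    SumFree p A → SelfInverse p A → 9 ℕ* L ℕ* ∣ A ∣ ≤ (L ℕ+ 37) ℕ* p
  -- The summand `θ⁴` serves `mixing`, the summand `L` the rounding of `p / L`.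
  asymptotic-bound L 90≤L = θ ℕ^ 4 ℕ+ L , λ p p-prime large A sum-free self-inverse →
    let 𝔽 = FiniteField.primeField p-prime in
    ℤₚ.drop‿+≤+ (subst₂ Arithmetic._≤_
      (sym (trans (pos-* (9 ℕ* L) ∣ A ∣) (cong₂ _*_ (pos-* 9 L) (sym (∑-member A)))))
      (sym (trans (pos-* (L ℕ+ 37) p) (cong (_* + p) (pos-+ L 37))))
      (DensityBound.density-bound 𝔽 (member A) (λ x → bit-Bit _)
        (member-sum-free 𝔽 A sum-free) (member-inv 𝔽 A self-inverse)
        L 90≤L (ℕ.≤-trans (ℕ.m≤n+m L (θ ℕ^ 4)) large) K K≡ (+ θ) θ≡
        (subst (Arithmetic._≤ + p) (trans (pos-^ θ 4) (eq (+ θ))) (+≤+ (ℕ.≤-trans (ℕ.m≤m+n (θ ℕ^ 4) L) large)))))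
    where
    K = 6 ℕ* L ℕ^ 5
    D = 2 ℕ* 9 ℕ^ (K ℕ* K)
    θ = 3 ℕ* L ℕ^ 2 ℕ* D ℕ^ 2
    K≡ : + K ≡ + 6 * (+ L) ^ 5
    K≡ = trans (pos-* 6 (L ℕ^ 5)) (cong (+ 6 *_) (pos-^ L 5))
    D≡ : + D ≡ + 2 * + 9 ^ (K ℕ* K)
    D≡ = trans (pos-* 2 (9 ℕ^ (K ℕ* K))) (cong (+ 2 *_) (pos-^ 9 (K ℕ* K)))
    square≡ : ∀ n → + (n ℕ^ 2) ≡ (+ n) ²
    square≡ n = trans (pos-^ n 2) (cong (+ n *_) (*-identityʳ (+ n)))
    θ≡ : + θ ≡ + 3 * (+ L) ² * (+ 2 * + 9 ^ (K ℕ* K)) ²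
    θ≡ = trans (pos-* (3 ℕ* L ℕ^ 2) (D ℕ^ 2)) (cong₂ _*_ (trans (pos-* 3 (L ℕ^ 2)) (cong (+ 3 *_) (square≡ L)))
      (trans (square≡ D) (cong _² D≡)))
    opaque
      unfolding _+_
      eq : ∀ t → t * (t * (t * (t * 1ℤ))) ≡ t * t * (t * t)
      eq = solve-∀

-- The theorem, with o(1) made explicit as 1/k for every positive k.

open import Defs
open import Data.Nat using (ℕ; _+_; _*_; _≤_; _<_)
open import Data.Nat.Primality using (Prime)
open import Data.Fin.Subset using (Subset; ∣_∣)
open import Data.Product using (∃-syntax)

theorem3 : (k : ℕ) → 0 < k → ∃[ P ] ((p : ℕ) → Prime p → P ≤ p → (A : Subset p) →
    AvoidsZero p A → SumFree p A → SelfInverse p A →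
    9 * k * ∣ A ∣ ≤ (k + 9) * p)
theorem3 k 0<k =
  -- The multiple `90 * k` is at least 90 for every positive `k`, and its error term `37 / (90 k)`
  -- lies below the permitted `9 / k`.
  let P , bound = Translation.asymptotic-bound (90 * k) (ℕ.m≤m*n 90 k)
  in P , λ p p-prime P≤p A _ sum-free self-inverse → rescale p ∣ A ∣ (bound p p-prime P≤p A sum-free self-inverse)
  where
  import Data.Nat as ℕ
  import Data.Nat.Tactic.RingSolver as ℕ-solver
  instance
    k≢0 : ℕ.NonZero k
    k≢0 = ℕ.>-nonZero 0<k
    90k≢0 : ℕ.NonZero (90 * k)
    90k≢0 = ℕ.m*n≢0 90 k
  rescale : ∀ p N → 9 * (90 * k) * N ≤ (90 * k + 37) * p → 9 * k * N ≤ (k + 9) * p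
  rescale p N bound = ℕ.*-cancelˡ-≤ 90 (begin
    90 * (9 * k * N)     ≡⟨ eq₁ k N ⟩
    9 * (90 * k) * N     ≤⟨ bound ⟩
    (90 * k + 37) * p    ≤⟨ ℕ.*-monoˡ-≤ p (ℕ.+-monoʳ-≤ (90 * k) (ℕ.m≤m+n 37 773)) ⟩
    (90 * k + 90 * 9) * p ≡⟨ eq₂ k p ⟩
    90 * ((k + 9) * p)   ∎)
    where
    open ℕ.≤-Reasoning
    eq₁ : ∀ k N → 90 * (9 * k * N) ≡ 9 * (90 * k) * N
    eq₁ = ℕ-solver.solve-∀
    eq₂ : ∀ k p → (90 * k + 90 * 9) * p ≡ 90 * ((k + 9) * p)
    eq₂ = ℕ-solver.solve-∀
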